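{- Let $D$ be a non-empty fourling shape and let $h$, $v$, $s$ be nonnegative integers. Then $$\sum_{\lambda} I_\lambda = 0,$$ where the sum is taken over all partition shapes $\lambda$ with fourling body $\mathrm{fb}(\lambda)=D$, exactly $s$ squares in the strip of $\lambda$, $\mathrm{hs}(\lambda)=h$ and $\mathrm{vs}(\lambda)=v$.
   Context: A shape $\lambda=(\lambda_1,\lambda_2,\ldots)$ is the Ferrers diagram of an integer partition; square $(r,c)$ is in row $r$ (counted from the top) and column $c$ (counted from the left); $\lambda\vdash n$ means $\lambda$ has $n$ squares. A standard Young tableau (SYT) on an $n$-shape is a filling of its squares with $1,\ldots,n$, each used once, increasing along rows (left to right) and down columns. The sign $\mathrm{sgn}(T)$ of a tableau is the sign of the word obtained by reading its entries row by row, left to right, top to bottom (like a book), where the sign of a word $w_1\cdots w_k$ of distinct integers is $(-1)^{|\{(i,j):i<j,\ w_i>w_j\}|}$. The sign-imbalance is $I_\lambda=\sum_{T\in\mathrm{SYT}(\lambda)}\mathrm{sgn}(T)$. A domino is a $1\times 2$ or $2\times1$ rectangle of two squares; a fourling is a $2\times 2$ square. A fourling shape is a (possibly empty) shape that is a union of fourlings, i.e. a shape $\mu$ with $\mu_{2i-1}=\mu_{2i}$ even for all $i$. The fourling body $\mathrm{fb}(\lambda)$ is the largest fourling shape contained in $\lambda$; the squares of $\lambda$ not in $\mathrm{fb}(\lambda)$ form the strip of $\lambda$. $\mathrm{vs}(\lambda)$ is the maximal number of disjoint vertical dominoes that fit in the strip of $\lambda$, and $\mathrm{hs}(\lambda)=\mathrm{vs}(\lambda')$,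 where $\lambda'$ is the conjugate (transpose) shape. -}

module Defs where

open import Data.Nat using (ℕ; zero; suc; _+_; _≤_; _<_; _<?_; _<ᵇ_; _≥_)
open import Data.Nat.Properties using ()
open import Data.Integer as ℤ using (ℤ; +_; -_)
open import Data.Bool using (Bool; true; false; _∧_)
open import Data.List using (List; []; _∷_; length; filter; map; concatMap; upTo; take; drop; foldr)
open import Data.Nat.ListAction using (sum)
open import Data.List.Relation.Unary.All using (All)
open import Data.List.Relation.Unary.Linked using (Linked)
open import Data.List.Relation.Unary.AllPairs using (AllPairs)
open import Data.Product using (_×_; _,_; ∃; Σ)
open import Data.Sum using (_⊎_)
open import Relation.Binary.PropositionalEquality using (_≡_; _≢_)

-- Shapes.  A shape is the list of its row lengths (λ₁, λ₂, …).
-- Rows and columns are 0-indexed here: square (r , c) lies in the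
-- shape μ iff c < row μ r.

Shape : Set
Shape = List ℕ

row : Shape → ℕ → ℕ
row []       _       = 0
row (x ∷ _)  zero    = x
row (_ ∷ xs) (suc r) = row xs r

IsPartition : Shape → Set
IsPartition μ = All (λ x → 0 < x) μ × Linked _≥_ μ

size : Shape → ℕ
size = sum

_⊆ₛ_ : Shape → Shape → Set
D ⊆ₛ μ = ∀ r c → c < row D r → c < row μ r

-- fourling shape: union of 2×2 squares, i.e. μ_{2i-1} = μ_{2i} even
-- (0-indexed: row 2i = row 2i+1 and it is even)
data Even : ℕ → Set where
  ev0  : Even 0
  ev+2 : ∀ {n} → Even n → Even (suc (suc n))

IsFourlingShape : Shape → Set
IsFourlingShape D =
  IsPartition D × (∀ i → row D (i + i) ≡ row D (suc (i + i)) × Even (row D (i + i)))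

IsFourlingBody : Shape → Shape → Set
IsFourlingBody D μ =
  IsFourlingShape D × D ⊆ₛ μ × (∀ E → IsFourlingShape E → E ⊆ₛ μ → E ⊆ₛ D)

InStrip : Shape → Shape → ℕ × ℕ → Set
InStrip D μ (r , c) = c < row μ r × ¬D
  where ¬D = row D r ≤ c

-- a vertical domino is given by its top square (r , c); it covers
-- (r , c) and (r+1 , c).  Two such dominoes are disjoint iff they lie in
-- different columns or their top rows differ by at least 2.
DisjointV : ℕ × ℕ → ℕ × ℕ → Set
DisjointV (r , c) (r' , c') = (c ≢ c') ⊎ (suc r < r' ⊎ suc r' < r)

IsVPacking : Shape → Shape → List (ℕ × ℕ) → Set
IsVPacking D μ ps =
  All (λ p → InStrip D μ p × InStrip D μ (suc (Data.Product.proj₁ p) , Data.Product.proj₂ p)) ps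
  × AllPairs DisjointV ps

VS : Shape → ℕ → Set
VS μ v = Σ Shape λ D → IsFourlingBody D μ
  × (Σ (List (ℕ × ℕ)) λ ps → IsVPacking D μ ps × length ps ≡ v)
  × (∀ ps → IsVPacking D μ ps → length ps ≤ v)

conj : Shape → Shape
conj μ = map (λ c → length (filter (c <?_) μ)) (upTo (row μ 0))

HS : Shape → ℕ → Set
HS μ h = VS (conj μ) h

-- Standard Young tableaux and sign-imbalance.
-- A filling of μ ⊢ n with 1..n (each once) is identified with its
-- reading word (rows read left to right, top to bottom), which is a
-- permutation of 1..n.

insertions : ℕ → List ℕ → List (List ℕ)
insertions x []       = (x ∷ []) ∷ []
insertions x (y ∷ ys) = (x ∷ y ∷ ys) ∷ map (y ∷_) (insertions x ys)

perms : List ℕ → List (List ℕ)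
perms []       = [] ∷ []
perms (x ∷ xs) = concatMap (insertions x) (perms xs)

rowsOf : Shape → List ℕ → List (List ℕ)
rowsOf []       w = []
rowsOf (k ∷ μ)  w = take k w ∷ rowsOf μ (drop k w)

increasing : List ℕ → Bool
increasing []           = true
increasing (x ∷ [])     = true
increasing (x ∷ y ∷ ys) = (x <ᵇ y) ∧ increasing (y ∷ ys)

colsOK : List ℕ → List ℕ → Bool
colsOK _        []       = true
colsOK []       (_ ∷ _)  = false
colsOK (a ∷ as) (b ∷ bs) = (a <ᵇ b) ∧ colsOK as bs

allRowsIncr : List (List ℕ) → Bool
allRowsIncr []       = true
allRowsIncr (R ∷ Rs) = increasing R ∧ allRowsIncr Rs

allColsIncr : List (List ℕ) → Bool
allColsIncr []            = true
allColsIncr (R ∷ [])      = true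
allColsIncr (R ∷ S ∷ Rs)  = colsOK R S ∧ allColsIncr (S ∷ Rs)

isSYT : Shape → List ℕ → Bool
isSYT μ w = allRowsIncr (rowsOf μ w) ∧ allColsIncr (rowsOf μ w)

inversions : List ℕ → ℕ
inversions []       = 0
inversions (x ∷ xs) = length (filter (_<? x) xs) + inversions xs

signOf : ℕ → ℤ
signOf zero          = + 1
signOf (suc zero)    = - (+ 1)
signOf (suc (suc k)) = signOf k

sgn : List ℕ → ℤ
sgn w = signOf (inversions w)

sumℤ : List ℤ → ℤ
sumℤ = foldr ℤ._+_ (+ 0)

signImbalance : Shape → ℤ
signImbalance μ =
  sumℤ (map (λ w → if isSYT μ w then sgn w else + 0) (perms (map suc (upTo (size μ)))))
  where open import Data.Bool using (if_then_else_)

{-# OPTIONS --safe #-}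
module Submission where

-- Encode a shape by its boundary word, read from the top: a row is a letter 1, a column a letter 0, and
-- adding a cell replaces 01 by 10.  If u denotes signed cell addition, then the sum of f(λ) I_λ over all
-- λ ⊢ n is (uⁿ f)(∅).  Two cells that do not form a domino cancel against the opposite order, so u² only
-- adds dominoes.  With rows and columns numbered from 0, vs(λ) counts the rows of odd index and odd length,
-- hs(λ) the columns of odd index and odd length, and rows 2i and 2i+1 of fb(λ) are 2⌊λ_{2i+1}/2⌋.  Hence, after cutting the word
-- into pairs of letters (sites), f_D(λ) = [fb(λ) = D] x^hs q^vs is a product of local transfer matrices
-- with two states (inside or outside a row pair), one label S0 or S2 per site recording D.
--
-- Add two labels lU and lD which double, respectively halve, an auxiliary space.  On words that start
-- with 00 and end with 11 the functionals of all label lists satisfy u² f = (q + x) f + Σ ± f′, where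
-- every f′ contains a label lU; this telescopes from exchange relations between neighbouring labels.
-- Functionals containing lU vanish at the empty shape and at the single cell, and so does f_D
-- for D ≠ ∅, hence uⁿ f_D(∅) = 0 by induction.  As q and x are arbitrary integers, each coefficient of
-- x^h q^v vanishes separately.

open import Defs
open import Data.Bool using (Bool; true; false; not; _∧_; if_then_else_)
open import Data.Bool.Properties using (∧-assoc; ∧-comm; not-involutive)
open import Data.Empty using (⊥; ⊥-elim)
open import Data.Integer as ℤ using (ℤ; +_; -[1+_]; _^_) renaming (_+_ to _+ᶻ_; _*_ to _*ᶻ_; -_ to -ᶻ_)
import Data.Integer.Properties as ℤₚ
open import Data.Integer.Tactic.RingSolver using (solve-∀)
open import Data.List using (List; []; _∷_; _++_; _∷ʳ_; applyUpTo; concatMap; drop; filter; foldr; initLast; _∷ʳ′_; length; map; replicate; take; upTo)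
open import Data.List.Membership.Propositional using (_∈_)
open import Data.List.Properties using (++-assoc; ∷-injectiveʳ; filter-++; filter-accept; filter-all; filter-reject; length-++; length-map; length-replicate; length-take; length-upTo; map-++; map-upTo; map-∘; take++drop≡id; upTo-∷ʳ)
open import Data.List.Relation.Unary.All as All using (All; []; _∷_)
open import Data.List.Relation.Unary.All.Properties as Allₚ using (++⁺; take⁺; drop⁺)
open import Data.List.Relation.Unary.AllPairs using (AllPairs; []; _∷_)
import Data.List.Relation.Unary.AllPairs.Properties as AllPairsₚ
open import Data.List.Relation.Unary.Any using (here; there)
open import Data.List.Relation.Unary.Linked using (Linked; []; [-]; _∷_)
import Data.List.Relation.Unary.Linked.Properties as Linkedₚ
open import Data.List.Relation.Unary.Unique.Propositional using (Unique)
open import Data.Nat as ℕ using (ℕ; zero; suc; _+_; _∸_; _≤_; _<_; _≥_; _<?_; _<ᵇ_; _≡ᵇ_; ⌊_/2⌋; s≤s; z≤n)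
import Data.Nat.Divisibility as ℕ∣
open import Data.Nat.ListAction using (sum)
import Data.Nat.Properties as ℕₚ
open import Data.Nat.Tactic.RingSolver using () renaming (solve-∀ to ℕsolve-∀)
open import Data.Product using (_×_; _,_; proj₁; proj₂; ∃-syntax)
open import Data.Sum using (_⊎_; inj₁; inj₂)
open import Data.Unit using (⊤; tt)
open import Function using (_∘_)
open import Function.Bundles using (_⇔_; Equivalence)
open import Relation.Binary.PropositionalEquality using (_≡_; _≢_; refl; sym; trans; cong; cong₂; subst; subst₂; module ≡-Reasoning)
open import Relation.Nullary using (¬_; Dec; yes; no)

-- Products of `lS0` and `lS2` are not closed under the addition of two cells: at a removable
-- fourling of the body, the labels `lS2 lS0`, the domino sum leaves a remainder that is factored
-- through a space twice as large; `lU` and `lD` are the two factors. Further additions nest such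
-- factors, so spaces of every depth occur. Doubling a representation reverses the sign `e` in its
-- relations and preserves their form, so the sixteen exchange relations, one for each ordered pair
-- of labels, are checked generically for two signs and then hold at every depth. Replacing `lU lU`
-- or `lD lD` by `lS0 lS2` shifts the depth by two; invariant maps between a space and its double
-- double, which pass through all labels, repair this. The remainders are never identified with
-- weights of shapes: it suffices that a label `lU` persists in them. The box around the shapes is
-- so large that the first two and the last two letters stay fixed; there the boundary terms of the
-- telescoping sum are x and -q times the functional itself, whence the factor q + x.

-- A word algebra with a sign, its doubling, and a normaliser.

module TermAlgebra where

  -- ad, ah map the outside space of a representation to its inside space, ld, lh map it back; zz and ww
  -- are the endomorphisms of the inside and outside spaces that appear in the relations `ruleL = ruleR`.
  data Letter : Set where
    ad ah ld lh zz ww : Letter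

  data Tm : Set where
    var         : List Bool → Tm
    tz          : Tm
    _t+_        : Tm → Tm → Tm
    tneg tq tx  : Tm → Tm
    tl          : Letter → Tm → Tm

  infixl 6 _t+_ _t-_

  _t-_ : Tm → Tm → Tm
  a t- b = a t+ tneg b

  tsg : Bool → Tm → Tm
  tsg true  t = t
  tsg false t = tneg t

  sub : (List Bool → Tm) → Tm → Tm
  sub σ (var p)  = σ p
  sub σ tz       = tz
  sub σ (a t+ b) = sub σ a t+ sub σ b
  sub σ (tneg a) = tneg (sub σ a)
  sub σ (tq a)   = tq (sub σ a)
  sub σ (tx a)   = tx (sub σ a)
  sub σ (tl l a) = tl l (sub σ a)

  -- The letters acting on pairs (var [false] , var [true]): if the letters satisfy the relations with
  -- sign e, these expressions satisfy them with sign `not e`.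
  tab : Bool → Letter → Tm × Tm
  tab e l = go l
    where
    v1 v2 : Tm
    v1 = var (false ∷ [])
    v2 = var (true ∷ [])
    _·_ : Letter → Tm → Tm
    _·_ = tl
    infixr 8 _·_
    tqx : Tm → Tm
    tqx t = tq (tx t)
    go : Letter → Tm × Tm
    go ad = tq (ad · v1) t+ tx (ad · v1) t- tqx (ad · ww · v1) t- ad · ld · ad · v2
          , tsg (not e) (ah · v1 t- tx (zz · ah · v1)) t- zz · ad · v2
    go ah = tsg e (tq (ah · v1) t- tx (ah · v1) t- tqx (zz · ah · v1)) t+ ad · v2 t+ tq (zz · ad · v2)
          , tsg e (ah · ww · v2) t- ah · lh · ah · v1
    go ld = tsg e (ld · zz · v1 t+ ld · ad · ld · v2)
          , tsg e (tq (lh · zz · v1) t- lh · v1 t+ tq (ld · v2) t+ tx (ld · v2) t+ tqx (ww · ld · v2))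
    go lh = ww · lh · v1 t- ld · v2 t- tx (ww · ld · v2)
          , tx (lh · v2) t- tq (lh · v2) t- tqx (lh · zz · v2) t- tsg e (lh · ah · lh · v1)
    go zz = zz · v1 t+ ad · ld · v2 t+ ad · ld · v2 , zz · v2
    go ww = ww · v1 , ww · v2 t- tsg e (lh · ah · v1 t+ lh · ah · v1)

  pick : ∀ {A : Set} → A × A → Bool → A
  pick (a , b) false = a
  pick (a , b) true  = b

  pairσ : Tm × Tm → List Bool → Tm
  pairσ e (b ∷ []) = pick e b
  pairσ e _        = tz

  -- The two components of a term of the doubled representation, written over the original one. The
  -- bit put in front of a variable name selects the component of that variable.
  expand : Bool → Tm → Tm × Tm
  expand e (var p)  = var (false ∷ p) , var (true ∷ p)
  expand e tz       = tz , tz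
  expand e (a t+ b) = proj₁ (expand e a) t+ proj₁ (expand e b) , proj₂ (expand e a) t+ proj₂ (expand e b)
  expand e (tneg a) = tneg (proj₁ (expand e a)) , tneg (proj₂ (expand e a))
  expand e (tq a)   = tq (proj₁ (expand e a)) , tq (proj₂ (expand e a))
  expand e (tx a)   = tx (proj₁ (expand e a)) , tx (proj₂ (expand e a))
  expand e (tl l a) = sub (pairσ (expand e a)) (proj₁ (tab e l)) , sub (pairσ (expand e a)) (proj₂ (tab e l))

  data Rule : Set where
    lhad ldah adlh ahld adz ahz lhw ldw : Rule

  ruleL : Rule → Tm
  ruleL lhad = tl ad (tl lh (var []))
  ruleL ldah = tl ah (tl ld (var []))
  ruleL adlh = tl lh (tl ad (var []))
  ruleL ahld = tl ld (tl ah (var []))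
  ruleL adz  = tl zz (tl ad (var []))
  ruleL ahz  = tl zz (tl ah (var []))
  ruleL lhw  = tl ww (tl lh (var []))
  ruleL ldw  = tl ww (tl ld (var []))

  -- Up to sign, `lh` inverts `ad` and `ld` inverts `ah`, with `zz` and `ww` measuring the defect;
  -- the last four rules carry `zz` and `ww` across the other letters.
  ruleR : Bool → Rule → Tm
  ruleR e lhad = var [] t- tx (tl zz (var []))
  ruleR e ldah = tsg e (var [] t- tq (tl zz (var [])))
  ruleR e adlh = var [] t+ tx (tl ww (var []))
  ruleR e ahld = tsg e (var [] t- tq (tl ww (var [])))
  ruleR e adz  = tneg (tl ad (tl ww (var [])))
  ruleR e ahz  = tl ah (tl ww (var []))
  ruleR e lhw  = tneg (tl lh (tl zz (var [])))
  ruleR e ldw  = tl ld (tl zz (var []))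

  -- The monomial c qᵃ xᵇ w(v); the letter applied last is at the head of w.
  record Mono : Set where
    constructor mono
    field
      co : ℤ
      qe xe : ℕ
      wd : List Letter
      vr : List Bool

  Poly : Set
  Poly = List Mono

  eqL : Letter → Letter → Bool
  eqL ad ad = true
  eqL ah ah = true
  eqL ld ld = true
  eqL lh lh = true
  eqL zz zz = true
  eqL ww ww = true
  eqL _  _  = false

  eqN : ℕ → ℕ → Bool
  eqN zero zero = true
  eqN (suc m) (suc n) = eqN m n
  eqN _ _ = false

  eqB : Bool → Bool → Bool
  eqB true true = true
  eqB false false = true
  eqB _ _ = false

  eqs : ∀ {A : Set} → (A → A → Bool) → List A → List A → Bool
  eqs e [] [] = true
  eqs e (a ∷ as) (b ∷ bs) = e a b ∧ eqs e as bs
  eqs e _ _ = false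

  eqK : Mono → Mono → Bool
  eqK (mono _ a b w v) (mono _ a′ b′ w′ v′) =
    eqs eqL w w′ ∧ (eqN a a′ ∧ (eqN b b′ ∧ eqs eqB v v′))

  -- Zero coefficients are dropped at once, since `null` recognises zero only as the empty list.
  consNZ : Mono → Poly → Poly
  consNZ (mono (+ 0) _ _ _ _) p = p
  consNZ m                    p = m ∷ p

  addM : Mono → Mono → Mono
  addM m n = record n { co = Mono.co m +ᶻ Mono.co n }

  insM : Mono → Poly → Poly
  insM m []      = consNZ m []
  insM m (n ∷ p) = if eqK m n then consNZ (addM m n) p else n ∷ insM m p

  _p+_ : Poly → Poly → Poly
  []      p+ r = r
  (m ∷ p) p+ r = insM m (p p+ r)

  scM : ℤ → ℕ → ℕ → Mono → Mono
  scM c a b (mono c′ a′ b′ w v) = mono (c *ᶻ c′) (a ℕ.+ a′) (b ℕ.+ b′) w v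

  consW : Letter → Mono → Mono
  consW l m = record m { wd = l ∷ Mono.wd m }

  sgz : Bool → ℤ
  sgz true  = + 1
  sgz false = -[1+ 0 ]

  -- Normal words have `zz` and `ww` as close to the variable as the rules `adz`, `ahz`, `lhw`,
  -- `ldw` can bring them.
  appZ appW : List Letter → List Bool → Poly
  appZ (ad ∷ w) v = map (λ m → scM -[1+ 0 ] 0 0 (consW ad m)) (appW w v)
  appZ (ah ∷ w) v = map (consW ah) (appW w v)
  appZ w        v = mono (+ 1) 0 0 (zz ∷ w) v ∷ []
  appW (lh ∷ w) v = map (λ m → scM -[1+ 0 ] 0 0 (consW lh m)) (appZ w v)
  appW (ld ∷ w) v = map (consW ld) (appZ w v)
  appW w        v = mono (+ 1) 0 0 (ww ∷ w) v ∷ []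

  app : Bool → Letter → List Letter → List Bool → Poly
  app e zz w        v = appZ w v
  app e ww w        v = appW w v
  app e ad (lh ∷ w) v = mono (+ 1) 0 0 w v ∷ map (scM -[1+ 0 ] 0 1) (appZ w v)
  app e ah (ld ∷ w) v = mono (sgz e) 0 0 w v ∷ map (scM (-ᶻ sgz e) 1 0) (appZ w v)
  app e lh (ad ∷ w) v = mono (+ 1) 0 0 w v ∷ map (scM (+ 1) 0 1) (appW w v)
  app e ld (ah ∷ w) v = mono (sgz e) 0 0 w v ∷ map (scM (-ᶻ sgz e) 1 0) (appW w v)
  app e l  w        v = mono (+ 1) 0 0 (l ∷ w) v ∷ []

  appP : Bool → Letter → Poly → Poly
  appP e l []                   = []
  appP e l (mono c a b w v ∷ p) = map (scM c a b) (app e l w v) p+ appP e l p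

  nf : Bool → Tm → Poly
  nf e (var p)  = mono (+ 1) 0 0 [] p ∷ []
  nf e tz       = []
  nf e (a t+ b) = nf e a p+ nf e b
  nf e (tneg a) = map (scM -[1+ 0 ] 0 0) (nf e a)
  nf e (tq a)   = map (scM (+ 1) 1 0) (nf e a)
  nf e (tx a)   = map (scM (+ 1) 0 1) (nf e a)
  nf e (tl l a) = appP e l (nf e a)

  null : Poly → Bool
  null [] = true
  null (_ ∷ _) = false

  -- The value `true` proves the equation in every representation of sign `e` (`chk-sound`); `false`
  -- carries no information.
  chk : Bool → Tm → Tm → Bool
  chk e s t = null (nf e (s t- t))

  chk₁ : Bool → Tm × Tm → Tm × Tm → Bool
  chk₁ e s t = chk e (proj₁ s) (proj₁ t) ∧ chk e (proj₂ s) (proj₂ t)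

  allRules : (Rule → Bool) → Bool
  allRules f = f lhad ∧ (f ldah ∧ (f adlh ∧ (f ahld ∧ (f adz ∧ (f ahz ∧ (f lhw ∧ f ldw))))))

-- Transfer matrices and the finite table of exchange relations.

module Tables where

  open TermAlgebra

  -- The pairs of letters 00, 10, 01, 11 of the boundary word.
  data Site : Set where
    s0 su sd st : Site

  data St : Set where
    o i : St

  flip : St → St
  flip o = i
  flip i = o

  data Kind : Set where
    sk uk : Kind

  nx : Kind → St → Site → St
  nx sk c s0 = c
  nx sk c st = c
  nx sk c su = flip c
  nx sk c sd = flip c
  nx uk c s0 = flip c
  nx uk c st = flip c
  nx uk c su = c
  nx uk c sd = c

  -- Parity of the zeros still to be read, recovered from the sign of the depth and the state. An
  -- `sk` label keeps the depth and flips the state at sites with one 0; a `uk` label reverses the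
  -- sign and flips the state at the other sites. Either way `eta` changes exactly at sites with one
  -- 0.
  eta : Bool → St → Bool
  eta e o = e
  eta e i = not e

  -- Domino additions across two neighbouring sites; η tells whether the number of letters 0 after them is even.
  moves : Bool → Site → Site → List (Bool × Site × Site)
  moves η s0 su = (true , su , s0) ∷ []
  moves η s0 sd = (true , sd , s0) ∷ []
  moves η sd su = (not η , st , s0) ∷ []
  moves η su sd = (true , st , s0) ∷ []
  moves η s0 st = (true , su , sd) ∷ (η , sd , su) ∷ []
  moves η sd st = (η , st , sd) ∷ []
  moves η su st = (η , st , su) ∷ []
  moves η _  _  = []

  private
    v v1 v2 : Tm
    v = var []
    v1 = var (false ∷ [])
    v2 = var (true ∷ [])

  -- Transfer matrices (t) and the boundary terms (g) through which the domino sum telescopes.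
  tS0 gS0 tS2 gS2 : Bool → St → Site → Tm
  tS0 e o s0 = v
  tS0 e i s0 = tx v
  tS0 e o su = tx (tl ah v)
  tS0 e o sd = tl ad v
  tS0 e _ _  = tz
  gS0 e o s0 = tx v
  gS0 e _ _  = tz
  tS2 e o st = tsg e v
  tS2 e i st = tq v
  tS2 e i su = tq (tl lh v)
  tS2 e i sd = tl ld v
  tS2 e _ _  = tz
  gS2 e o st = tneg (tsg e (tq v))
  gS2 e _ _  = tz

  -- Together with `tDn` a factorisation of the remainder of `S2` followed by `S0`: it equals `tDn`
  -- after `tUp` (relation `p20`).
  tUp gUp : Bool → St → Site → Tm × Tm
  tUp e o su = tsg e v , tz
  tUp e o sd = tz , tneg v
  tUp e o st = tsg e (tq (tl ad v)) , tneg (tl ah v)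
  tUp e i s0 = tl ld v , tq (tl lh v)
  tUp e i su = tq (tx v) , tz
  tUp e i sd = tz , tneg v
  tUp e _ _  = tz , tz
  gUp e o su = tsg e (tx v) t- tx (tl ld (tl ah v)) , tneg (tq (tx (tl lh (tl ah v))))
  gUp e o sd = tneg (tl ld (tl ad v)) , tneg (tx v t+ tq (tl lh (tl ad v)))
  gUp e _ _  = tz , tz

  tDn gDn : Bool → St → Site → Tm
  tDn e o sd = v1
  tDn e o su = v2
  tDn e o st = tl ad v2 t- tsg e (tx (tl ah v1))
  tDn e i sd = v1
  tDn e i su = tneg (tsg e (tq (tx v2)))
  tDn e i s0 = tl lh v1 t- tx (tl ld v2)
  tDn e _ _  = tz
  gDn e o sd = tl ld (tl ad v2) t- tq v1 t- tsg e (tx (tl ld (tl ah v1)))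
  gDn e o su = tq (tl lh (tl ad v2)) t- tq v2 t- tsg e (tq (tx (tl lh (tl ah v1))))
  gDn e _ _  = tz

  L₁ L₂ : Set
  L₁ = Tm × Tm
  L₂ = L₁ × L₁

  pairσ₂ : L₂ → List Bool → Tm
  pairσ₂ t (b′ ∷ b ∷ []) = pick (pick t b) b′
  pairσ₂ t _             = tz

  oneσ : Tm → List Bool → Tm
  oneσ t []      = t
  oneσ t (_ ∷ _) = tz

  ap₀ : Tm → Tm → Tm
  ap₀ T t = sub (oneσ t) T

  ap₁ : Bool → Tm → L₁ → L₁
  ap₁ e T t = sub (pairσ t) (proj₁ (expand e T)) , sub (pairσ t) (proj₂ (expand e T))

  up₀ : Tm × Tm → Tm → L₁
  up₀ (A , B) t = ap₀ A t , ap₀ B t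
  up₁ : Bool → Tm × Tm → L₁ → L₂
  up₁ e (A , B) t = ap₁ e A t , ap₁ e B t
  dn₀ : Tm → L₁ → Tm
  dn₀ T t = sub (pairσ t) T
  dn₁ : Bool → Tm → L₂ → L₁
  dn₁ e T t = sub (pairσ₂ t) (proj₁ (expand e T)) , sub (pairσ₂ t) (proj₂ (expand e T))
  -- Tensoring with an invariant element of the two added factors of dimension two, antisymmetric or
  -- symmetric according to `e`. `K₀` is the contraction in the opposite direction.
  J₀ : Bool → Tm → L₂
  J₀ e t = (tz , t) , (tsg (not e) t , tz)
  K₀ : Bool → L₂ → Tm
  K₀ e ((a , b) , (c , d)) = b t+ tsg e c

  add₁ : L₁ → L₁ → L₁
  add₁ (a , b) (c , d) = a t+ c , b t+ d
  add₂ : L₂ → L₂ → L₂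
  add₂ (a , b) (c , d) = add₁ a c , add₁ b d
  sg₁ : Bool → L₁ → L₁
  sg₁ b (x , y) = tsg b x , tsg b y
  sg₂ : Bool → L₂ → L₂
  sg₂ b (x , y) = sg₁ b x , sg₁ b y
  z₁ : L₁
  z₁ = tz , tz
  z₂ : L₂
  z₂ = z₁ , z₁

  chk₂ : Bool → L₂ → L₂ → Bool
  chk₂ e (a , b) (c , d) = chk₁ e a c ∧ chk₁ e b d

  all4 : (Site → Bool) → Bool
  all4 f = f s0 ∧ (f su ∧ (f sd ∧ f st))
  all32 : (St → Site → Site → Bool) → Bool
  all32 f = all4 (λ s → all4 (λ t → f o s t)) ∧ all4 (λ s → all4 (λ t → f i s t))

  -- In `pr`, P and Q are the transfer matrices of two neighbouring labels and `low` is the lowered term.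
  module Chk {X Y Z : Set} (add : Z → Z → Z) (sg : Bool → Z → Z) (zr : Z) (ck : Z → Z → Bool) where
    pr : Kind → Kind → Bool → (P gP : St → Site → X → Y) (Q gQ : St → Site → Y → Z) (low : St → Site → Site → X → Z) → X → St → Site → Site → Bool
    pr kP kQ e P gP Q gQ low x c s t =
      ck (add (foldr (λ m a → add (sg (proj₁ m) (Q (nx kP c (proj₁ (proj₂ m))) (proj₂ (proj₂ m)) (P c (proj₁ (proj₂ m)) x))) a) zr
                (moves (eta e (nx kQ (nx kP c s) t)) s t))
              (gQ (nx kP c s) t (P c s x)))
         (add (Q (nx kP c s) t (gP c s x)) (low c s t x))

  module Checks (e : Bool) where
    e′ = not e
    S0 g0 S2 g2 : St → Site → Tm → Tm
    S0 c s = ap₀ (tS0 e c s)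
    g0 c s = ap₀ (gS0 e c s)
    S2 c s = ap₀ (tS2 e c s)
    g2 c s = ap₀ (gS2 e c s)
    S0′ g0′ S2′ g2′ : St → Site → L₁ → L₁
    S0′ c s = ap₁ e (tS0 e′ c s)
    g0′ c s = ap₁ e (gS0 e′ c s)
    S2′ c s = ap₁ e (tS2 e′ c s)
    g2′ c s = ap₁ e (gS2 e′ c s)
    U gU : St → Site → Tm → L₁
    U c s = up₀ (tUp e c s)
    gU c s = up₀ (gUp e c s)
    U′ gU′ : St → Site → L₁ → L₂
    U′ c s = up₁ e (tUp e′ c s)
    gU′ c s = up₁ e (gUp e′ c s)
    D gD : St → Site → L₁ → Tm
    D c s = dn₀ (tDn e c s)
    gD c s = dn₀ (gDn e c s)
    D′ gD′ : St → Site → L₂ → L₁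
    D′ c s = dn₁ e (tDn e′ c s)
    gD′ c s = dn₁ e (gDn e′ c s)
    x0 : Tm
    x0 = var []
    x1 : L₁
    x1 = v1 , v2
    x2 : L₂
    x2 = (var (false ∷ false ∷ []) , var (true ∷ false ∷ [])) , (var (false ∷ true ∷ []) , var (true ∷ true ∷ []))
    module K0 {X Y} = Chk {X} {Y} _t+_ tsg tz (chk e)
    module K1 {X Y} = Chk {X} {Y} add₁ sg₁ z₁ (chk₁ e)
    module K2 {X Y} = Chk {X} {Y} add₂ sg₂ z₂ (chk₂ e)
    no0 : ∀ {X : Set} → St → Site → Site → X → Tm
    no0 _ _ _ _ = tz
    no1 : ∀ {X : Set} → St → Site → Site → X → L₁
    no1 _ _ _ _ = z₁
    c00 : St → Site → Site → Bool
    c00 = K0.pr sk sk e S0 g0 S0 g0 no0 x0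
    p00 = all32 c00
    c22 : St → Site → Site → Bool
    c22 = K0.pr sk sk e S2 g2 S2 g2 no0 x0
    p22 = all32 c22
    c02 : St → Site → Site → Bool
    c02 = K0.pr sk sk e S0 g0 S2 g2 no0 x0
    p02 = all32 c02
    -- Among `S0` and `S2` only this order leaves a remainder: a row pair followed by a column pair
    -- is a removable fourling of the body.
    c20 : St → Site → Site → Bool
    c20 = K0.pr sk sk e S2 g2 S0 g0 (λ c s t x → D (nx uk c s) t (U c s x)) x0
    p20 = all32 c20
    c0U : St → Site → Site → Bool
    c0U = K1.pr sk uk e′ S0 g0 U gU no1 x0
    p0U = all32 c0U
    c2U : St → Site → Site → Bool
    c2U = K1.pr sk uk e′ S2 g2 U gU (λ c s t x → sg₁ e (S2′ (nx uk c s) t (U c s x))) x0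
    p2U = all32 c2U
    cU0 : St → Site → Site → Bool
    cU0 = K1.pr uk sk e′ U gU S0′ g0′ (λ c s t x → U (nx sk c s) t (S0 c s x)) x0
    pU0 = all32 cU0
    cU2 : St → Site → Site → Bool
    cU2 = K1.pr uk sk e′ U gU S2′ g2′ no1 x0
    pU2 = all32 cU2
    cUD : St → Site → Site → Bool
    cUD = K0.pr uk uk e U gU D gD no0 x0
    pUD = all32 cUD
    cD0 : St → Site → Site → Bool
    cD0 = K0.pr uk sk e D gD S0 g0 (λ c s t x → D (nx sk c s) t (S0′ c s x)) x1
    pD0 = all32 cD0
    cD2 : St → Site → Site → Bool
    cD2 = K0.pr uk sk e D gD S2 g2 no0 x1
    pD2 = all32 cD2
    c0D : St → Site → Site → Bool
    c0D = K0.pr sk uk e S0′ g0′ D gD no0 x1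
    p0D = all32 c0D
    c2D : St → Site → Site → Bool
    c2D = K0.pr sk uk e S2′ g2′ D gD (λ c s t x → tsg e′ (S2 (nx uk c s) t (D c s x))) x1
    p2D = all32 c2D
    cDU : St → Site → Site → Bool
    cDU = K1.pr uk uk e′ D gD U gU (λ c s t x → sg₁ e (S2′ (nx sk c s) t (S0′ c s x))) x1
    pDU = all32 cDU
    -- The remainder fills the two doublings opened by `U` and `U′` with the invariant element only,
    -- so `S0` and `S2` act at the original depth.
    cUU : St → Site → Site → Bool
    cUU = K2.pr uk uk e U gU U′ gU′ (λ c s t x → sg₂ e (J₀ e (S2 (nx sk c s) t (S0 c s x)))) x0
    pUU = all32 cUU
    cDD : St → Site → Site → Bool
    cDD = K0.pr uk uk e D′ gD′ D gD (λ c s t x → S2 (nx sk c s) t (S0 c s (K₀ e x))) x2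
    pDD = all32 cDD
    allS : (St → Site → Bool) → Bool
    allS f = all4 (f o) ∧ all4 (f i)
    -- With `ckU` below this bends the depth-changing labels: the invariant element followed by `lD`
    -- leaves `lU`, and `lU` followed by the contraction leaves `lD`, up to sign.
    cjD : St → Site → Bool
    cjD = λ c s → chk₁ e (D′ c s (J₀ e x0)) (sg₁ false (U c s x0))
    jD = allS cjD
    ckU : St → Site → Bool
    ckU = λ c s → chk e (K₀ e (U′ c s x1)) (tsg e′ (D c s x1))
    kU = allS ckU
    allL : (Letter → Bool) → Bool
    allL f = f ad ∧ (f ah ∧ (f ld ∧ (f lh ∧ (f zz ∧ f ww))))
    -- Since `J₀` and, by `ckl`, `K₀` commute with the letters, they commute with every term and
    -- hence slide through all labels.
    cjl : Letter → Bool
    cjl = λ l → chk₂ e (dn₁ e (proj₁ (tab e′ l)) (J₀ e x0) , dn₁ e (proj₂ (tab e′ l)) (J₀ e x0)) (J₀ e (tl l x0))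
    jl = allL cjl
    ckl : Letter → Bool
    ckl = λ l → chk e (K₀ e (dn₁ e (proj₁ (tab e′ l)) x2 , dn₁ e (proj₂ (tab e′ l)) x2)) (tl l (K₀ e x2))
    kl = allL ckl
    allHold : Bool
    allHold = p00 ∧ (p22 ∧ (p02 ∧ (p20 ∧ (p0U ∧ (p2U ∧ (pU0 ∧ (pU2 ∧ (pUD ∧ (pD0 ∧ (pD2 ∧ (p0D ∧ (p2D ∧ (pDU ∧ (pUU ∧ (pDD ∧ (jD ∧ (kU ∧ (jl ∧ kl))))))))))))))))))

  -- All exchange relations are decided by normalising both sides.
  allHold-holds : ∀ e → Checks.allHold e ≡ true
  allHold-holds true  = refl
  allHold-holds false = refl

-- Representations, soundness of the normaliser, and laws of the double.

module Semantics (q x : ℤ) where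

  open TermAlgebra
  open Tables

  -- The laws are kept apart: `dbl` is defined on bare operations, and the laws of the double are
  -- derived afterwards from those of the original by normalisation.
  record Raw : Set₁ where
    infixl 6 _⊕_
    field
      C   : Set
      𝟘   : C
      _⊕_ : C → C → C
      zs  : ℤ → C → C
      act : Letter → C → C

  module _ (R : Raw) where
    open Raw R
    ⟦_⟧ : Tm → (List Bool → C) → C
    ⟦ var p ⟧  ρ = ρ p
    ⟦ tz ⟧     ρ = 𝟘
    ⟦ a t+ b ⟧ ρ = ⟦ a ⟧ ρ ⊕ ⟦ b ⟧ ρ
    ⟦ tneg a ⟧ ρ = zs -[1+ 0 ] (⟦ a ⟧ ρ)
    ⟦ tq a ⟧   ρ = zs q (⟦ a ⟧ ρ)
    ⟦ tx a ⟧   ρ = zs x (⟦ a ⟧ ρ)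
    ⟦ tl l a ⟧ ρ = act l (⟦ a ⟧ ρ)

    ⟦⟧-cong : ∀ t {ρ ρ′} → (∀ p → ρ p ≡ ρ′ p) → ⟦ t ⟧ ρ ≡ ⟦ t ⟧ ρ′
    ⟦⟧-cong (var p)  e = e p
    ⟦⟧-cong tz       e = refl
    ⟦⟧-cong (a t+ b) e = cong₂ _⊕_ (⟦⟧-cong a e) (⟦⟧-cong b e)
    ⟦⟧-cong (tneg a) e = cong (zs _) (⟦⟧-cong a e)
    ⟦⟧-cong (tq a)   e = cong (zs _) (⟦⟧-cong a e)
    ⟦⟧-cong (tx a)   e = cong (zs _) (⟦⟧-cong a e)
    ⟦⟧-cong (tl l a) e = cong (act l) (⟦⟧-cong a e)

    ⟦sub⟧ : ∀ σ t ρ → ⟦ sub σ t ⟧ ρ ≡ ⟦ t ⟧ (λ p → ⟦ σ p ⟧ ρ)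
    ⟦sub⟧ σ (var p)  ρ = refl
    ⟦sub⟧ σ tz       ρ = refl
    ⟦sub⟧ σ (a t+ b) ρ = cong₂ _⊕_ (⟦sub⟧ σ a ρ) (⟦sub⟧ σ b ρ)
    ⟦sub⟧ σ (tneg a) ρ = cong (zs _) (⟦sub⟧ σ a ρ)
    ⟦sub⟧ σ (tq a)   ρ = cong (zs _) (⟦sub⟧ σ a ρ)
    ⟦sub⟧ σ (tx a)   ρ = cong (zs _) (⟦sub⟧ σ a ρ)
    ⟦sub⟧ σ (tl l a) ρ = cong (act l) (⟦sub⟧ σ a ρ)

    one : C → List Bool → C
    one v []      = v
    one v (_ ∷ _) = 𝟘

    penv : C × C → List Bool → C
    penv v (b ∷ []) = pick v b
    penv v _        = 𝟘

  dbl : Bool → Raw → Raw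
  dbl e R = record
    { C   = C × C
    ; 𝟘   = 𝟘 , 𝟘
    ; _⊕_ = λ u v → proj₁ u ⊕ proj₁ v , proj₂ u ⊕ proj₂ v
    ; zs  = λ a v → zs a (proj₁ v) , zs a (proj₂ v)
    ; act = λ l v → ⟦_⟧ R (proj₁ (tab e l)) (penv R v) , ⟦_⟧ R (proj₂ (tab e l)) (penv R v)
    }
    where open Raw R

  expand-sound : ∀ e R t (ρ : List Bool → Raw.C (dbl e R)) (ρ₂ : List Bool → Raw.C R) →
    (∀ b p → ρ₂ (b ∷ p) ≡ pick (ρ p) b) →
    ⟦_⟧ (dbl e R) t ρ ≡ (⟦_⟧ R (proj₁ (expand e t)) ρ₂ , ⟦_⟧ R (proj₂ (expand e t)) ρ₂)
  expand-sound e R (var p) ρ ρ₂ h = cong₂ _,_ (sym (h false p)) (sym (h true p))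
  expand-sound e R tz ρ ρ₂ h = refl
  expand-sound e R (a t+ b) ρ ρ₂ h = cong₂ (Raw._⊕_ (dbl e R)) (expand-sound e R a ρ ρ₂ h) (expand-sound e R b ρ ρ₂ h)
  expand-sound e R (tneg a) ρ ρ₂ h = cong (Raw.zs (dbl e R) _) (expand-sound e R a ρ ρ₂ h)
  expand-sound e R (tq a) ρ ρ₂ h = cong (Raw.zs (dbl e R) _) (expand-sound e R a ρ ρ₂ h)
  expand-sound e R (tx a) ρ ρ₂ h = cong (Raw.zs (dbl e R) _) (expand-sound e R a ρ ρ₂ h)
  expand-sound e R (tl l a) ρ ρ₂ h =
    trans (cong (Raw.act (dbl e R) l) (expand-sound e R a ρ ρ₂ h))
          (cong₂ _,_ (go (proj₁ (tab e l))) (go (proj₂ (tab e l))))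
    where
    same : ∀ p → penv R (⟦_⟧ R (proj₁ (expand e a)) ρ₂ , ⟦_⟧ R (proj₂ (expand e a)) ρ₂) p
               ≡ ⟦_⟧ R (pairσ (expand e a) p) ρ₂
    same []              = refl
    same (false ∷ [])    = refl
    same (true ∷ [])     = refl
    same (false ∷ _ ∷ _) = refl
    same (true ∷ _ ∷ _)  = refl
    go : ∀ T → ⟦_⟧ R T (penv R _) ≡ ⟦_⟧ R (sub (pairσ (expand e a)) T) ρ₂
    go T = trans (⟦⟧-cong R T same) (sym (⟦sub⟧ R (pairσ (expand e a)) T ρ₂))

  record Laws (e : Bool) (R : Raw) : Set where
    open Raw R
    field
      assoc : ∀ u v w → (u ⊕ v) ⊕ w ≡ u ⊕ (v ⊕ w)
      comm  : ∀ u v → u ⊕ v ≡ v ⊕ u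
      idl   : ∀ v → 𝟘 ⊕ v ≡ v
      zs-+  : ∀ a b v → zs (a +ᶻ b) v ≡ zs a v ⊕ zs b v
      zs-*  : ∀ a b v → zs (a *ᶻ b) v ≡ zs a (zs b v)
      zs-⊕  : ∀ a u v → zs a (u ⊕ v) ≡ zs a u ⊕ zs a v
      zs-1  : ∀ v → zs (+ 1) v ≡ v
      zs-0  : ∀ v → zs (+ 0) v ≡ 𝟘
      act-⊕ : ∀ l u v → act l (u ⊕ v) ≡ act l u ⊕ act l v
      act-z : ∀ l a v → act l (zs a v) ≡ zs a (act l v)
      rule  : ∀ r v → ⟦_⟧ R (ruleL r) (one R v) ≡ ⟦_⟧ R (ruleR e r) (one R v)

  module Lin {e R} (L : Laws e R) where
    open Raw R
    open Laws L
    zs-𝟘 : ∀ a → zs a 𝟘 ≡ 𝟘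
    zs-𝟘 a = trans (cong (zs a) (sym (zs-0 𝟘))) (trans (sym (zs-* a (+ 0) 𝟘)) (trans (cong (λ b → zs b 𝟘) (ℤₚ.*-zeroʳ a)) (zs-0 𝟘)))
    act-𝟘 : ∀ l → act l 𝟘 ≡ 𝟘
    act-𝟘 l = trans (cong (act l) (sym (zs-0 𝟘))) (trans (act-z l (+ 0) 𝟘) (zs-0 _))
    idr : ∀ v → v ⊕ 𝟘 ≡ v
    idr v = trans (comm v 𝟘) (idl v)
    zs-comm : ∀ a b v → zs a (zs b v) ≡ zs b (zs a v)
    zs-comm a b v = trans (sym (zs-* a b v)) (trans (cong (λ c → zs c v) (ℤₚ.*-comm a b)) (zs-* b a v))
    four : ∀ a b c d → (a ⊕ b) ⊕ (c ⊕ d) ≡ (a ⊕ c) ⊕ (b ⊕ d)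
    four a b c d = trans (assoc a b (c ⊕ d)) (trans (cong (a ⊕_) (trans (sym (assoc b c d)) (trans (cong (_⊕ d) (comm b c)) (assoc c b d)))) (sym (assoc a c (b ⊕ d))))

    ⟦⟧-⊕ : ∀ t ρ ρ′ → ⟦_⟧ R t (λ p → ρ p ⊕ ρ′ p) ≡ ⟦_⟧ R t ρ ⊕ ⟦_⟧ R t ρ′
    ⟦⟧-⊕ (var p) ρ ρ′ = refl
    ⟦⟧-⊕ tz ρ ρ′ = sym (idl 𝟘)
    ⟦⟧-⊕ (a t+ b) ρ ρ′ = trans (cong₂ _⊕_ (⟦⟧-⊕ a ρ ρ′) (⟦⟧-⊕ b ρ ρ′)) (four _ _ _ _)
    ⟦⟧-⊕ (tneg a) ρ ρ′ = trans (cong (zs _) (⟦⟧-⊕ a ρ ρ′)) (zs-⊕ _ _ _)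
    ⟦⟧-⊕ (tq a) ρ ρ′ = trans (cong (zs _) (⟦⟧-⊕ a ρ ρ′)) (zs-⊕ _ _ _)
    ⟦⟧-⊕ (tx a) ρ ρ′ = trans (cong (zs _) (⟦⟧-⊕ a ρ ρ′)) (zs-⊕ _ _ _)
    ⟦⟧-⊕ (tl l a) ρ ρ′ = trans (cong (act l) (⟦⟧-⊕ a ρ ρ′)) (act-⊕ l _ _)

    ⟦⟧-z : ∀ t c ρ → ⟦_⟧ R t (λ p → zs c (ρ p)) ≡ zs c (⟦_⟧ R t ρ)
    ⟦⟧-z (var p) c ρ = refl
    ⟦⟧-z tz c ρ = sym (zs-𝟘 c)
    ⟦⟧-z (a t+ b) c ρ = trans (cong₂ _⊕_ (⟦⟧-z a c ρ) (⟦⟧-z b c ρ)) (sym (zs-⊕ c _ _))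
    ⟦⟧-z (tneg a) c ρ = trans (cong (zs _) (⟦⟧-z a c ρ)) (zs-comm _ c _)
    ⟦⟧-z (tq a) c ρ = trans (cong (zs _) (⟦⟧-z a c ρ)) (zs-comm _ c _)
    ⟦⟧-z (tx a) c ρ = trans (cong (zs _) (⟦⟧-z a c ρ)) (zs-comm _ c _)
    ⟦⟧-z (tl l a) c ρ = trans (cong (act l) (⟦⟧-z a c ρ)) (act-z l c _)

    wordI : List Letter → C → C
    wordI []      v = v
    wordI (l ∷ w) v = act l (wordI w v)

    pw : ℕ → ℕ → ℤ
    pw a b = (q ℤ.^ a) *ᶻ (x ℤ.^ b)

    M⟦_⟧ : Mono → (List Bool → C) → C
    M⟦ mono c a b w v ⟧ ρ = zs (c *ᶻ pw a b) (wordI w (ρ v))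

    P⟦_⟧ : Poly → (List Bool → C) → C
    P⟦ [] ⟧    ρ = 𝟘
    P⟦ m ∷ p ⟧ ρ = M⟦ m ⟧ ρ ⊕ P⟦ p ⟧ ρ

    pw-+ : ∀ a b a′ b′ → pw (a ℕ.+ a′) (b ℕ.+ b′) ≡ pw a b *ᶻ pw a′ b′
    pw-+ a b a′ b′ = trans (cong₂ _*ᶻ_ (ℤₚ.^-distribˡ-+-* q a a′) (ℤₚ.^-distribˡ-+-* x b b′)) (h (q ℤ.^ a) (q ℤ.^ a′) (x ℤ.^ b) (x ℤ.^ b′))
      where
      h : ∀ m n k l → (m *ᶻ n) *ᶻ (k *ᶻ l) ≡ (m *ᶻ k) *ᶻ (n *ᶻ l)
      h = solve-∀

    scM-sound : ∀ c a b m ρ → M⟦ scM c a b m ⟧ ρ ≡ zs (c *ᶻ pw a b) (M⟦ m ⟧ ρ)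
    scM-sound c a b (mono c′ a′ b′ w v) ρ =
      trans (cong (λ k → zs k (wordI w (ρ v))) (trans (cong ((c *ᶻ c′) *ᶻ_) (pw-+ a b a′ b′)) (h c c′ (pw a b) (pw a′ b′)))) (zs-* _ _ _)
      where
      h : ∀ m n k l → (m *ᶻ n) *ᶻ (k *ᶻ l) ≡ (m *ᶻ k) *ᶻ (n *ᶻ l)
      h = solve-∀

    map-scM : ∀ c a b p ρ → P⟦ map (scM c a b) p ⟧ ρ ≡ zs (c *ᶻ pw a b) (P⟦ p ⟧ ρ)
    map-scM c a b [] ρ = sym (zs-𝟘 _)
    map-scM c a b (m ∷ p) ρ = trans (cong₂ _⊕_ (scM-sound c a b m ρ) (map-scM c a b p ρ)) (sym (zs-⊕ _ _ _))

    map-consW : ∀ l p ρ → P⟦ map (consW l) p ⟧ ρ ≡ act l (P⟦ p ⟧ ρ)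
    map-consW l [] ρ = sym (act-𝟘 l)
    map-consW l (mono c a b w v ∷ p) ρ =
      trans (cong₂ _⊕_ (sym (act-z l _ _)) (map-consW l p ρ)) (sym (act-⊕ l _ _))

    map-negW : ∀ l p ρ → P⟦ map (λ m → scM -[1+ 0 ] 0 0 (consW l m)) p ⟧ ρ ≡ zs -[1+ 0 ] (act l (P⟦ p ⟧ ρ))
    map-negW l [] ρ = sym (trans (cong (zs _) (act-𝟘 l)) (zs-𝟘 _))
    map-negW l (m ∷ p) ρ =
      trans (cong₂ _⊕_ (trans (scM-sound -[1+ 0 ] 0 0 (consW l m) ρ) (cong (zs _) (sym (act-z l _ _)))) (map-negW l p ρ))
            (trans (sym (zs-⊕ _ _ _)) (cong (zs _) (sym (act-⊕ l _ _))))

    consNZ-sound : ∀ m p ρ → P⟦ consNZ m p ⟧ ρ ≡ M⟦ m ⟧ ρ ⊕ P⟦ p ⟧ ρ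
    consNZ-sound (mono (+ 0) a b w v) p ρ = sym (trans (cong (_⊕ P⟦ p ⟧ ρ) (trans (cong (λ k → zs k (wordI w (ρ v))) (ℤₚ.*-zeroˡ (pw a b))) (zs-0 _))) (idl _))
    consNZ-sound (mono (+ (suc n)) a b w v) p ρ = refl
    consNZ-sound (mono -[1+ n ] a b w v) p ρ = refl

    ∧-true : ∀ {a b} → a ∧ b ≡ true → (a ≡ true) × (b ≡ true)
    ∧-true {true} {true} _ = refl , refl

    eqL-sound : ∀ a b → eqL a b ≡ true → a ≡ b
    eqL-sound ad ad _ = refl
    eqL-sound ah ah _ = refl
    eqL-sound ld ld _ = refl
    eqL-sound lh lh _ = refl
    eqL-sound zz zz _ = refl
    eqL-sound ww ww _ = refl

    eqN-sound : ∀ a b → eqN a b ≡ true → a ≡ b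
    eqN-sound zero zero _ = refl
    eqN-sound (suc a) (suc b) e = cong suc (eqN-sound a b e)

    eqB-sound : ∀ a b → eqB a b ≡ true → a ≡ b
    eqB-sound true true _ = refl
    eqB-sound false false _ = refl

    eqs-sound : ∀ {A : Set} (f : A → A → Bool) → (∀ a b → f a b ≡ true → a ≡ b) → ∀ as bs → eqs f as bs ≡ true → as ≡ bs
    eqs-sound f h [] [] _ = refl
    eqs-sound f h (a ∷ as) (b ∷ bs) e = cong₂ _∷_ (h a b (proj₁ (∧-true e))) (eqs-sound f h as bs (proj₂ (∧-true {f a b} e)))

    addM-sound : ∀ m n ρ → eqK m n ≡ true → M⟦ addM m n ⟧ ρ ≡ M⟦ m ⟧ ρ ⊕ M⟦ n ⟧ ρ
    addM-sound (mono c a b w v) (mono c′ a′ b′ w′ v′) ρ e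
      with ∧-true {eqs eqL w w′} e
    ... | ew , e₁ with ∧-true {eqN a a′} e₁
    ... | ea , e₂ with ∧-true {eqN b b′} e₂
    ... | eb , ev with eqs-sound eqL eqL-sound w w′ ew | eqN-sound a a′ ea | eqN-sound b b′ eb | eqs-sound eqB eqB-sound v v′ ev
    ... | refl | refl | refl | refl = trans (cong (λ k → zs k (wordI w (ρ v))) (ℤₚ.*-distribʳ-+ (pw a b) c c′)) (zs-+ _ _ _)

    insM-sound : ∀ m p ρ → P⟦ insM m p ⟧ ρ ≡ M⟦ m ⟧ ρ ⊕ P⟦ p ⟧ ρ
    insM-sound m [] ρ = consNZ-sound m [] ρ
    insM-sound m (n ∷ p) ρ with eqK m n in eq
    ... | true  = trans (consNZ-sound (addM m n) p ρ) (trans (cong (_⊕ P⟦ p ⟧ ρ) (addM-sound m n ρ eq)) (assoc _ _ _))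
    ... | false = trans (cong (M⟦ n ⟧ ρ ⊕_) (insM-sound m p ρ)) (trans (sym (assoc _ _ _)) (trans (cong (_⊕ P⟦ p ⟧ ρ) (comm _ _)) (assoc _ _ _)))

    p+-sound : ∀ p r ρ → P⟦ p p+ r ⟧ ρ ≡ P⟦ p ⟧ ρ ⊕ P⟦ r ⟧ ρ
    p+-sound [] r ρ = sym (idl _)
    p+-sound (m ∷ p) r ρ = trans (insM-sound m (p p+ r) ρ) (trans (cong (M⟦ m ⟧ ρ ⊕_) (p+-sound p r ρ)) (sym (assoc _ _ _)))

    unit : ∀ v → zs (+ 1 *ᶻ pw 0 0) v ⊕ 𝟘 ≡ v
    unit v = trans (idr _) (zs-1 v)

    appZ-sound : ∀ w v ρ → P⟦ appZ w v ⟧ ρ ≡ act zz (wordI w (ρ v))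
    appW-sound : ∀ w v ρ → P⟦ appW w v ⟧ ρ ≡ act ww (wordI w (ρ v))
    appZ-sound [] v ρ = unit _
    appZ-sound (ad ∷ w) v ρ = trans (map-negW ad (appW w v) ρ) (trans (cong (λ u → zs -[1+ 0 ] (act ad u)) (appW-sound w v ρ)) (sym (rule adz _)))
    appZ-sound (ah ∷ w) v ρ = trans (map-consW ah (appW w v) ρ) (trans (cong (act ah) (appW-sound w v ρ)) (sym (rule ahz _)))
    appZ-sound (ld ∷ w) v ρ = unit _
    appZ-sound (lh ∷ w) v ρ = unit _
    appZ-sound (zz ∷ w) v ρ = unit _
    appZ-sound (ww ∷ w) v ρ = unit _
    appW-sound [] v ρ = unit _
    appW-sound (ad ∷ w) v ρ = unit _
    appW-sound (ah ∷ w) v ρ = unit _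
    appW-sound (ld ∷ w) v ρ = trans (map-consW ld (appZ w v) ρ) (trans (cong (act ld) (appZ-sound w v ρ)) (sym (rule ldw _)))
    appW-sound (lh ∷ w) v ρ = trans (map-negW lh (appZ w v) ρ) (trans (cong (λ u → zs -[1+ 0 ] (act lh u)) (appZ-sound w v ρ)) (sym (rule lhw _)))
    appW-sound (zz ∷ w) v ρ = unit _
    appW-sound (ww ∷ w) v ρ = unit _

    pq : pw 1 0 ≡ q
    pq = h q
      where
      h : ∀ a → (a *ᶻ + 1) *ᶻ + 1 ≡ a
      h = solve-∀
    px : pw 0 1 ≡ x
    px = h x
      where
      h : ∀ a → + 1 *ᶻ (a *ᶻ + 1) ≡ a
      h = solve-∀

    tsg-sound : ∀ b t ρ → ⟦_⟧ R (tsg b t) ρ ≡ zs (sgz b) (⟦_⟧ R t ρ)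
    tsg-sound true  t ρ = sym (zs-1 _)
    tsg-sound false t ρ = refl

    red1 : ∀ w v c ρ p → P⟦ p ⟧ ρ ≡ c → P⟦ mono (+ 1) 0 0 w v ∷ map (scM -[1+ 0 ] 0 1) p ⟧ ρ ≡ wordI w (ρ v) ⊕ zs -[1+ 0 ] (zs x c)
    red1 w v c ρ p h = cong₂ _⊕_ (zs-1 _) (trans (map-scM -[1+ 0 ] 0 1 p ρ) (trans (cong (λ k → zs (-[1+ 0 ] *ᶻ k) (P⟦ p ⟧ ρ)) px) (trans (zs-* _ x _) (cong (λ u → zs _ (zs x u)) h))))
    red2 : ∀ b w v c ρ p → P⟦ p ⟧ ρ ≡ c → P⟦ mono (sgz b) 0 0 w v ∷ map (scM (-ᶻ sgz b) 1 0) p ⟧ ρ ≡ zs (sgz b) (wordI w (ρ v) ⊕ zs -[1+ 0 ] (zs q c))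
    red2 b w v c ρ p h = trans (cong₂ _⊕_ (cong (λ k → zs k (wordI w (ρ v))) (ℤₚ.*-identityʳ (sgz b)))
        (trans (map-scM (-ᶻ sgz b) 1 0 p ρ) (trans (cong (λ k → zs ((-ᶻ sgz b) *ᶻ k) (P⟦ p ⟧ ρ)) pq) (trans (cong (λ k → zs k (P⟦ p ⟧ ρ)) (hh (sgz b) q)) (trans (zs-* _ _ _) (cong (zs (sgz b)) (trans (zs-* _ q _) (cong (λ u → zs _ (zs q u)) h))))))))
        (sym (zs-⊕ _ _ _))
      where
      hh : ∀ s a → (-ᶻ s) *ᶻ a ≡ s *ᶻ (-[1+ 0 ] *ᶻ a)
      hh = solve-∀
    red3 : ∀ w v c ρ p → P⟦ p ⟧ ρ ≡ c → P⟦ mono (+ 1) 0 0 w v ∷ map (scM (+ 1) 0 1) p ⟧ ρ ≡ wordI w (ρ v) ⊕ zs x c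
    red3 w v c ρ p h = cong₂ _⊕_ (zs-1 _) (trans (map-scM (+ 1) 0 1 p ρ) (trans (cong (λ k → zs (+ 1 *ᶻ k) (P⟦ p ⟧ ρ)) px) (trans (cong (λ k → zs k (P⟦ p ⟧ ρ)) (ℤₚ.*-identityˡ x)) (cong (zs x) h))))

    app-sound : ∀ l w v ρ → P⟦ app e l w v ⟧ ρ ≡ act l (wordI w (ρ v))
    app-sound zz w v ρ = appZ-sound w v ρ
    app-sound ww w v ρ = appW-sound w v ρ
    app-sound ad [] v ρ = unit _
    app-sound ad (ad ∷ w) v ρ = unit _
    app-sound ad (ah ∷ w) v ρ = unit _
    app-sound ad (ld ∷ w) v ρ = unit _
    app-sound ad (lh ∷ w) v ρ = trans (red1 w v _ ρ (appZ w v) (appZ-sound w v ρ)) (sym (rule lhad _))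
    app-sound ad (zz ∷ w) v ρ = unit _
    app-sound ad (ww ∷ w) v ρ = unit _
    app-sound ah [] v ρ = unit _
    app-sound ah (ad ∷ w) v ρ = unit _
    app-sound ah (ah ∷ w) v ρ = unit _
    app-sound ah (ld ∷ w) v ρ = trans (red2 e w v _ ρ (appZ w v) (appZ-sound w v ρ)) (sym (trans (rule ldah _) (tsg-sound e _ _)))
    app-sound ah (lh ∷ w) v ρ = unit _
    app-sound ah (zz ∷ w) v ρ = unit _
    app-sound ah (ww ∷ w) v ρ = unit _
    app-sound ld [] v ρ = unit _
    app-sound ld (ad ∷ w) v ρ = unit _
    app-sound ld (ah ∷ w) v ρ = trans (red2 e w v _ ρ (appW w v) (appW-sound w v ρ)) (sym (trans (rule ahld _) (tsg-sound e _ _)))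
    app-sound ld (ld ∷ w) v ρ = unit _
    app-sound ld (lh ∷ w) v ρ = unit _
    app-sound ld (zz ∷ w) v ρ = unit _
    app-sound ld (ww ∷ w) v ρ = unit _
    app-sound lh [] v ρ = unit _
    app-sound lh (ad ∷ w) v ρ = trans (red3 w v _ ρ (appW w v) (appW-sound w v ρ)) (sym (rule adlh _))
    app-sound lh (ah ∷ w) v ρ = unit _
    app-sound lh (ld ∷ w) v ρ = unit _
    app-sound lh (lh ∷ w) v ρ = unit _
    app-sound lh (zz ∷ w) v ρ = unit _
    app-sound lh (ww ∷ w) v ρ = unit _

    appP-sound : ∀ l p ρ → P⟦ appP e l p ⟧ ρ ≡ act l (P⟦ p ⟧ ρ)
    appP-sound l [] ρ = sym (act-𝟘 l)
    appP-sound l (mono c a b w v ∷ p) ρ =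
      trans (p+-sound (map (scM c a b) (app e l w v)) (appP e l p) ρ)
        (trans (cong₂ _⊕_ (trans (map-scM c a b (app e l w v) ρ) (trans (cong (zs _) (app-sound l w v ρ)) (sym (act-z l _ _)))) (appP-sound l p ρ))
          (sym (act-⊕ l _ _)))

    nf-sound : ∀ t ρ → P⟦ nf e t ⟧ ρ ≡ ⟦_⟧ R t ρ
    nf-sound (var p) ρ = unit _
    nf-sound tz ρ = refl
    nf-sound (a t+ b) ρ = trans (p+-sound (nf e a) (nf e b) ρ) (cong₂ _⊕_ (nf-sound a ρ) (nf-sound b ρ))
    nf-sound (tneg a) ρ = trans (map-scM -[1+ 0 ] 0 0 (nf e a) ρ) (cong (zs -[1+ 0 ]) (nf-sound a ρ))
    nf-sound (tq a) ρ = trans (map-scM (+ 1) 1 0 (nf e a) ρ) (trans (cong (λ k → zs (+ 1 *ᶻ k) (P⟦ nf e a ⟧ ρ)) pq) (trans (cong (λ k → zs k (P⟦ nf e a ⟧ ρ)) (ℤₚ.*-identityˡ q)) (cong (zs q) (nf-sound a ρ))))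
    nf-sound (tx a) ρ = trans (map-scM (+ 1) 0 1 (nf e a) ρ) (trans (cong (λ k → zs (+ 1 *ᶻ k) (P⟦ nf e a ⟧ ρ)) px) (trans (cong (λ k → zs k (P⟦ nf e a ⟧ ρ)) (ℤₚ.*-identityˡ x)) (cong (zs x) (nf-sound a ρ))))
    nf-sound (tl l a) ρ = trans (appP-sound l (nf e a) ρ) (cong (act l) (nf-sound a ρ))

    null-sound : ∀ p ρ → null p ≡ true → P⟦ p ⟧ ρ ≡ 𝟘
    null-sound [] ρ _ = refl

    cancel : ∀ u v → u ⊕ zs -[1+ 0 ] v ≡ 𝟘 → u ≡ v
    cancel u v h = trans (sym (idr u)) (trans (cong (u ⊕_) (sym inv)) (trans (sym (assoc _ _ _)) (trans (cong (_⊕ v) h) (idl v))))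
      where
      inv : zs -[1+ 0 ] v ⊕ v ≡ 𝟘
      inv = trans (cong (zs -[1+ 0 ] v ⊕_) (sym (zs-1 v))) (trans (sym (zs-+ -[1+ 0 ] (+ 1) v)) (zs-0 v))

    chk-sound : ∀ s t → chk e s t ≡ true → ∀ ρ → ⟦_⟧ R s ρ ≡ ⟦_⟧ R t ρ
    chk-sound s t h ρ = cancel _ _ (trans (sym (nf-sound (s t- t) ρ)) (null-sound (nf e (s t- t)) ρ h))

  -- The normaliser works with the rules of sign `e` and confirms that the letters of `tab e`
  -- satisfy those of sign `not e`.
  dblRules : (e : Bool) → allRules (λ r → chk₁ e (expand e (ruleL r)) (expand e (ruleR (not e) r))) ≡ true
  dblRules true  = refl
  dblRules false = refl

  allRules-sound : ∀ f → allRules f ≡ true → ∀ r → f r ≡ true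
  allRules-sound f h r = go (f lhad) (f ldah) (f adlh) (f ahld) (f adz) (f ahz) (f lhw) (f ldw) refl refl refl refl refl refl refl refl h r
    where
    -- The eight values are generalised to variables tied by equations, so that the conjunction can
    -- be split by matching on them.
    go : ∀ a b c d p u g k → f lhad ≡ a → f ldah ≡ b → f adlh ≡ c → f ahld ≡ d → f adz ≡ p → f ahz ≡ u → f lhw ≡ g → f ldw ≡ k →
      a ∧ (b ∧ (c ∧ (d ∧ (p ∧ (u ∧ (g ∧ k)))))) ≡ true → ∀ r → f r ≡ true
    go true true true true true true true true r1 r2 r3 r4 r5 r6 r7 r8 _ lhad = r1
    go true true true true true true true true r1 r2 r3 r4 r5 r6 r7 r8 _ ldah = r2
    go true true true true true true true true r1 r2 r3 r4 r5 r6 r7 r8 _ adlh = r3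
    go true true true true true true true true r1 r2 r3 r4 r5 r6 r7 r8 _ ahld = r4
    go true true true true true true true true r1 r2 r3 r4 r5 r6 r7 r8 _ adz = r5
    go true true true true true true true true r1 r2 r3 r4 r5 r6 r7 r8 _ ahz = r6
    go true true true true true true true true r1 r2 r3 r4 r5 r6 r7 r8 _ lhw = r7
    go true true true true true true true true r1 r2 r3 r4 r5 r6 r7 r8 _ ldw = r8

  -- The module laws hold componentwise. Only `rule` needs computation: both sides expand to pairs
  -- of terms over `R`, where `dblRules` decides them.
  dblLaws : ∀ {e R} → Laws e R → Laws (not e) (dbl e R)
  dblLaws {e} {R} L = record
    { assoc = λ u v w → cong₂ _,_ (assoc _ _ _) (assoc _ _ _)
    ; comm  = λ u v → cong₂ _,_ (comm _ _) (comm _ _)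
    ; idl   = λ v → cong₂ _,_ (idl _) (idl _)
    ; zs-+  = λ a b v → cong₂ _,_ (zs-+ _ _ _) (zs-+ _ _ _)
    ; zs-*  = λ a b v → cong₂ _,_ (zs-* _ _ _) (zs-* _ _ _)
    ; zs-⊕  = λ a u v → cong₂ _,_ (zs-⊕ _ _ _) (zs-⊕ _ _ _)
    ; zs-1  = λ v → cong₂ _,_ (zs-1 _) (zs-1 _)
    ; zs-0  = λ v → cong₂ _,_ (zs-0 _) (zs-0 _)
    ; act-⊕ = λ l u v → cong₂ _,_ (a⊕ (proj₁ (tab e l)) u v) (a⊕ (proj₂ (tab e l)) u v)
    ; act-z = λ l c v → cong₂ _,_ (az (proj₁ (tab e l)) c v) (az (proj₂ (tab e l)) c v)
    ; rule  = rl
    }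
    where
    open Raw R
    open Laws L
    open Lin L
    a⊕ : ∀ T u v → ⟦_⟧ R T (penv R (proj₁ u ⊕ proj₁ v , proj₂ u ⊕ proj₂ v)) ≡ ⟦_⟧ R T (penv R u) ⊕ ⟦_⟧ R T (penv R v)
    a⊕ T u v = trans (⟦⟧-cong R T h) (⟦⟧-⊕ T _ _)
      where
      h : ∀ p → penv R (proj₁ u ⊕ proj₁ v , proj₂ u ⊕ proj₂ v) p ≡ penv R u p ⊕ penv R v p
      h []              = sym (idl _)
      h (false ∷ [])    = refl
      h (true ∷ [])     = refl
      h (false ∷ _ ∷ _) = sym (idl _)
      h (true ∷ _ ∷ _)  = sym (idl _)
    az : ∀ T c v → ⟦_⟧ R T (penv R (zs c (proj₁ v) , zs c (proj₂ v))) ≡ zs c (⟦_⟧ R T (penv R v))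
    az T c v = trans (⟦⟧-cong R T h) (⟦⟧-z T c _)
      where
      h : ∀ p → penv R (zs c (proj₁ v) , zs c (proj₂ v)) p ≡ zs c (penv R v p)
      h []              = sym (zs-𝟘 c)
      h (false ∷ [])    = refl
      h (true ∷ [])     = refl
      h (false ∷ _ ∷ _) = sym (zs-𝟘 c)
      h (true ∷ _ ∷ _)  = sym (zs-𝟘 c)
    rl : ∀ r v → ⟦_⟧ (dbl e R) (ruleL r) (one (dbl e R) v) ≡ ⟦_⟧ (dbl e R) (ruleR (not e) r) (one (dbl e R) v)
    rl r v = trans (expand-sound e R (ruleL r) _ ρ₂ h) (trans (cong₂ _,_ (chk-sound (proj₁ (expand e (ruleL r))) (proj₁ (expand e (ruleR (not e) r))) (proj₁ c) ρ₂) (chk-sound (proj₂ (expand e (ruleL r))) (proj₂ (expand e (ruleR (not e) r))) (proj₂ c) ρ₂)) (sym (expand-sound e R (ruleR (not e) r) _ ρ₂ h)))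
      where
      ρ₂ : List Bool → C
      ρ₂ (b ∷ p) = pick (one (dbl e R) v p) b
      ρ₂ []      = 𝟘
      h : ∀ b p → ρ₂ (b ∷ p) ≡ pick (one (dbl e R) v p) b
      h b p = refl
      c = ∧-true {chk e (proj₁ (expand e (ruleL r))) (proj₁ (expand e (ruleR (not e) r)))} (allRules-sound (λ r′ → chk₁ e (expand e (ruleL r′)) (expand e (ruleR (not e) r′))) (dblRules e) r)

-- Exchange relations and invariant maps in an arbitrary representation.

module Doubling (q x : ℤ) where

  open TermAlgebra
  open Tables
  open Semantics q x

  mS : (R : Raw) → Tm → Raw.C R → Raw.C R
  mS R T v = ⟦_⟧ R T (one R v)

  mU : (R : Raw) → Tm × Tm → Raw.C R → Raw.C R × Raw.C R
  mU R (A , B) v = mS R A v , mS R B v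

  mD : (R : Raw) → Tm → Raw.C R × Raw.C R → Raw.C R
  mD R T v = ⟦_⟧ R T (penv R v)

  hsum : (R : Raw) → (Site → Site → Raw.C R) → List (Bool × Site × Site) → Raw.C R
  hsum R f = foldr (λ m a → Raw._⊕_ R (Raw.zs R (sgz (proj₁ m)) (f (proj₁ (proj₂ m)) (proj₂ (proj₂ m)))) a) (Raw.𝟘 R)

  -- One telescoping step: the moves across two sites are a difference of boundary terms plus a
  -- remainder. The subtracted boundary term stands on the left.
  PairEq : (R : Raw) {X Y : Set} → Kind → Kind → Bool → (P gP : St → Site → X → Y) (Q gQ : St → Site → Y → Raw.C R)
    (low : St → Site → Site → X → Raw.C R) → Set
  PairEq R {X} kP kQ e P gP Q gQ low = ∀ c s t (v : X) →
    Raw._⊕_ R (hsum R (λ s₂ t₂ → Q (nx kP c s₂) t₂ (P c s₂ v)) (moves (eta e (nx kQ (nx kP c s) t)) s t)) (gQ (nx kP c s) t (P c s v))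
    ≡ Raw._⊕_ R (Q (nx kP c s) t (gP c s v)) (low c s t v)

  and-l : ∀ {a b} → a ∧ b ≡ true → a ≡ true
  and-l {true} _ = refl
  and-r : ∀ {a b} → a ∧ b ≡ true → b ≡ true
  and-r {true} h = h

  all4-s : ∀ f → all4 f ≡ true → ∀ s → f s ≡ true
  all4-s f h s0 = and-l h
  all4-s f h su = and-l (and-r {f s0} h)
  all4-s f h sd = and-l (and-r {f su} (and-r {f s0} h))
  all4-s f h st = and-r {f sd} (and-r {f su} (and-r {f s0} h))

  allS-s : ∀ e f → Checks.allS e f ≡ true → ∀ c s → f c s ≡ true
  allS-s e f h o s = all4-s (f o) (and-l h) s
  allS-s e f h i s = all4-s (f i) (and-r {all4 (f o)} h) s

  all32-s : ∀ f → all32 f ≡ true → ∀ c s t → f c s t ≡ true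
  all32-s f h o s t = all4-s (f o s) (all4-s (λ s → all4 (f o s)) (and-l h) s) t
  all32-s f h i s t = all4-s (f i s) (all4-s (λ s → all4 (f i s)) (and-r {all4 (λ s → all4 (f o s))} h) s) t

  -- One argument turns a check on terms into an equation of vectors; it serves the three codomains
  -- `Tm`, `L₁` and `L₂`, that is, a space, its double and its double double.
  module Transfer (R : Raw) {X Y Z Xs Ys : Set} (add : Z → Z → Z) (sg : Bool → Z → Z) (zr : Z) (ck : Z → Z → Bool)
    (Ix : X → Xs) (Iy : Y → Ys) (Iz : Z → Raw.C R)
    (iadd : ∀ a b → Iz (add a b) ≡ Raw._⊕_ R (Iz a) (Iz b)) (isg : ∀ b a → Iz (sg b a) ≡ Raw.zs R (sgz b) (Iz a))
    (izr : Iz zr ≡ Raw.𝟘 R) (ick : ∀ a b → ck a b ≡ true → Iz a ≡ Iz b) where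
    open Raw R

    module _ (P gP : St → Site → X → Y) (Q gQ : St → Site → Y → Z) (low : St → Site → Site → X → Z)
      (P′ gP′ : St → Site → Xs → Ys) (Q′ gQ′ : St → Site → Ys → C) (low′ : St → Site → Site → Xs → C)
      (hP : ∀ c s a → Iy (P c s a) ≡ P′ c s (Ix a)) (hgP : ∀ c s a → Iy (gP c s a) ≡ gP′ c s (Ix a))
      (hQ : ∀ c s a → Iz (Q c s a) ≡ Q′ c s (Iy a)) (hgQ : ∀ c s a → Iz (gQ c s a) ≡ gQ′ c s (Iy a))
      (hl : ∀ c s t a → Iz (low c s t a) ≡ low′ c s t (Ix a)) where

      fold-eq : ∀ kP c a ms → Iz (foldr (λ m r → add (sg (proj₁ m) (Q (nx kP c (proj₁ (proj₂ m))) (proj₂ (proj₂ m)) (P c (proj₁ (proj₂ m)) a))) r) zr ms)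
        ≡ hsum R (λ s₂ t₂ → Q′ (nx kP c s₂) t₂ (P′ c s₂ (Ix a))) ms
      fold-eq kP c a [] = izr
      fold-eq kP c a ((b , s , t) ∷ ms) = trans (iadd _ _) (cong₂ _⊕_
        (trans (isg b _) (cong (zs (sgz b)) (trans (hQ _ t _) (cong (Q′ _ t) (hP c s a))))) (fold-eq kP c a ms))

      tr : ∀ kP kQ e a c s t → Chk.pr add sg zr ck kP kQ e P gP Q gQ low a c s t ≡ true →
        hsum R (λ s₂ t₂ → Q′ (nx kP c s₂) t₂ (P′ c s₂ (Ix a))) (moves (eta e (nx kQ (nx kP c s) t)) s t) ⊕ gQ′ (nx kP c s) t (P′ c s (Ix a))
        ≡ Q′ (nx kP c s) t (gP′ c s (Ix a)) ⊕ low′ c s t (Ix a)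
      tr kP kQ e a c s t h = trans (sym lhs) (trans (ick _ _ h) rhs)
        where
        lhs = trans (iadd _ _) (cong₂ _⊕_ (fold-eq kP c a (moves (eta e (nx kQ (nx kP c s) t)) s t)) (trans (hgQ _ t _) (cong (gQ′ _ t) (hP c s a))))
        rhs = trans (iadd _ _) (cong₂ _⊕_ (trans (hQ _ t _) (cong (Q′ _ t) (hgP c s a))) (hl c s t a))

  record Inter (R R′ : Raw) : Set where
    private
      module A = Raw R
      module B = Raw R′
    field
      f  : A.C → B.C
      f⊕ : ∀ u v → f (u A.⊕ v) ≡ f u B.⊕ f v
      fz : ∀ a v → f (A.zs a v) ≡ B.zs a (f v)
      f𝟘 : f A.𝟘 ≡ B.𝟘
      fa : ∀ l v → f (A.act l v) ≡ B.act l (f v)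

    nat : ∀ t ρ → f (⟦_⟧ R t ρ) ≡ ⟦_⟧ R′ t (λ p → f (ρ p))
    nat (var p)  ρ = refl
    nat tz       ρ = f𝟘
    nat (a t+ b) ρ = trans (f⊕ _ _) (cong₂ B._⊕_ (nat a ρ) (nat b ρ))
    nat (tneg a) ρ = trans (fz _ _) (cong (B.zs _) (nat a ρ))
    nat (tq a)   ρ = trans (fz _ _) (cong (B.zs _) (nat a ρ))
    nat (tx a)   ρ = trans (fz _ _) (cong (B.zs _) (nat a ρ))
    nat (tl l a) ρ = trans (fa l _) (cong (B.act l) (nat a ρ))

    nat-S : ∀ T v → f (mS R T v) ≡ mS R′ T (f v)
    nat-S T v = trans (nat T _) (⟦⟧-cong R′ T h)
      where
      h : ∀ p → f (one R v p) ≡ one R′ (f v) p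
      h []      = refl
      h (_ ∷ _) = f𝟘

    nat-D : ∀ T v → f (mD R T v) ≡ mD R′ T (f (proj₁ v) , f (proj₂ v))
    nat-D T v = trans (nat T _) (⟦⟧-cong R′ T h)
      where
      h : ∀ p → f (penv R v p) ≡ penv R′ (f (proj₁ v) , f (proj₂ v)) p
      h []              = f𝟘
      h (false ∷ [])    = refl
      h (true ∷ [])     = refl
      h (false ∷ _ ∷ _) = f𝟘
      h (true ∷ _ ∷ _)  = f𝟘

  -- Depths differing by two have signs that are only propositionally equal, hence the argument
  -- `e ≡ e′`.
  liftI : ∀ {e e′ R R′} → e ≡ e′ → Inter R R′ → Inter (dbl e R) (dbl e′ R′)
  liftI {e} {e′} {R} {R′} eq I = record
    { f  = λ v → f (proj₁ v) , f (proj₂ v)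
    ; f⊕ = λ u v → cong₂ _,_ (f⊕ _ _) (f⊕ _ _)
    ; fz = λ a v → cong₂ _,_ (fz _ _) (fz _ _)
    ; f𝟘 = cong₂ _,_ f𝟘 f𝟘
    ; fa = λ l v → cong₂ _,_
        (trans (nat-D (proj₁ (tab e l)) v) (cong (λ k → mD R′ (proj₁ (tab k l)) (f (proj₁ v) , f (proj₂ v))) eq))
        (trans (nat-D (proj₂ (tab e l)) v) (cong (λ k → mD R′ (proj₂ (tab k l)) (f (proj₁ v) , f (proj₂ v))) eq))
    }
    where open Inter I

  module Level {e R} (L : Laws e R) where
    open Raw R
    open Laws L
    open Lin L

    e′ = not e
    R₁ = dbl e R
    R₂ = dbl e′ R₁

    private module Y = Checks e

    S0 g0 S2 g2 : St → Site → C → C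
    S0 c s = mS R (tS0 e c s)
    g0 c s = mS R (gS0 e c s)
    S2 c s = mS R (tS2 e c s)
    g2 c s = mS R (gS2 e c s)
    S0′ g0′ S2′ g2′ : St → Site → C × C → C × C
    S0′ c s = mS R₁ (tS0 e′ c s)
    g0′ c s = mS R₁ (gS0 e′ c s)
    S2′ c s = mS R₁ (tS2 e′ c s)
    g2′ c s = mS R₁ (gS2 e′ c s)
    U gU : St → Site → C → C × C
    U c s = mU R (tUp e c s)
    gU c s = mU R (gUp e c s)
    U′ gU′ : St → Site → C × C → (C × C) × (C × C)
    U′ c s = mU R₁ (tUp e′ c s)
    gU′ c s = mU R₁ (gUp e′ c s)
    D gD : St → Site → C × C → C
    D c s = mD R (tDn e c s)
    gD c s = mD R (gDn e c s)
    D′ gD′ : St → Site → (C × C) × (C × C) → C × C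
    D′ c s = mD R₁ (tDn e′ c s)
    gD′ c s = mD R₁ (gDn e′ c s)

    module Int (ρ : List Bool → C) where
      I₀ : Tm → C
      I₀ t = ⟦_⟧ R t ρ
      I₁ : L₁ → C × C
      I₁ t = I₀ (proj₁ t) , I₀ (proj₂ t)
      I₂ : L₂ → (C × C) × (C × C)
      I₂ t = I₁ (proj₁ t) , I₁ (proj₂ t)

      isg₁ : ∀ b t → I₁ (sg₁ b t) ≡ Raw.zs R₁ (sgz b) (I₁ t)
      isg₁ b t = cong₂ _,_ (tsg-sound b _ ρ) (tsg-sound b _ ρ)
      isg₂ : ∀ b t → I₂ (sg₂ b t) ≡ Raw.zs R₂ (sgz b) (I₂ t)
      isg₂ b t = cong₂ _,_ (isg₁ b _) (isg₁ b _)
      ick₁ : ∀ a b → chk₁ e a b ≡ true → I₁ a ≡ I₁ b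
      ick₁ (a , b) (a′ , b′) h = cong₂ _,_ (chk-sound a a′ (and-l h) ρ) (chk-sound b b′ (and-r {chk e a a′} h) ρ)
      ick₂ : ∀ a b → chk₂ e a b ≡ true → I₂ a ≡ I₂ b
      ick₂ (a , b) (a′ , b′) h = cong₂ _,_ (ick₁ a a′ (and-l h)) (ick₁ b b′ (and-r {chk₁ e a a′} h))

      h₀ : ∀ T t → I₀ (ap₀ T t) ≡ mS R T (I₀ t)
      h₀ T t = trans (⟦sub⟧ R (oneσ t) T ρ) (⟦⟧-cong R T h)
        where
        h : ∀ p → ⟦_⟧ R (oneσ t p) ρ ≡ one R (I₀ t) p
        h []      = refl
        h (_ ∷ _) = refl
      hD₀ : ∀ T t → I₀ (dn₀ T t) ≡ mD R T (I₁ t)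
      hD₀ T t = trans (⟦sub⟧ R (pairσ t) T ρ) (⟦⟧-cong R T h)
        where
        h : ∀ p → ⟦_⟧ R (pairσ t p) ρ ≡ penv R (I₁ t) p
        h []              = refl
        h (false ∷ [])    = refl
        h (true ∷ [])     = refl
        h (false ∷ _ ∷ _) = refl
        h (true ∷ _ ∷ _)  = refl
      h₁ : ∀ T t → I₁ (ap₁ e T t) ≡ mS R₁ T (I₁ t)
      h₁ T t = trans (cong₂ _,_ (⟦sub⟧ R (pairσ t) (proj₁ (expand e T)) ρ) (⟦sub⟧ R (pairσ t) (proj₂ (expand e T)) ρ)) (sym (expand-sound e R T (one R₁ (I₁ t)) (λ p → ⟦_⟧ R (pairσ t p) ρ) h))
        where
        h : ∀ b p → ⟦_⟧ R (pairσ t (b ∷ p)) ρ ≡ pick (one R₁ (I₁ t) p) b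
        h false []      = refl
        h true  []      = refl
        h false (_ ∷ _) = refl
        h true  (_ ∷ _) = refl
      hD₁ : ∀ T t → I₁ (dn₁ e T t) ≡ mD R₁ T (I₂ t)
      hD₁ T t = trans (cong₂ _,_ (⟦sub⟧ R (pairσ₂ t) (proj₁ (expand e T)) ρ) (⟦sub⟧ R (pairσ₂ t) (proj₂ (expand e T)) ρ)) (sym (expand-sound e R T (penv R₁ (I₂ t)) (λ p → ⟦_⟧ R (pairσ₂ t p) ρ) h))
        where
        h : ∀ b p → ⟦_⟧ R (pairσ₂ t (b ∷ p)) ρ ≡ pick (penv R₁ (I₂ t) p) b
        h false []               = refl
        h true  []               = refl
        h false (false ∷ [])     = refl
        h false (true ∷ [])      = refl
        h true  (false ∷ [])     = refl
        h true  (true ∷ [])      = refl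
        h false (false ∷ _ ∷ _)  = refl
        h false (true ∷ _ ∷ _)   = refl
        h true  (false ∷ _ ∷ _)  = refl
        h true  (true ∷ _ ∷ _)   = refl
      hU₀ : ∀ T t → I₁ (up₀ T t) ≡ mU R T (I₀ t)
      hU₀ (A , B) t = cong₂ _,_ (h₀ A t) (h₀ B t)
      hU₁ : ∀ T t → I₂ (up₁ e T t) ≡ mU R₁ T (I₁ t)
      hU₁ (A , B) t = cong₂ _,_ (h₁ A t) (h₁ B t)

      kS0 : ∀ c s a → I₀ (Y.S0 c s a) ≡ S0 c s (I₀ a)
      kS0 c s a = h₀ (tS0 e c s) a
      kg0 : ∀ c s a → I₀ (Y.g0 c s a) ≡ g0 c s (I₀ a)
      kg0 c s a = h₀ (gS0 e c s) a
      kS2 : ∀ c s a → I₀ (Y.S2 c s a) ≡ S2 c s (I₀ a)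
      kS2 c s a = h₀ (tS2 e c s) a
      kg2 : ∀ c s a → I₀ (Y.g2 c s a) ≡ g2 c s (I₀ a)
      kg2 c s a = h₀ (gS2 e c s) a
      kS0′ : ∀ c s a → I₁ (Y.S0′ c s a) ≡ S0′ c s (I₁ a)
      kS0′ c s a = h₁ (tS0 e′ c s) a
      kg0′ : ∀ c s a → I₁ (Y.g0′ c s a) ≡ g0′ c s (I₁ a)
      kg0′ c s a = h₁ (gS0 e′ c s) a
      kS2′ : ∀ c s a → I₁ (Y.S2′ c s a) ≡ S2′ c s (I₁ a)
      kS2′ c s a = h₁ (tS2 e′ c s) a
      kg2′ : ∀ c s a → I₁ (Y.g2′ c s a) ≡ g2′ c s (I₁ a)
      kg2′ c s a = h₁ (gS2 e′ c s) a
      kU : ∀ c s a → I₁ (Y.U c s a) ≡ U c s (I₀ a)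
      kU c s a = hU₀ (tUp e c s) a
      kgU : ∀ c s a → I₁ (Y.gU c s a) ≡ gU c s (I₀ a)
      kgU c s a = hU₀ (gUp e c s) a
      kU′ : ∀ c s a → I₂ (Y.U′ c s a) ≡ U′ c s (I₁ a)
      kU′ c s a = hU₁ (tUp e′ c s) a
      kgU′ : ∀ c s a → I₂ (Y.gU′ c s a) ≡ gU′ c s (I₁ a)
      kgU′ c s a = hU₁ (gUp e′ c s) a
      kD : ∀ c s a → I₀ (Y.D c s a) ≡ D c s (I₁ a)
      kD c s a = hD₀ (tDn e c s) a
      kgD : ∀ c s a → I₀ (Y.gD c s a) ≡ gD c s (I₁ a)
      kgD c s a = hD₀ (gDn e c s) a
      kD′ : ∀ c s a → I₁ (Y.D′ c s a) ≡ D′ c s (I₂ a)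
      kD′ c s a = hD₁ (tDn e′ c s) a
      kgD′ : ∀ c s a → I₁ (Y.gD′ c s a) ≡ gD′ c s (I₂ a)
      kgD′ c s a = hD₁ (gDn e′ c s) a

      module Tr₀ {X Y Xs Ys : Set} (Ix : X → Xs) (Iy : Y → Ys) =
        Transfer R {X} {Y} {Tm} _t+_ tsg tz (chk e) Ix Iy I₀ (λ _ _ → refl) (λ b t → tsg-sound b t ρ) refl (λ a b h → chk-sound a b h ρ)
      module Tr₁ {X Y Xs Ys : Set} (Ix : X → Xs) (Iy : Y → Ys) =
        Transfer R₁ {X} {Y} {L₁} add₁ sg₁ z₁ (chk₁ e) Ix Iy I₁ (λ _ _ → refl) isg₁ refl ick₁
      module Tr₂ {X Y Xs Ys : Set} (Ix : X → Xs) (Iy : Y → Ys) =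
        Transfer R₂ {X} {Y} {L₂} add₂ sg₂ z₂ (chk₂ e) Ix Iy I₂ (λ _ _ → refl) isg₂ refl ick₂

    Jm : C → (C × C) × (C × C)
    Jm v = (𝟘 , v) , (zs (sgz e′) v , 𝟘)
    Km : (C × C) × (C × C) → C
    Km v = proj₂ (proj₁ v) ⊕ zs (sgz e) (proj₁ (proj₂ v))

    ρ₂ : (C × C) × (C × C) → List Bool → C
    ρ₂ v (b′ ∷ b ∷ []) = pick (pick v b) b′
    ρ₂ v _             = 𝟘

    private
      ev = allHold-holds e
      a1 = and-r {Y.p00} ev
      a2 = and-r {Y.p22} a1
      a3 = and-r {Y.p02} a2
      a4 = and-r {Y.p20} a3
      a5 = and-r {Y.p0U} a4
      a6 = and-r {Y.p2U} a5
      a7 = and-r {Y.pU0} a6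
      a8 = and-r {Y.pU2} a7
      a9 = and-r {Y.pUD} a8
      a10 = and-r {Y.pD0} a9
      a11 = and-r {Y.pD2} a10
      a12 = and-r {Y.p0D} a11
      a13 = and-r {Y.p2D} a12
      a14 = and-r {Y.pDU} a13
      a15 = and-r {Y.pUU} a14
      a16 = and-r {Y.pDD} a15
      a17 = and-r {Y.jD} a16
      a18 = and-r {Y.kU} a17

    zl₀ : ∀ {X : Set} → St → Site → Site → X → C
    zl₀ _ _ _ _ = 𝟘
    zl₁ : ∀ {X : Set} → St → Site → Site → X → C × C
    zl₁ _ _ _ _ = 𝟘 , 𝟘

    -- The indices name the labels in reading order. Each relation is its table entry with the
    -- generic argument specialised to the vector `v`.
    q00 : PairEq R sk sk e S0 g0 S0 g0 zl₀
    q00 c s t v = Tr₀.tr I₀ I₀ Y.S0 Y.g0 Y.S0 Y.g0 Y.no0 S0 g0 S0 g0 zl₀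
        kS0 kg0 kS0 kg0 (λ _ _ _ _ → refl) sk sk e Y.x0 c s t (all32-s Y.c00 (and-l ev) c s t)
      where open Int (one R v)
    q22 : PairEq R sk sk e S2 g2 S2 g2 zl₀
    q22 c s t v = Tr₀.tr I₀ I₀ Y.S2 Y.g2 Y.S2 Y.g2 Y.no0 S2 g2 S2 g2 zl₀
        kS2 kg2 kS2 kg2 (λ _ _ _ _ → refl) sk sk e Y.x0 c s t (all32-s Y.c22 (and-l a1) c s t)
      where open Int (one R v)
    q02 : PairEq R sk sk e S0 g0 S2 g2 zl₀
    q02 c s t v = Tr₀.tr I₀ I₀ Y.S0 Y.g0 Y.S2 Y.g2 Y.no0 S0 g0 S2 g2 zl₀
        kS0 kg0 kS2 kg2 (λ _ _ _ _ → refl) sk sk e Y.x0 c s t (all32-s Y.c02 (and-l a2) c s t)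
      where open Int (one R v)
    q20 : PairEq R sk sk e S2 g2 S0 g0 (λ c s t v → D (nx uk c s) t (U c s v))
    q20 c s t v = Tr₀.tr I₀ I₀ Y.S2 Y.g2 Y.S0 Y.g0 (λ c s t a → Y.D (nx uk c s) t (Y.U c s a)) S2 g2 S0 g0 (λ c s t v → D (nx uk c s) t (U c s v))
        kS2 kg2 kS0 kg0 (λ c s t a → trans (kD (nx uk c s) t (Y.U c s a)) (cong (D (nx uk c s) t) (kU c s a))) sk sk e Y.x0 c s t (all32-s Y.c20 (and-l a3) c s t)
      where open Int (one R v)
    q0U : PairEq R₁ sk uk e′ S0 g0 U gU zl₁
    q0U c s t v = Tr₁.tr I₀ I₀ Y.S0 Y.g0 Y.U Y.gU Y.no1 S0 g0 U gU zl₁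
        kS0 kg0 kU kgU (λ _ _ _ _ → refl) sk uk e′ Y.x0 c s t (all32-s Y.c0U (and-l a4) c s t)
      where open Int (one R v)
    q2U : PairEq R₁ sk uk e′ S2 g2 U gU (λ c s t v → Raw.zs R₁ (sgz e) (S2′ (nx uk c s) t (U c s v)))
    q2U c s t v = Tr₁.tr I₀ I₀ Y.S2 Y.g2 Y.U Y.gU (λ c s t a → sg₁ e (Y.S2′ (nx uk c s) t (Y.U c s a))) S2 g2 U gU (λ c s t v → Raw.zs R₁ (sgz e) (S2′ (nx uk c s) t (U c s v)))
        kS2 kg2 kU kgU (λ c s t a → trans (isg₁ e (Y.S2′ (nx uk c s) t (Y.U c s a))) (cong (Raw.zs R₁ (sgz e)) (trans (kS2′ (nx uk c s) t (Y.U c s a)) (cong (S2′ (nx uk c s) t) (kU c s a))))) sk uk e′ Y.x0 c s t (all32-s Y.c2U (and-l a5) c s t)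
      where open Int (one R v)
    qU0 : PairEq R₁ uk sk e′ U gU S0′ g0′ (λ c s t v → U (nx sk c s) t (S0 c s v))
    qU0 c s t v = Tr₁.tr I₀ I₁ Y.U Y.gU Y.S0′ Y.g0′ (λ c s t a → Y.U (nx sk c s) t (Y.S0 c s a)) U gU S0′ g0′ (λ c s t v → U (nx sk c s) t (S0 c s v))
        kU kgU kS0′ kg0′ (λ c s t a → trans (kU (nx sk c s) t (Y.S0 c s a)) (cong (U (nx sk c s) t) (kS0 c s a))) uk sk e′ Y.x0 c s t (all32-s Y.cU0 (and-l a6) c s t)
      where open Int (one R v)
    qU2 : PairEq R₁ uk sk e′ U gU S2′ g2′ zl₁
    qU2 c s t v = Tr₁.tr I₀ I₁ Y.U Y.gU Y.S2′ Y.g2′ Y.no1 U gU S2′ g2′ zl₁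
        kU kgU kS2′ kg2′ (λ _ _ _ _ → refl) uk sk e′ Y.x0 c s t (all32-s Y.cU2 (and-l a7) c s t)
      where open Int (one R v)
    qUD : PairEq R uk uk e U gU D gD zl₀
    qUD c s t v = Tr₀.tr I₀ I₁ Y.U Y.gU Y.D Y.gD Y.no0 U gU D gD zl₀
        kU kgU kD kgD (λ _ _ _ _ → refl) uk uk e Y.x0 c s t (all32-s Y.cUD (and-l a8) c s t)
      where open Int (one R v)
    qD0 : PairEq R uk sk e D gD S0 g0 (λ c s t v → D (nx sk c s) t (S0′ c s v))
    qD0 c s t v = Tr₀.tr I₁ I₀ Y.D Y.gD Y.S0 Y.g0 (λ c s t a → Y.D (nx sk c s) t (Y.S0′ c s a)) D gD S0 g0 (λ c s t v → D (nx sk c s) t (S0′ c s v))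
        kD kgD kS0 kg0 (λ c s t a → trans (kD (nx sk c s) t (Y.S0′ c s a)) (cong (D (nx sk c s) t) (kS0′ c s a))) uk sk e Y.x1 c s t (all32-s Y.cD0 (and-l a9) c s t)
      where open Int (penv R v)
    qD2 : PairEq R uk sk e D gD S2 g2 zl₀
    qD2 c s t v = Tr₀.tr I₁ I₀ Y.D Y.gD Y.S2 Y.g2 Y.no0 D gD S2 g2 zl₀
        kD kgD kS2 kg2 (λ _ _ _ _ → refl) uk sk e Y.x1 c s t (all32-s Y.cD2 (and-l a10) c s t)
      where open Int (penv R v)
    q0D : PairEq R sk uk e S0′ g0′ D gD zl₀
    q0D c s t v = Tr₀.tr I₁ I₁ Y.S0′ Y.g0′ Y.D Y.gD Y.no0 S0′ g0′ D gD zl₀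
        kS0′ kg0′ kD kgD (λ _ _ _ _ → refl) sk uk e Y.x1 c s t (all32-s Y.c0D (and-l a11) c s t)
      where open Int (penv R v)
    q2D : PairEq R sk uk e S2′ g2′ D gD (λ c s t v → zs (sgz e′) (S2 (nx uk c s) t (D c s v)))
    q2D c s t v = Tr₀.tr I₁ I₁ Y.S2′ Y.g2′ Y.D Y.gD (λ c s t a → tsg e′ (Y.S2 (nx uk c s) t (Y.D c s a))) S2′ g2′ D gD (λ c s t v → zs (sgz e′) (S2 (nx uk c s) t (D c s v)))
        kS2′ kg2′ kD kgD (λ c s t a → trans (tsg-sound e′ (Y.S2 (nx uk c s) t (Y.D c s a)) _) (cong (zs (sgz e′)) (trans (kS2 (nx uk c s) t (Y.D c s a)) (cong (S2 (nx uk c s) t) (kD c s a))))) sk uk e Y.x1 c s t (all32-s Y.c2D (and-l a12) c s t)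
      where open Int (penv R v)
    qDU : PairEq R₁ uk uk e′ D gD U gU (λ c s t v → Raw.zs R₁ (sgz e) (S2′ (nx sk c s) t (S0′ c s v)))
    qDU c s t v = Tr₁.tr I₁ I₀ Y.D Y.gD Y.U Y.gU (λ c s t a → sg₁ e (Y.S2′ (nx sk c s) t (Y.S0′ c s a))) D gD U gU (λ c s t v → Raw.zs R₁ (sgz e) (S2′ (nx sk c s) t (S0′ c s v)))
        kD kgD kU kgU (λ c s t a → trans (isg₁ e (Y.S2′ (nx sk c s) t (Y.S0′ c s a))) (cong (Raw.zs R₁ (sgz e)) (trans (kS2′ (nx sk c s) t (Y.S0′ c s a)) (cong (S2′ (nx sk c s) t) (kS0′ c s a))))) uk uk e′ Y.x1 c s t (all32-s Y.cDU (and-l a13) c s t)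
      where open Int (penv R v)

    module JK (ρ : List Bool → C) where
      open Int ρ
      hJ : ∀ t → I₂ (J₀ e t) ≡ Jm (I₀ t)
      hJ t = cong (λ u → (𝟘 , I₀ t) , (u , 𝟘)) (tsg-sound e′ t ρ)
      hK : ∀ t → I₀ (K₀ e t) ≡ Km (I₂ t)
      hK t = cong (I₀ (proj₂ (proj₁ t)) ⊕_) (tsg-sound e (proj₁ (proj₂ t)) ρ)

    qUU : PairEq R₂ uk uk e U gU U′ gU′ (λ c s t v → Raw.zs R₂ (sgz e) (Jm (S2 (nx sk c s) t (S0 c s v))))
    qUU c s t v = Tr₂.tr I₀ I₁ Y.U Y.gU Y.U′ Y.gU′ (λ c s t a → sg₂ e (J₀ e (Y.S2 (nx sk c s) t (Y.S0 c s a)))) U gU U′ gU′ (λ c s t v → Raw.zs R₂ (sgz e) (Jm (S2 (nx sk c s) t (S0 c s v))))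
        kU kgU kU′ kgU′ (λ c s t a → trans (isg₂ e (J₀ e (Y.S2 (nx sk c s) t (Y.S0 c s a)))) (cong (Raw.zs R₂ (sgz e)) (trans (hJ (Y.S2 (nx sk c s) t (Y.S0 c s a))) (cong Jm (trans (kS2 (nx sk c s) t (Y.S0 c s a)) (cong (S2 (nx sk c s) t) (kS0 c s a))))))) uk uk e Y.x0 c s t (all32-s Y.cUU (and-l a14) c s t)
      where
      open Int (one R v)
      open JK (one R v)
    qDD : PairEq R uk uk e D′ gD′ D gD (λ c s t v → S2 (nx sk c s) t (S0 c s (Km v)))
    qDD c s t v = Tr₀.tr I₂ I₁ Y.D′ Y.gD′ Y.D Y.gD (λ c s t a → Y.S2 (nx sk c s) t (Y.S0 c s (K₀ e a))) D′ gD′ D gD (λ c s t v → S2 (nx sk c s) t (S0 c s (Km v)))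
        kD′ kgD′ kD kgD (λ c s t a → trans (kS2 (nx sk c s) t (Y.S0 c s (K₀ e a))) (cong (S2 (nx sk c s) t) (trans (kS0 c s (K₀ e a)) (cong (S0 c s) (hK a))))) uk uk e Y.x2 c s t (all32-s Y.cDD (and-l a15) c s t)
      where
      open Int (ρ₂ v)
      open JK (ρ₂ v)

    JD : ∀ c s v → D′ c s (Jm v) ≡ Raw.zs R₁ -[1+ 0 ] (U c s v)
    JD c s v = trans (cong (D′ c s) (sym (hJ Y.x0))) (trans (sym (kD′ c s (J₀ e Y.x0))) (trans (ick₁ (Y.D′ c s (J₀ e Y.x0)) (sg₁ false (Y.U c s Y.x0)) (allS-s e Y.cjD (and-l a16) c s)) (trans (isg₁ false (Y.U c s Y.x0)) (cong (Raw.zs R₁ -[1+ 0 ]) (kU c s Y.x0)))))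
      where
      open Int (one R v)
      open JK (one R v)
    KU : ∀ c s v → Km (U′ c s v) ≡ zs (sgz e′) (D c s v)
    KU c s v = trans (cong Km (sym (kU′ c s Y.x1))) (trans (sym (hK (Y.U′ c s Y.x1))) (trans (chk-sound (K₀ e (Y.U′ c s Y.x1)) (tsg e′ (Y.D c s Y.x1)) (allS-s e Y.ckU (and-l a17) c s) _) (trans (tsg-sound e′ (Y.D c s Y.x1) _) (cong (zs (sgz e′)) (kD c s Y.x1)))))
      where
      open Int (penv R v)
      open JK (penv R v)

    allL-s : ∀ f → Checks.allL e f ≡ true → ∀ l → f l ≡ true
    allL-s f h ad = and-l h
    allL-s f h ah = and-l (and-r {f ad} h)
    allL-s f h ld = and-l (and-r {f ah} (and-r {f ad} h))
    allL-s f h lh = and-l (and-r {f ld} (and-r {f ah} (and-r {f ad} h)))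
    allL-s f h zz = and-l (and-r {f lh} (and-r {f ld} (and-r {f ah} (and-r {f ad} h))))
    allL-s f h ww = and-r {f zz} (and-r {f lh} (and-r {f ld} (and-r {f ah} (and-r {f ad} h))))

    JI : Inter R R₂
    JI = record
      { f  = Jm
      ; f⊕ = λ u v → cong₂ _,_ (cong (_, u ⊕ v) (sym (idl 𝟘))) (cong₂ _,_ (zs-⊕ _ u v) (sym (idl 𝟘)))
      ; fz = λ a v → cong₂ _,_ (cong (_, zs a v) (sym (zs-𝟘 a))) (cong₂ _,_ (zs-comm _ a v) (sym (zs-𝟘 a)))
      ; f𝟘 = cong (λ u → (𝟘 , 𝟘) , (u , 𝟘)) (zs-𝟘 _)
      ; fa = fa
      }
      where
      fa : ∀ l v → Jm (act l v) ≡ Raw.act R₂ l (Jm v)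
      fa l v = sym (trans (cong (Raw.act R₂ l) (sym (hJ Y.x0))) (trans (sym (cong₂ _,_ (hD₁ (proj₁ (tab e′ l)) (J₀ e Y.x0)) (hD₁ (proj₂ (tab e′ l)) (J₀ e Y.x0))))
         (trans (ick₂ (dn₁ e (proj₁ (tab e′ l)) (J₀ e Y.x0) , dn₁ e (proj₂ (tab e′ l)) (J₀ e Y.x0)) (J₀ e (tl l Y.x0)) (allL-s Y.cjl (and-l a18) l)) (hJ (tl l Y.x0)))))
        where
        open Int (one R v)
        open JK (one R v)

    KI : Inter R₂ R
    KI = record
      { f  = Km
      ; f⊕ = λ u v → trans (cong ((proj₂ (proj₁ u) ⊕ proj₂ (proj₁ v)) ⊕_) (zs-⊕ _ _ _)) (four _ _ _ _)
      ; fz = λ a v → trans (cong (zs a (proj₂ (proj₁ v)) ⊕_) (zs-comm _ a _)) (sym (zs-⊕ a _ _))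
      ; f𝟘 = trans (cong (𝟘 ⊕_) (zs-𝟘 _)) (idl 𝟘)
      ; fa = fa
      }
      where
      fa : ∀ l v → Km (Raw.act R₂ l v) ≡ act l (Km v)
      fa l v = trans (cong Km (sym (cong₂ _,_ (hD₁ (proj₁ (tab e′ l)) Y.x2) (hD₁ (proj₂ (tab e′ l)) Y.x2)))) (trans (sym (hK (dn₁ e (proj₁ (tab e′ l)) Y.x2 , dn₁ e (proj₂ (tab e′ l)) Y.x2)))
         (trans (chk-sound (K₀ e (dn₁ e (proj₁ (tab e′ l)) Y.x2 , dn₁ e (proj₂ (tab e′ l)) Y.x2)) (tl l (K₀ e Y.x2)) (allL-s Y.ckl (and-r {Y.jl} a18) l) _) (cong (act l) (hK Y.x2))))
        where
        open Int (ρ₂ v)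
        open JK (ρ₂ v)

-- Label lists as functionals on site words, and the telescoping domino sum.

module Labels (q x : ℤ) where

  open TermAlgebra
  open Tables
  open Semantics q x
  open Doubling q x

  ep : ℕ → Bool
  ep zero    = true
  ep (suc d) = not (ep d)

  -- Over this representation the matrices of `lS0` and `lS2` are the scalars 0, 1, x, q, which
  -- produce the weight x^hs q^vs.
  base : Raw
  base = record { C = ℤ ; 𝟘 = + 0 ; _⊕_ = _+ᶻ_ ; zs = _*ᶻ_ ; act = ac }
    where
    ac : Letter → ℤ → ℤ
    ac zz v = + 0
    ac ww v = + 0
    ac _  v = v

  baseL : Laws true base
  baseL = record
    { assoc = ℤₚ.+-assoc ; comm = ℤₚ.+-comm ; idl = ℤₚ.+-identityˡ
    ; zs-+ = λ a b v → ℤₚ.*-distribʳ-+ v a b ; zs-* = λ a b v → ℤₚ.*-assoc a b v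
    ; zs-⊕ = ℤₚ.*-distribˡ-+ ; zs-1 = ℤₚ.*-identityˡ ; zs-0 = ℤₚ.*-zeroˡ
    ; act-⊕ = a⊕ ; act-z = az ; rule = rl }
    where
    a⊕ : ∀ l u v → Raw.act base l (u +ᶻ v) ≡ Raw.act base l u +ᶻ Raw.act base l v
    a⊕ ad u v = refl
    a⊕ ah u v = refl
    a⊕ ld u v = refl
    a⊕ lh u v = refl
    a⊕ zz u v = refl
    a⊕ ww u v = refl
    az : ∀ l a v → Raw.act base l (a *ᶻ v) ≡ a *ᶻ Raw.act base l v
    az ad a v = refl
    az ah a v = refl
    az ld a v = refl
    az lh a v = refl
    az zz a v = sym (ℤₚ.*-zeroʳ a)
    az ww a v = sym (ℤₚ.*-zeroʳ a)
    n1 : ∀ a v → v ≡ v +ᶻ -[1+ 0 ] *ᶻ (a *ᶻ + 0)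
    n1 = solve-∀
    n2 : ∀ a v → v ≡ v +ᶻ a *ᶻ + 0
    n2 = solve-∀
    rl : ∀ r v → ⟦_⟧ base (ruleL r) (one base v) ≡ ⟦_⟧ base (ruleR true r) (one base v)
    rl lhad v = n1 x v
    rl ldah v = n1 q v
    rl adlh v = n2 x v
    rl ahld v = n1 q v
    rl adz v = refl
    rl ahz v = refl
    rl lhw v = refl
    rl ldw v = refl

  V : ℕ → Raw
  V zero    = base
  V (suc d) = dbl (ep d) (V d)

  LV : ∀ d → Laws (ep d) (V d)
  LV zero    = baseL
  LV (suc d) = dblLaws (LV d)

  CV : ℕ → Set
  CV d = Raw.C (V d)

  -- A label from depth d to depth d′; at depth d the auxiliary space has been doubled d times.
  data Lab : ℕ → ℕ → Set where
    lS0 lS2 : ∀ {d} → Lab d d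
    lU      : ∀ {d} → Lab d (suc d)
    lD      : ∀ {d} → Lab (suc d) d

  kind : ∀ {d d′} → Lab d d′ → Kind
  kind lS0 = sk
  kind lS2 = sk
  kind lU  = uk
  kind lD  = uk

  M G : ∀ {d d′} → Lab d d′ → St → Site → CV d → CV d′
  M {d} lS0 c s = mS (V d) (tS0 (ep d) c s)
  M {d} lS2 c s = mS (V d) (tS2 (ep d) c s)
  M {d} lU  c s = mU (V d) (tUp (ep d) c s)
  M (lD {d}) c s = mD (V d) (tDn (ep d) c s)
  G {d} lS0 c s = mS (V d) (gS0 (ep d) c s)
  G {d} lS2 c s = mS (V d) (gS2 (ep d) c s)
  G {d} lU  c s = mU (V d) (gUp (ep d) c s)
  G (lD {d}) c s = mD (V d) (gDn (ep d) c s)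

  infixr 5 _∷_
  -- The index is the depth at which the list starts. It ends at depth 0, so that the product of the
  -- matrices is a scalar.
  data Labs : ℕ → Set where
    []  : Labs 0
    _∷_ : ∀ {d d′} → Lab d d′ → Labs d′ → Labs d

  len : ∀ {d} → Labs d → ℕ
  len []       = 0
  len (_ ∷ ls) = suc (len ls)

  -- Every row pair has to be complete at the end of the word.
  fin : St → ℤ → ℤ
  fin o v = v
  fin i v = + 0

  ev : ∀ {d} → Labs d → St → CV d → List Site → ℤ
  ev []       c v []      = fin c v
  ev []       c v (_ ∷ _) = + 0
  ev (l ∷ ls) c v []      = + 0
  ev (l ∷ ls) c v (s ∷ w) = ev ls (nx (kind l) c s) (M l c s v) w

  module _ {d : ℕ} where
    open Raw (V d)
    open Laws (LV d)
    open Lin (LV d)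
    mS-⊕ : ∀ T u v → mS (V d) T (u ⊕ v) ≡ mS (V d) T u ⊕ mS (V d) T v
    mS-⊕ T u v = trans (⟦⟧-cong (V d) T h) (⟦⟧-⊕ T _ _)
      where
      h : ∀ p → one (V d) (u ⊕ v) p ≡ one (V d) u p ⊕ one (V d) v p
      h []      = refl
      h (_ ∷ _) = sym (idl _)
    mS-z : ∀ T a v → mS (V d) T (zs a v) ≡ zs a (mS (V d) T v)
    mS-z T a v = trans (⟦⟧-cong (V d) T h) (⟦⟧-z T a _)
      where
      h : ∀ p → one (V d) (zs a v) p ≡ zs a (one (V d) v p)
      h []      = refl
      h (_ ∷ _) = sym (zs-𝟘 a)
    mD-⊕ : ∀ T u v → mD (V d) T (proj₁ u ⊕ proj₁ v , proj₂ u ⊕ proj₂ v) ≡ mD (V d) T u ⊕ mD (V d) T v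
    mD-⊕ T u v = trans (⟦⟧-cong (V d) T h) (⟦⟧-⊕ T _ _)
      where
      h : ∀ p → penv (V d) (proj₁ u ⊕ proj₁ v , proj₂ u ⊕ proj₂ v) p ≡ penv (V d) u p ⊕ penv (V d) v p
      h []              = sym (idl _)
      h (false ∷ [])    = refl
      h (true ∷ [])     = refl
      h (false ∷ _ ∷ _) = sym (idl _)
      h (true ∷ _ ∷ _)  = sym (idl _)
    mD-z : ∀ T a v → mD (V d) T (zs a (proj₁ v) , zs a (proj₂ v)) ≡ zs a (mD (V d) T v)
    mD-z T a v = trans (⟦⟧-cong (V d) T h) (⟦⟧-z T a _)
      where
      h : ∀ p → penv (V d) (zs a (proj₁ v) , zs a (proj₂ v)) p ≡ zs a (penv (V d) v p)
      h []              = sym (zs-𝟘 a)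
      h (false ∷ [])    = refl
      h (true ∷ [])     = refl
      h (false ∷ _ ∷ _) = sym (zs-𝟘 a)
      h (true ∷ _ ∷ _)  = sym (zs-𝟘 a)

  M-⊕ : ∀ {d d′} (l : Lab d d′) c s u v → M l c s (Raw._⊕_ (V d) u v) ≡ Raw._⊕_ (V d′) (M l c s u) (M l c s v)
  M-⊕ {d} lS0 c s u v = mS-⊕ {d} (tS0 (ep d) c s) u v
  M-⊕ {d} lS2 c s u v = mS-⊕ {d} (tS2 (ep d) c s) u v
  M-⊕ {d} lU c s u v = cong₂ _,_ (mS-⊕ {d} (proj₁ (tUp (ep d) c s)) u v) (mS-⊕ {d} (proj₂ (tUp (ep d) c s)) u v)
  M-⊕ (lD {d}) c s u v = mD-⊕ {d} (tDn (ep d) c s) u v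

  M-z : ∀ {d d′} (l : Lab d d′) c s a v → M l c s (Raw.zs (V d) a v) ≡ Raw.zs (V d′) a (M l c s v)
  M-z {d} lS0 c s u v = mS-z {d} (tS0 (ep d) c s) u v
  M-z {d} lS2 c s u v = mS-z {d} (tS2 (ep d) c s) u v
  M-z {d} lU c s u v = cong₂ _,_ (mS-z {d} (proj₁ (tUp (ep d) c s)) u v) (mS-z {d} (proj₂ (tUp (ep d) c s)) u v)
  M-z (lD {d}) c s u v = mD-z {d} (tDn (ep d) c s) u v

  ev-⊕ : ∀ {d} (ls : Labs d) c u v w → ev ls c (Raw._⊕_ (V d) u v) w ≡ ev ls c u w +ᶻ ev ls c v w
  ev-⊕ [] o u v []      = refl
  ev-⊕ [] i u v []      = refl
  ev-⊕ [] c u v (_ ∷ _) = refl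
  ev-⊕ (l ∷ ls) c u v []      = refl
  ev-⊕ (l ∷ ls) c u v (s ∷ w) = trans (cong (λ y → ev ls _ y w) (M-⊕ l c s u v)) (ev-⊕ ls _ _ _ w)

  ev-z : ∀ {d} (ls : Labs d) c a v w → ev ls c (Raw.zs (V d) a v) w ≡ a *ᶻ ev ls c v w
  ev-z [] o a v []      = refl
  ev-z [] i a v []      = sym (ℤₚ.*-zeroʳ a)
  ev-z [] c a v (_ ∷ _) = sym (ℤₚ.*-zeroʳ a)
  ev-z (l ∷ ls) c a v []      = sym (ℤₚ.*-zeroʳ a)
  ev-z (l ∷ ls) c a v (s ∷ w) = trans (cong (λ y → ev ls _ y w) (M-z l c s a v)) (ev-z ls _ a _ w)

  ev-𝟘 : ∀ {d} (ls : Labs d) c w → ev ls c (Raw.𝟘 (V d)) w ≡ + 0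
  ev-𝟘 {d} ls c w = trans (cong (λ y → ev ls c y w) (sym (Laws.zs-0 (LV d) (Raw.𝟘 (V d))))) (trans (ev-z ls c (+ 0) _ w) (ℤₚ.*-zeroˡ (ev ls c (Raw.𝟘 (V d)) w)))

  single : Site → Bool
  single s0 = false
  single su = true
  single sd = true
  single st = false

  xr : Bool → Bool → Bool
  xr true  b = not b
  xr false b = b

  flb : Bool → St → St
  flb true  c = flip c
  flb false c = c

  kb : Kind → Bool
  kb sk = false
  kb uk = true

  nx-fl : ∀ k c s → nx k c s ≡ flb (xr (kb k) (single s)) c
  nx-fl sk c s0 = refl
  nx-fl sk c su = refl
  nx-fl sk c sd = refl
  nx-fl sk c st = refl
  nx-fl uk c s0 = refl
  nx-fl uk c su = refl
  nx-fl uk c sd = refl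
  nx-fl uk c st = refl

  flb-flb : ∀ a b c → flb a (flb b c) ≡ flb (xr a b) c
  flb-flb true true o = refl
  flb-flb true true i = refl
  flb-flb true false c = refl
  flb-flb false b c = refl

  xsw : ∀ a b s t → xr (xr a t) (xr b s) ≡ xr (xr a b) (xr s t)
  xsw true true true true = refl
  xsw true true true false = refl
  xsw true true false true = refl
  xsw true true false false = refl
  xsw true false true true = refl
  xsw true false true false = refl
  xsw true false false true = refl
  xsw true false false false = refl
  xsw false true true true = refl
  xsw false true true false = refl
  xsw false true false true = refl
  xsw false true false false = refl
  xsw false false true true = refl
  xsw false false true false = refl
  xsw false false false true = refl
  xsw false false false false = refl

  -- Only the parities of the kinds and of the sites enter. Moves preserve the latter and the
  -- lowered pairs of `pairLow` the former, so all terms of one exchange relation end in the same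
  -- state.
  nx-nx : ∀ kP kQ c s t → nx kQ (nx kP c s) t ≡ flb (xr (xr (kb kQ) (kb kP)) (xr (single s) (single t))) c
  nx-nx kP kQ c s t = trans (nx-fl kQ _ t) (trans (cong (flb (xr (kb kQ) (single t))) (nx-fl kP c s)) (trans (flb-flb (xr (kb kQ) (single t)) (xr (kb kP) (single s)) c) (cong (λ b → flb b c) (xsw (kb kQ) (kb kP) (single s) (single t)))))

  Par : Site → Site → Bool × Site × Site → Set
  Par s t (_ , s₂ , t₂) = xr (single s₂) (single t₂) ≡ xr (single s) (single t)

  moves-par : ∀ η s t → All (Par s t) (moves η s t)
  moves-par η s0 s0 = []
  moves-par η s0 su = refl ∷ []
  moves-par η s0 sd = refl ∷ []
  moves-par η s0 st = refl ∷ refl ∷ []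
  moves-par η su s0 = []
  moves-par η su su = []
  moves-par η su sd = refl ∷ []
  moves-par η su st = refl ∷ []
  moves-par η sd s0 = []
  moves-par η sd su = refl ∷ []
  moves-par η sd sd = []
  moves-par η sd st = refl ∷ []
  moves-par η st t = []

  -- τ tells whether the number of letters 0 still to be read is even.
  moveSum : (List Site → ℤ) → List Site → List (Bool × Site × Site) → ℤ
  moveSum f w = foldr (λ m a → sgz (proj₁ m) *ᶻ f (proj₁ (proj₂ m) ∷ proj₂ (proj₂ m) ∷ w) +ᶻ a) (+ 0)

  dominoSum : Bool → (List Site → ℤ) → List Site → ℤ
  dominoSum τ f (s ∷ t ∷ w) = moveSum f w (moves (xr (single t) (xr (single s) τ)) s t) +ᶻ dominoSum (xr (single s) τ) (λ u → f (s ∷ u)) (t ∷ w)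
  dominoSum τ f _           = + 0

  eta-nx : ∀ {d d′} (l : Lab d d′) c s → eta (ep d′) (nx (kind l) c s) ≡ xr (single s) (eta (ep d) c)
  eta-nx lS0 c s = etaS _ c s
    where
    etaS : ∀ e c s → eta e (nx sk c s) ≡ xr (single s) (eta e c)
    etaS e o s0 = refl
    etaS e o su = refl
    etaS e o sd = refl
    etaS e o st = refl
    etaS e i s0 = refl
    etaS e i su = sym (not-involutive e)
    etaS e i sd = sym (not-involutive e)
    etaS e i st = refl
  eta-nx (lS2 {d}) c s = eta-nx (lS0 {d}) c s
  eta-nx (lU {d}) c s = etaU (ep d) c s
    where
    etaU : ∀ e c s → eta (not e) (nx uk c s) ≡ xr (single s) (eta e c)
    etaU e o s0 = not-involutive e
    etaU e o su = refl
    etaU e o sd = refl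
    etaU e o st = not-involutive e
    etaU e i s0 = refl
    etaU e i su = refl
    etaU e i sd = refl
    etaU e i st = refl
  eta-nx (lD {d}) c s = etaD (ep d) c s
    where
    etaD : ∀ e c s → eta e (nx uk c s) ≡ xr (single s) (eta (not e) c)
    etaD e o s0 = refl
    etaD e o su = sym (not-involutive e)
    etaD e o sd = sym (not-involutive e)
    etaD e o st = refl
    etaD e i s0 = sym (not-involutive e)
    etaD e i su = cong not (sym (not-involutive e))
    etaD e i sd = cong not (sym (not-involutive e))
    etaD e i st = sym (not-involutive e)

  ep-eq : ∀ k d → ep (k ℕ.+ suc (suc d)) ≡ ep (k ℕ.+ d)
  ep-eq zero d    = not-involutive (ep d)
  ep-eq (suc k) d = cong not (ep-eq k d)

  -- Here `k` counts the doublings that lie outside the inserted two.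
  Jint : ∀ k d → Inter (V (k ℕ.+ d)) (V (k ℕ.+ suc (suc d)))
  Jint zero d    = Level.JI (LV d)
  Jint (suc k) d = liftI (sym (ep-eq k d)) (Jint k d)

  Kint : ∀ k d → Inter (V (k ℕ.+ suc (suc d))) (V (k ℕ.+ d))
  Kint zero d    = Level.KI (LV d)
  Kint (suc k) d = liftI (ep-eq k d) (Kint k d)

  jf : ∀ k d → CV (k ℕ.+ d) → CV (k ℕ.+ suc (suc d))
  jf k d = Inter.f (Jint k d)
  kf : ∀ k d → CV (k ℕ.+ suc (suc d)) → CV (k ℕ.+ d)
  kf k d = Inter.f (Kint k d)

  -- The singlet embedding V d → V (d + 2) slides to the right through all labels until a matching lD turns it into lU.
  jmap : ∀ k d → Labs (k ℕ.+ suc (suc d)) → Labs (k ℕ.+ d)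
  jmap zero d (lS0 ∷ ls)    = lS0 ∷ jmap zero d ls
  jmap zero d (lS2 ∷ ls)    = lS2 ∷ jmap zero d ls
  jmap zero d (lU ∷ ls)     = lU ∷ jmap (suc zero) d ls
  jmap zero d (lD ∷ ls)     = lU ∷ ls
  jmap (suc k) d (lS0 ∷ ls) = lS0 ∷ jmap (suc k) d ls
  jmap (suc k) d (lS2 ∷ ls) = lS2 ∷ jmap (suc k) d ls
  jmap (suc k) d (lU ∷ ls)  = lU ∷ jmap (suc (suc k)) d ls
  jmap (suc k) d (lD ∷ ls)  = lD ∷ jmap k d ls

  jS : ∀ k d (T : Bool → Tm) v → mS (V (k ℕ.+ suc (suc d))) (T (ep (k ℕ.+ suc (suc d)))) (jf k d v) ≡ jf k d (mS (V (k ℕ.+ d)) (T (ep (k ℕ.+ d))) v)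
  jS k d T v = trans (cong (λ e → mS (V (k ℕ.+ suc (suc d))) (T e) (jf k d v)) (ep-eq k d)) (sym (Inter.nat-S (Jint k d) (T (ep (k ℕ.+ d))) v))

  jD : ∀ k d (T : Bool → Tm) v → mD (V (k ℕ.+ suc (suc d))) (T (ep (k ℕ.+ suc (suc d)))) (jf (suc k) d v) ≡ jf k d (mD (V (k ℕ.+ d)) (T (ep (k ℕ.+ d))) v)
  jD k d T v = trans (cong (λ e → mD (V (k ℕ.+ suc (suc d))) (T e) (jf (suc k) d v)) (ep-eq k d)) (sym (Inter.nat-D (Jint k d) (T (ep (k ℕ.+ d))) v))

  kS : ∀ k d (T : Bool → Tm) v → kf k d (mS (V (k ℕ.+ suc (suc d))) (T (ep (k ℕ.+ suc (suc d)))) v) ≡ mS (V (k ℕ.+ d)) (T (ep (k ℕ.+ d))) (kf k d v)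
  kS k d T v = trans (Inter.nat-S (Kint k d) (T (ep (k ℕ.+ suc (suc d)))) v) (cong (λ e → mS (V (k ℕ.+ d)) (T e) (kf k d v)) (ep-eq k d))

  kD : ∀ k d (T : Bool → Tm) v → kf k d (mD (V (k ℕ.+ suc (suc d))) (T (ep (k ℕ.+ suc (suc d)))) v) ≡ mD (V (k ℕ.+ d)) (T (ep (k ℕ.+ d))) (kf (suc k) d v)
  kD k d T v = trans (Inter.nat-D (Kint k d) (T (ep (k ℕ.+ suc (suc d)))) v) (cong (λ e → mD (V (k ℕ.+ d)) (T e) (kf (suc k) d v)) (ep-eq k d))

  -- The sign comes from the matching `lD`, by `JD`; all labels before it commute with `jf`.
  jmap-sound : ∀ k d (ls : Labs (k ℕ.+ suc (suc d))) c v w → ev ls c (jf k d v) w ≡ -[1+ 0 ] *ᶻ ev (jmap k d ls) c v w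
  jmap-sound zero d (lS0 ∷ ls) c v [] = refl
  jmap-sound zero d (lS2 ∷ ls) c v [] = refl
  jmap-sound zero d (lU ∷ ls) c v [] = refl
  jmap-sound zero d (lD ∷ ls) c v [] = refl
  jmap-sound (suc k) d (lS0 ∷ ls) c v [] = refl
  jmap-sound (suc k) d (lS2 ∷ ls) c v [] = refl
  jmap-sound (suc k) d (lU ∷ ls) c v [] = refl
  jmap-sound (suc k) d (lD ∷ ls) c v [] = refl
  jmap-sound zero d (lS0 ∷ ls) c v (s ∷ w) = trans (cong (λ y → ev ls _ y w) (jS 0 d (λ e → tS0 e c s) v)) (jmap-sound zero d ls _ _ w)
  jmap-sound zero d (lS2 ∷ ls) c v (s ∷ w) = trans (cong (λ y → ev ls _ y w) (jS 0 d (λ e → tS2 e c s) v)) (jmap-sound zero d ls _ _ w)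
  jmap-sound zero d (lU ∷ ls) c v (s ∷ w) =
    trans (cong (λ y → ev ls _ y w) (cong₂ _,_ (jS 0 d (λ e → proj₁ (tUp e c s)) v) (jS 0 d (λ e → proj₂ (tUp e c s)) v))) (jmap-sound 1 d ls _ _ w)
  jmap-sound zero d (lD ∷ ls) c v (s ∷ w) = trans (cong (λ y → ev ls _ y w) (Level.JD (LV d) c s v)) (ev-z ls _ -[1+ 0 ] _ w)
  jmap-sound (suc k) d (lS0 ∷ ls) c v (s ∷ w) = trans (cong (λ y → ev ls _ y w) (jS (suc k) d (λ e → tS0 e c s) v)) (jmap-sound (suc k) d ls _ _ w)
  jmap-sound (suc k) d (lS2 ∷ ls) c v (s ∷ w) = trans (cong (λ y → ev ls _ y w) (jS (suc k) d (λ e → tS2 e c s) v)) (jmap-sound (suc k) d ls _ _ w)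
  jmap-sound (suc k) d (lU ∷ ls) c v (s ∷ w) =
    trans (cong (λ y → ev ls _ y w) (cong₂ _,_ (jS (suc k) d (λ e → proj₁ (tUp e c s)) v) (jS (suc k) d (λ e → proj₂ (tUp e c s)) v))) (jmap-sound (suc (suc k)) d ls _ _ w)
  jmap-sound (suc k) d (lD ∷ ls) c v (s ∷ w) = trans (cong (λ y → ev ls _ y w) (jD k d (λ e → tDn e c s) v)) (jmap-sound k d ls _ _ w)

  -- The remainder of `lD lD` begins with a contraction of two doublings that were opened further
  -- left. The constructor `jt` keeps this contraction pending until labels are put in front. Its
  -- depth is given by an equation so that terms at any index can be matched.
  data Term : ℕ → Set where
    pl : ∀ {d} → Labs d → Term d
    jt : ∀ k d {m} → m ≡ k ℕ.+ suc (suc d) → Labs (k ℕ.+ d) → Term m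

  tv : ∀ {d} → Term d → St → CV d → List Site → ℤ
  tv (pl ls)     c v w = ev ls c v w
  tv (jt k d refl ls) c v w = ev ls c (kf k d v) w

  -- The pending contraction moves left past the new label. When it meets the `lU` that opened the
  -- outer of its two doublings, it is resolved.
  tcons : ∀ {d d′} → Lab d d′ → Term d′ → Bool × Term d
  tcons l   (pl ls)           = true , pl (l ∷ ls)
  tcons lS0 (jt k d refl ls)       = true , jt k d refl (lS0 ∷ ls)
  tcons lS2 (jt k d refl ls)       = true , jt k d refl (lS2 ∷ ls)
  -- Contraction after `lU` is `lD` with the sign of `KU`.
  tcons lU  (jt zero d refl ls)    = not (ep d) , pl (lD ∷ ls)
  tcons lU  (jt (suc k) d refl ls) = true , jt k d refl (lU ∷ ls)
  tcons lD  (jt k d refl ls)       = true , jt (suc k) d refl (lD ∷ ls)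

  one* : ∀ a → + 1 *ᶻ a ≡ a
  one* = ℤₚ.*-identityˡ

  tcons-sound : ∀ {d d′} (l : Lab d d′) (T : Term d′) c v s w →
    sgz (proj₁ (tcons l T)) *ᶻ tv (proj₂ (tcons l T)) c v (s ∷ w) ≡ tv T (nx (kind l) c s) (M l c s v) w
  tcons-sound l (pl ls) c v s w = one* _
  tcons-sound lS0 (jt k d refl ls) c v s w = trans (one* _) (cong (λ y → ev ls (nx sk c s) y w) (sym (kS k d (λ e → tS0 e c s) v)))
  tcons-sound lS2 (jt k d refl ls) c v s w = trans (one* _) (cong (λ y → ev ls (nx sk c s) y w) (sym (kS k d (λ e → tS2 e c s) v)))
  tcons-sound lU (jt zero d refl ls) c v s w = sym (trans (cong (λ y → ev ls (nx uk c s) y w) (Level.KU (LV d) c s v)) (ev-z ls _ _ _ w))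
  tcons-sound lU (jt (suc k) d refl ls) c v s w = trans (one* _) (cong (λ y → ev ls (nx uk c s) y w) (sym (cong₂ _,_ (kS k d (λ e → proj₁ (tUp e c s)) v) (kS k d (λ e → proj₂ (tUp e c s)) v))))
  tcons-sound lD (jt k d refl ls) c v s w = trans (one* _) (cong (λ y → ev ls (nx uk c s) y w) (sym (kD k d (λ e → tDn e c s) v)))

  Terms : ℕ → Set
  Terms d = List (Bool × Term d)

  sumT : ∀ {d} → Terms d → St → CV d → List Site → ℤ
  sumT []             c v w = + 0
  sumT ((b , T) ∷ ts) c v w = sgz b *ᶻ tv T c v w +ᶻ sumT ts c v w

  bmul : Bool → Bool → Bool
  bmul true b = b
  bmul false b = not b

  sgz-bmul : ∀ a b → sgz (bmul a b) ≡ sgz a *ᶻ sgz b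
  sgz-bmul true true = refl
  sgz-bmul true false = refl
  sgz-bmul false true = refl
  sgz-bmul false false = refl

  consT : ∀ {d d′} → Lab d d′ → Terms d′ → Terms d
  consT l []             = []
  consT l ((b , T) ∷ ts) = (bmul b (proj₁ (tcons l T)) , proj₂ (tcons l T)) ∷ consT l ts

  consT-sound : ∀ {d d′} (l : Lab d d′) (ts : Terms d′) c v s w →
    sumT (consT l ts) c v (s ∷ w) ≡ sumT ts (nx (kind l) c s) (M l c s v) w
  consT-sound l [] c v s w = refl
  consT-sound l ((b , T) ∷ ts) c v s w = cong₂ _+ᶻ_
    (trans (cong (_*ᶻ tv (proj₂ (tcons l T)) c v (s ∷ w)) (sgz-bmul b (proj₁ (tcons l T)))) (trans (ℤₚ.*-assoc (sgz b) (sgz (proj₁ (tcons l T))) _) (cong (sgz b *ᶻ_) (tcons-sound l T c v s w))))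
    (consT-sound l ts c v s w)

  -- A removable fourling `lS2 lS0` opens into `lU lD`; these labels move right past `lS0` and left
  -- past `lS2`. Two of them meeting in any order but `lU lD` close to `lS0 lS2`, the body without
  -- that fourling locally.
  pairLow : ∀ {d d₁ d₂} → Lab d d₁ → Lab d₁ d₂ → Labs d₂ → Terms d
  pairLow {d} lS2 lS0 ls = (true , pl (lU ∷ lD ∷ ls)) ∷ []
  pairLow {d} lS2 lU ls  = (ep d , pl (lU ∷ lS2 ∷ ls)) ∷ []
  pairLow lU lS0 ls      = (true , pl (lS0 ∷ lU ∷ ls)) ∷ []
  pairLow lD lS0 ls      = (true , pl (lS0 ∷ lD ∷ ls)) ∷ []
  pairLow lS2 (lD {d}) ls = (not (ep d) , pl (lD ∷ lS2 ∷ ls)) ∷ []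
  pairLow (lD {d}) lU ls  = (ep d , pl (lS0 ∷ lS2 ∷ ls)) ∷ []
  -- The sign of `qUU` times the -1 of `jmap-sound`.
  pairLow {d} lU lU ls    = (not (ep d) , pl (lS0 ∷ lS2 ∷ jmap zero d ls)) ∷ []
  pairLow lD (lD {d}) ls  = (true , jt zero d refl (lS0 ∷ lS2 ∷ ls)) ∷ []
  pairLow _ _ ls          = []

  lows : ∀ {d} → Labs d → Terms d
  lows (P ∷ Q ∷ ls) = pairLow P Q ls ++ consT P (lows (Q ∷ ls))
  lows _            = []

  evFirst evLast : ∀ {d} → Labs d → St → CV d → List Site → ℤ
  evFirst (l ∷ ls) c v (s ∷ w) = ev ls (nx (kind l) c s) (G l c s v) w
  evFirst _        c v _       = + 0
  evLast (l ∷ [])     c v w       = evFirst (l ∷ []) c v w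
  evLast (l ∷ m ∷ ls) c v (s ∷ w) = evLast (m ∷ ls) (nx (kind l) c s) (M l c s v) w
  evLast _            c v _       = + 0

  module PairSound {d d₁ d₂} (P : Lab d d₁) (Q : Lab d₁ d₂) (ls : Labs d₂) where
    private
      kP = kind P
      kQ = kind Q

    c₂ : St → Site → Site → St
    c₂ c s t = nx kQ (nx kP c s) t

    moveSum-ev : ∀ c v w c′ ms → All (λ m → nx kQ (nx kP c (proj₁ (proj₂ m))) (proj₂ (proj₂ m)) ≡ c′) ms →
      moveSum (ev (P ∷ Q ∷ ls) c v) w ms ≡ ev ls c′ (hsum (V d₂) (λ s₂ t₂ → M Q (nx kP c s₂) t₂ (M P c s₂ v)) ms) w
    moveSum-ev c v w c′ [] [] = sym (ev-𝟘 ls c′ w)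
    moveSum-ev c v w c′ ((b , s , t) ∷ ms) (refl ∷ hs) = trans (cong₂ _+ᶻ_ (sym (ev-z ls c′ (sgz b) _ w)) (moveSum-ev c v w c′ ms hs)) (sym (ev-⊕ ls c′ _ _ w))

    Low : (St → Site → Site → CV d → CV d₂) → Set
    Low low = ∀ c v s t w → ev ls (c₂ c s t) (low c s t v) w ≡ sumT (pairLow P Q ls) c v (s ∷ t ∷ w)

    sound : ∀ low → PairEq (V d₂) kP kQ (ep d₂) (M P) (G P) (M Q) (G Q) low → Low low → ∀ c v s t w →
      moveSum (ev (P ∷ Q ∷ ls) c v) w (moves (xr (single t) (xr (single s) (eta (ep d) c))) s t)
        +ᶻ ev ls (c₂ c s t) (G Q (nx kP c s) t (M P c s v)) w
      ≡ ev ls (c₂ c s t) (M Q (nx kP c s) t (G P c s v)) w +ᶻ sumT (pairLow P Q ls) c v (s ∷ t ∷ w)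
    sound low pe lw c v s t w = begin
      moveSum (ev (P ∷ Q ∷ ls) c v) w (moves (xr (single t) (xr (single s) (eta (ep d) c))) s t) +ᶻ rest
        ≡⟨ cong (λ η → moveSum (ev (P ∷ Q ∷ ls) c v) w (moves η s t) +ᶻ rest) (sym η-eq) ⟩
      moveSum (ev (P ∷ Q ∷ ls) c v) w (moves (eta (ep d₂) (c₂ c s t)) s t) +ᶻ rest
        ≡⟨ cong (_+ᶻ rest) (moveSum-ev c v w (c₂ c s t) (moves (eta (ep d₂) (c₂ c s t)) s t) (All.map (λ {m} → par {m}) (moves-par (eta (ep d₂) (c₂ c s t)) s t))) ⟩
      ev ls (c₂ c s t) (hsum (V d₂) _ (moves (eta (ep d₂) (c₂ c s t)) s t)) w +ᶻ rest
        ≡⟨ sym (ev-⊕ ls (c₂ c s t) _ _ w) ⟩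
      _ ≡⟨ cong (λ y → ev ls (c₂ c s t) y w) (pe c s t v) ⟩
      _ ≡⟨ ev-⊕ ls (c₂ c s t) _ _ w ⟩
      _ ≡⟨ cong (ev ls (c₂ c s t) (M Q (nx kP c s) t (G P c s v)) w +ᶻ_) (lw c v s t w) ⟩
      ev ls (c₂ c s t) (M Q (nx kP c s) t (G P c s v)) w +ᶻ sumT (pairLow P Q ls) c v (s ∷ t ∷ w) ∎
      where
      open ≡-Reasoning
      rest = ev ls (c₂ c s t) (G Q (nx kP c s) t (M P c s v)) w
      η-eq : eta (ep d₂) (c₂ c s t) ≡ xr (single t) (xr (single s) (eta (ep d) c))
      η-eq = trans (eta-nx Q (nx kP c s) t) (cong (xr (single t)) (eta-nx P c s))
      par : ∀ {m} → Par s t m → nx kQ (nx kP c (proj₁ (proj₂ m))) (proj₂ (proj₂ m)) ≡ c₂ c s t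
      par {b , s₂ , t₂} h = trans (nx-nx kP kQ c s₂ t₂) (trans (cong (λ y → flb (xr (xr (kb kQ) (kb kP)) y) c) h) (sym (nx-nx kP kQ c s t)))

  pair-sound : ∀ {d d₁ d₂} (P : Lab d d₁) (Q : Lab d₁ d₂) (ls : Labs d₂) c v s t w →
      moveSum (ev (P ∷ Q ∷ ls) c v) w (moves (xr (single t) (xr (single s) (eta (ep d) c))) s t)
        +ᶻ ev ls (nx (kind Q) (nx (kind P) c s) t) (G Q (nx (kind P) c s) t (M P c s v)) w
      ≡ ev ls (nx (kind Q) (nx (kind P) c s) t) (M Q (nx (kind P) c s) t (G P c s v)) w +ᶻ sumT (pairLow P Q ls) c v (s ∷ t ∷ w)
  pair-sound (lS0 {d}) lS0 ls = PairSound.sound lS0 lS0 ls _ (Level.q00 (LV d)) (λ c v s t w → ev-𝟘 ls _ w)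
  pair-sound (lS2 {d}) lS2 ls = PairSound.sound lS2 lS2 ls _ (Level.q22 (LV d)) (λ c v s t w → ev-𝟘 ls _ w)
  pair-sound (lS0 {d}) lS2 ls = PairSound.sound lS0 lS2 ls _ (Level.q02 (LV d)) (λ c v s t w → ev-𝟘 ls _ w)
  pair-sound (lS2 {d}) lS0 ls = PairSound.sound lS2 lS0 ls _ (Level.q20 (LV d)) (λ c v s t w → trans (cong (λ k → ev ls k (M (lD {d}) (nx uk c s) t (M (lU {d}) c s v)) w) (sw c s t)) (sym (trans (ℤₚ.+-identityʳ _) (one* _))))
    where
    sw : ∀ c s t → nx sk (nx sk c s) t ≡ nx uk (nx uk c s) t
    sw c s t = trans (nx-nx sk sk c s t) (sym (nx-nx uk uk c s t))
  pair-sound (lS0 {d}) lU ls = PairSound.sound lS0 lU ls _ (Level.q0U (LV d)) (λ c v s t w → ev-𝟘 ls _ w)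
  pair-sound (lS2 {d}) lU ls = PairSound.sound lS2 lU ls _ (Level.q2U (LV d)) (λ c v s t w → trans (ev-z ls _ (sgz (ep d)) _ w) (trans (cong (λ k → sgz (ep d) *ᶻ ev ls k (M (lS2 {suc d}) (nx uk c s) t (M (lU {d}) c s v)) w) (sw c s t)) (sym (ℤₚ.+-identityʳ _))))
    where
    sw : ∀ c s t → nx uk (nx sk c s) t ≡ nx sk (nx uk c s) t
    sw c s t = trans (nx-nx sk uk c s t) (sym (nx-nx uk sk c s t))
  pair-sound (lU {d}) lS0 ls = PairSound.sound lU lS0 ls _ (Level.qU0 (LV d)) (λ c v s t w → trans (cong (λ k → ev ls k (M (lU {d}) (nx sk c s) t (M (lS0 {d}) c s v)) w) (sw c s t)) (sym (trans (ℤₚ.+-identityʳ _) (one* _))))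
    where
    sw : ∀ c s t → nx sk (nx uk c s) t ≡ nx uk (nx sk c s) t
    sw c s t = trans (nx-nx uk sk c s t) (sym (nx-nx sk uk c s t))
  pair-sound (lU {d}) lS2 ls = PairSound.sound lU lS2 ls _ (Level.qU2 (LV d)) (λ c v s t w → ev-𝟘 ls _ w)
  pair-sound (lU {d}) lD ls = PairSound.sound lU lD ls _ (Level.qUD (LV d)) (λ c v s t w → ev-𝟘 ls _ w)
  pair-sound (lD {d}) lS0 ls = PairSound.sound lD lS0 ls _ (Level.qD0 (LV d)) (λ c v s t w → trans (cong (λ k → ev ls k (M (lD {d}) (nx sk c s) t (M (lS0 {suc d}) c s v)) w) (sw c s t)) (sym (trans (ℤₚ.+-identityʳ _) (one* _))))
    where
    sw : ∀ c s t → nx sk (nx uk c s) t ≡ nx uk (nx sk c s) t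
    sw c s t = trans (nx-nx uk sk c s t) (sym (nx-nx sk uk c s t))
  pair-sound (lD {d}) lS2 ls = PairSound.sound lD lS2 ls _ (Level.qD2 (LV d)) (λ c v s t w → ev-𝟘 ls _ w)
  pair-sound lS0 (lD {d}) ls = PairSound.sound lS0 lD ls _ (Level.q0D (LV d)) (λ c v s t w → ev-𝟘 ls _ w)
  pair-sound lS2 (lD {d}) ls = PairSound.sound lS2 lD ls _ (Level.q2D (LV d)) (λ c v s t w → trans (ev-z ls _ (sgz (not (ep d))) _ w) (trans (cong (λ k → sgz (not (ep d)) *ᶻ ev ls k (M (lS2 {d}) (nx uk c s) t (M (lD {d}) c s v)) w) (sw c s t)) (sym (ℤₚ.+-identityʳ _))))
    where
    sw : ∀ c s t → nx uk (nx sk c s) t ≡ nx sk (nx uk c s) t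
    sw c s t = trans (nx-nx sk uk c s t) (sym (nx-nx uk sk c s t))
  pair-sound (lD {d}) lU ls = PairSound.sound lD lU ls _ (Level.qDU (LV d)) (λ c v s t w → trans (ev-z ls _ (sgz (ep d)) _ w) (trans (cong (λ k → sgz (ep d) *ᶻ ev ls k (M (lS2 {suc d}) (nx sk c s) t (M (lS0 {suc d}) c s v)) w) (sw c s t)) (sym (ℤₚ.+-identityʳ _))))
    where
    sw : ∀ c s t → nx uk (nx uk c s) t ≡ nx sk (nx sk c s) t
    sw c s t = trans (nx-nx uk uk c s t) (sym (nx-nx sk sk c s t))
  pair-sound (lU {d}) lU ls = PairSound.sound lU lU ls (λ c s t v → Raw.zs (V (suc (suc d))) (sgz (ep d)) (jf 0 d (M (lS2 {d}) (nx sk c s) t (M (lS0 {d}) c s v))))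
    -- The table gives the relation with sign `ep d`, while depth d + 2 carries the sign
    -- `not (not (ep d))`.
    (subst (λ e → PairEq (V (suc (suc d))) uk uk e (M (lU {d})) (G (lU {d})) (M (lU {suc d})) (G (lU {suc d})) (λ c s t v → Raw.zs (V (suc (suc d))) (sgz (ep d)) (jf 0 d (M (lS2 {d}) (nx sk c s) t (M (lS0 {d}) c s v))))) (sym (not-involutive (ep d))) (Level.qUU (LV d)))
    (λ c v s t w → trans (ev-z ls _ (sgz (ep d)) _ w) (trans (cong (sgz (ep d) *ᶻ_) (jmap-sound 0 d ls _ _ w))
      (trans (cong (λ k → sgz (ep d) *ᶻ (-[1+ 0 ] *ᶻ ev (jmap 0 d ls) k (M (lS2 {d}) (nx sk c s) t (M (lS0 {d}) c s v)) w)) (sw c s t))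
        (trans (sym (ℤₚ.*-assoc (sgz (ep d)) -[1+ 0 ] _)) (trans (cong (_*ᶻ ev (jmap 0 d ls) (nx sk (nx sk c s) t) (M (lS2 {d}) (nx sk c s) t (M (lS0 {d}) c s v)) w) (sn (ep d))) (sym (ℤₚ.+-identityʳ _)))))))
    where
    sw : ∀ c s t → nx uk (nx uk c s) t ≡ nx sk (nx sk c s) t
    sw c s t = trans (nx-nx uk uk c s t) (sym (nx-nx sk sk c s t))
    sn : ∀ b → sgz b *ᶻ -[1+ 0 ] ≡ sgz (not b)
    sn true = refl
    sn false = refl
  pair-sound lD (lD {d}) ls = PairSound.sound lD lD ls _ (Level.qDD (LV d)) (λ c v s t w → trans (cong (λ k → ev ls k (M (lS2 {d}) (nx sk c s) t (M (lS0 {d}) c s (kf 0 d v))) w) (sw c s t)) (sym (trans (ℤₚ.+-identityʳ _) (one* _))))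
    where
    sw : ∀ c s t → nx uk (nx uk c s) t ≡ nx sk (nx sk c s) t
    sw c s t = trans (nx-nx uk uk c s t) (sym (nx-nx sk sk c s t))

  sumT-++ : ∀ {d} (ts us : Terms d) c v w → sumT (ts ++ us) c v w ≡ sumT ts c v w +ᶻ sumT us c v w
  sumT-++ [] us c v w = sym (ℤₚ.+-identityˡ _)
  sumT-++ ((b , T) ∷ ts) us c v w = trans (cong (sgz b *ᶻ tv T c v w +ᶻ_) (sumT-++ ts us c v w)) (sym (ℤₚ.+-assoc (sgz b *ᶻ tv T c v w) _ _))

  -- Consecutive pairs share a label, and its boundary term occurs with opposite signs in their two
  -- relations. Only the boundary terms of the first and the last label survive.
  dominoSum-ev : ∀ {d} (ls : Labs d) c v w → length w ≡ len ls →
    dominoSum (eta (ep d) c) (ev ls c v) w +ᶻ evLast ls c v w ≡ evFirst ls c v w +ᶻ sumT (lows ls) c v w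
  dominoSum-ev [] c v [] h = refl
  dominoSum-ev (P ∷ []) c v (s ∷ []) h = trans (ℤₚ.+-identityˡ (evFirst (P ∷ []) c v (s ∷ []))) (sym (ℤₚ.+-identityʳ (evFirst (P ∷ []) c v (s ∷ []))))
  dominoSum-ev {d} (_∷_ {d′ = d₁} P (_∷_ {d′ = d₂} Q ls)) c v (s ∷ t ∷ w) h = begin
      (a +ᶻ dominoSum (xr (single s) (eta (ep d) c)) (ev (Q ∷ ls) c₁ v₁) (t ∷ w)) +ᶻ l
        ≡⟨ cong (λ τ → (a +ᶻ dominoSum τ (ev (Q ∷ ls) c₁ v₁) (t ∷ w)) +ᶻ l) (sym (eta-nx P c s)) ⟩
      (a +ᶻ b) +ᶻ l ≡⟨ ℤₚ.+-assoc a b l ⟩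
      a +ᶻ (b +ᶻ l) ≡⟨ cong (a +ᶻ_) (dominoSum-ev (Q ∷ ls) c₁ v₁ (t ∷ w) (cong ℕ.pred h)) ⟩
      a +ᶻ (f +ᶻ r) ≡⟨ sym (ℤₚ.+-assoc a f r) ⟩
      (a +ᶻ f) +ᶻ r ≡⟨ cong (_+ᶻ r) (pair-sound P Q ls c v s t w) ⟩
      (g +ᶻ p) +ᶻ r ≡⟨ ℤₚ.+-assoc g p r ⟩
      g +ᶻ (p +ᶻ r) ≡⟨ cong (λ y → g +ᶻ (p +ᶻ y)) (sym (consT-sound P (lows (Q ∷ ls)) c v s (t ∷ w))) ⟩
      g +ᶻ (p +ᶻ sumT (consT P (lows (Q ∷ ls))) c v (s ∷ t ∷ w)) ≡⟨ cong (g +ᶻ_) (sym (sumT-++ (pairLow P Q ls) (consT P (lows (Q ∷ ls))) c v (s ∷ t ∷ w))) ⟩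
      g +ᶻ sumT (lows (P ∷ Q ∷ ls)) c v (s ∷ t ∷ w) ∎
    where
    open ≡-Reasoning
    c₁ = nx (kind P) c s
    v₁ = M P c s v
    a = moveSum (ev (P ∷ Q ∷ ls) c v) w (moves (xr (single t) (xr (single s) (eta (ep d) c))) s t)
    b = dominoSum (eta (ep d₁) c₁) (ev (Q ∷ ls) c₁ v₁) (t ∷ w)
    l = evLast (Q ∷ ls) c₁ v₁ (t ∷ w)
    f = evFirst (Q ∷ ls) c₁ v₁ (t ∷ w)
    r = sumT (lows (Q ∷ ls)) c₁ v₁ (t ∷ w)
    g = evFirst (P ∷ Q ∷ ls) c v (s ∷ t ∷ w)
    p = sumT (pairLow P Q ls) c v (s ∷ t ∷ w)

-- Boundary terms at the ends of a word, and functionals containing `lU`.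

module DominoStep (q x : ℤ) where

  open TermAlgebra
  open Tables
  open Semantics q x
  open Doubling q x
  open Labels q x

  -- At a site 00 outside a row pair the boundary entry is x times the matrix entry for `lS0`; for
  -- `lS2` and `lU` both are 0.
  evFirst-first : ∀ (ls : Labs 0) v w → evFirst ls o v (s0 ∷ w) ≡ x *ᶻ ev ls o v (s0 ∷ w)
  evFirst-first []         v w = sym (ℤₚ.*-zeroʳ x)
  evFirst-first (lS0 ∷ ls) v w = ev-z ls o x v w
  evFirst-first (lS2 ∷ ls) v w = trans (ev-𝟘 ls o w) (sym (trans (cong (x *ᶻ_) (ev-𝟘 ls o w)) (ℤₚ.*-zeroʳ x)))
  evFirst-first (lU ∷ ls)  v w = trans (ev-𝟘 ls i w) (sym (trans (cong (x *ᶻ_) (ev-𝟘 ls i w)) (ℤₚ.*-zeroʳ x)))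

  -- At a final site 11 only `lS2` outside a row pair contributes, and its boundary entry is -q
  -- times its matrix entry. In the other cases the matrix entry is 0 or the word ends inside a row
  -- pair, and the boundary entry is 0.
  evLast-last : ∀ {d} (ls : Labs d) c v w → length (w ++ st ∷ []) ≡ len ls → evLast ls c v (w ++ st ∷ []) ≡ (-ᶻ q) *ᶻ ev ls c v (w ++ st ∷ [])
  evLast-last (lS0 ∷ []) o v [] h = sym (ℤₚ.*-zeroʳ (-ᶻ q))
  evLast-last (lS0 ∷ []) i v [] h = sym (ℤₚ.*-zeroʳ (-ᶻ q))
  evLast-last (lS2 ∷ []) o v [] h = e q v
    where
    e : ∀ a b → -[1+ 0 ] *ᶻ (a *ᶻ b) ≡ (-ᶻ a) *ᶻ b
    e = solve-∀
  evLast-last (lS2 ∷ []) i v [] h = sym (ℤₚ.*-zeroʳ (-ᶻ q))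
  evLast-last (lD ∷ []) o v [] h = sym (ℤₚ.*-zeroʳ (-ᶻ q))
  evLast-last (lD ∷ []) i v [] h = sym (ℤₚ.*-zeroʳ (-ᶻ q))
  evLast-last (l ∷ m ∷ ls) c v (s ∷ w) h = evLast-last (m ∷ ls) _ _ w (cong ℕ.pred h)
  evLast-last (l ∷ []) c v (s ∷ []) ()
  evLast-last (l ∷ []) c v (s ∷ t ∷ w) ()

  dominoSum-step : ∀ (ls : Labs 0) v w → length (s0 ∷ w ++ st ∷ []) ≡ len ls →
    dominoSum true (ev ls o v) (s0 ∷ w ++ st ∷ []) ≡ (q +ᶻ x) *ᶻ ev ls o v (s0 ∷ w ++ st ∷ []) +ᶻ sumT (lows ls) o v (s0 ∷ w ++ st ∷ [])
  dominoSum-step ls v w h = fin′ (dominoSum true (ev ls o v) W) (ev ls o v W) (sumT (lows ls) o v W) q x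
    (trans (cong (dominoSum true (ev ls o v) W +ᶻ_) (sym (evLast-last ls o v (s0 ∷ w) h)))
      (trans (dominoSum-ev ls o v W h) (cong (_+ᶻ sumT (lows ls) o v W) (evFirst-first ls v (w ++ st ∷ [])))))
    where
    W = s0 ∷ w ++ st ∷ []
    e : ∀ u a q → u ≡ (u +ᶻ (-ᶻ q) *ᶻ a) +ᶻ q *ᶻ a
    e = solve-∀
    e′ : ∀ a s q x → (x *ᶻ a +ᶻ s) +ᶻ q *ᶻ a ≡ (q +ᶻ x) *ᶻ a +ᶻ s
    e′ = solve-∀
    fin′ : ∀ u a s q x → u +ᶻ (-ᶻ q) *ᶻ a ≡ x *ᶻ a +ᶻ s → u ≡ (q +ᶻ x) *ᶻ a +ᶻ s
    fin′ u a s q x h = trans (e u a q) (trans (cong (_+ᶻ q *ᶻ a) h) (e′ a s q x))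

  -- At depth 0: some label lU occurs.
  Nontrivial : ∀ {d} → Labs d → Set
  Nontrivial {suc d} _          = ⊤
  Nontrivial {zero} []          = ⊥
  Nontrivial {zero} (lS0 ∷ ls)  = Nontrivial ls
  Nontrivial {zero} (lS2 ∷ ls)  = Nontrivial ls
  Nontrivial {zero} (lU ∷ ls)   = ⊤

  NontrivialTerm : ∀ {d} → Term d → Set
  NontrivialTerm (pl ls)         = Nontrivial ls
  NontrivialTerm (jt k d eq ls)  = ⊤

  ∷-nontrivial : ∀ {d d′} (l : Lab d d′) (ls : Labs d′) → Nontrivial ls → Nontrivial (l ∷ ls)
  ∷-nontrivial {zero} lS0 ls h = h
  ∷-nontrivial {zero} lS2 ls h = h
  ∷-nontrivial {zero} lU ls h = tt
  ∷-nontrivial {suc d} l ls h = tt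

  tcons-nontrivial : ∀ {d d′} (l : Lab d d′) (T : Term d′) → NontrivialTerm T → NontrivialTerm (proj₂ (tcons l T))
  tcons-nontrivial l (pl ls) h = ∷-nontrivial l ls h
  tcons-nontrivial lS0 (jt k d refl ls) h = tt
  tcons-nontrivial lS2 (jt k d refl ls) h = tt
  tcons-nontrivial lU (jt zero d refl ls) h = tt
  tcons-nontrivial lU (jt (suc k) d refl ls) h = tt
  tcons-nontrivial lD (jt k d refl ls) h = tt

  -- A list starting at depth 2 has to change its depth, and `jmap` makes its first depth-changing
  -- label an `lU`.
  jmap-nontrivial : (ls : Labs 2) → Nontrivial (jmap 0 0 ls)
  jmap-nontrivial (lS0 ∷ ls) = jmap-nontrivial ls
  jmap-nontrivial (lS2 ∷ ls) = jmap-nontrivial ls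
  jmap-nontrivial (lU ∷ ls)  = tt
  jmap-nontrivial (lD ∷ ls)  = tt

  NontrivialTerms : ∀ {d} → Terms d → Set
  NontrivialTerms = All (λ m → NontrivialTerm (proj₂ m))

  -- At depth 0 the remainder shows an `lU` itself, or contains one by `jmap-nontrivial`; at
  -- positive depth an `lU` stands somewhere to the left.
  pairLow-nontrivial : ∀ {d d₁ d₂} (P : Lab d d₁) (Q : Lab d₁ d₂) (ls : Labs d₂) → NontrivialTerms (pairLow P Q ls)
  pairLow-nontrivial {zero} lS0 lS0 ls = []
  pairLow-nontrivial {zero} lS0 lS2 ls = []
  pairLow-nontrivial {zero} lS0 lU ls = []
  pairLow-nontrivial {zero} lS2 lS0 ls = tt ∷ []
  pairLow-nontrivial {zero} lS2 lS2 ls = []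
  pairLow-nontrivial {zero} lS2 lU ls = tt ∷ []
  pairLow-nontrivial {zero} lU lS0 ls = tt ∷ []
  pairLow-nontrivial {zero} lU lS2 ls = []
  pairLow-nontrivial {zero} lU lU ls = jmap-nontrivial ls ∷ []
  pairLow-nontrivial {zero} lU lD ls = []
  pairLow-nontrivial {suc d} lS0 lS0 ls = []
  pairLow-nontrivial {suc d} lS0 lS2 ls = []
  pairLow-nontrivial {suc d} lS0 lU ls = []
  pairLow-nontrivial {suc d} lS0 lD ls = []
  pairLow-nontrivial {suc d} lS2 lS0 ls = tt ∷ []
  pairLow-nontrivial {suc d} lS2 lS2 ls = []
  pairLow-nontrivial {suc d} lS2 lU ls = tt ∷ []
  pairLow-nontrivial {suc d} lS2 lD ls = tt ∷ []
  pairLow-nontrivial {suc d} lU lS0 ls = tt ∷ []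
  pairLow-nontrivial {suc d} lU lS2 ls = []
  pairLow-nontrivial {suc d} lU lU ls = tt ∷ []
  pairLow-nontrivial {suc d} lU lD ls = []
  pairLow-nontrivial {suc d} lD lS0 ls = tt ∷ []
  pairLow-nontrivial {suc d} lD lS2 ls = []
  pairLow-nontrivial {suc d} lD lU ls = tt ∷ []
  pairLow-nontrivial {suc d} lD lD ls = tt ∷ []

  consT-nontrivial : ∀ {d d′} (l : Lab d d′) (ts : Terms d′) → NontrivialTerms ts → NontrivialTerms (consT l ts)
  consT-nontrivial l [] [] = []
  consT-nontrivial l ((b , T) ∷ ts) (h ∷ hs) = tcons-nontrivial l T h ∷ consT-nontrivial l ts hs

  lows-nontrivial : ∀ {d} (ls : Labs d) → NontrivialTerms (lows ls)
  lows-nontrivial []           = []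
  lows-nontrivial (P ∷ [])     = []
  lows-nontrivial (P ∷ Q ∷ ls) = ++⁺ (pairLow-nontrivial P Q ls) (consT-nontrivial P (lows (Q ∷ ls)) (lows-nontrivial (Q ∷ ls)))

  lenT : ∀ {d} → Term d → ℕ
  lenT (pl ls)        = len ls
  lenT (jt k d eq ls) = len ls

  len-jmap : ∀ k d ls → len (jmap k d ls) ≡ len ls
  len-jmap zero d (lS0 ∷ ls)    = cong suc (len-jmap zero d ls)
  len-jmap zero d (lS2 ∷ ls)    = cong suc (len-jmap zero d ls)
  len-jmap zero d (lU ∷ ls)     = cong suc (len-jmap 1 d ls)
  len-jmap zero d (lD ∷ ls)     = refl
  len-jmap (suc k) d (lS0 ∷ ls) = cong suc (len-jmap (suc k) d ls)
  len-jmap (suc k) d (lS2 ∷ ls) = cong suc (len-jmap (suc k) d ls)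
  len-jmap (suc k) d (lU ∷ ls)  = cong suc (len-jmap (suc (suc k)) d ls)
  len-jmap (suc k) d (lD ∷ ls)  = cong suc (len-jmap k d ls)

  len-tcons : ∀ {d d′} (l : Lab d d′) T → lenT (proj₂ (tcons l T)) ≡ suc (lenT T)
  len-tcons l (pl ls) = refl
  len-tcons lS0 (jt k d refl ls) = refl
  len-tcons lS2 (jt k d refl ls) = refl
  len-tcons lU (jt zero d refl ls) = refl
  len-tcons lU (jt (suc k) d refl ls) = refl
  len-tcons lD (jt k d refl ls) = refl

  Lens : ∀ {d} → ℕ → Terms d → Set
  Lens n = All (λ m → lenT (proj₂ m) ≡ n)

  len-pair : ∀ {d d₁ d₂} (P : Lab d d₁) (Q : Lab d₁ d₂) (ls : Labs d₂) → Lens (suc (suc (len ls))) (pairLow P Q ls)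
  len-pair lS0 lS0 ls = []
  len-pair lS0 lS2 ls = []
  len-pair lS0 lU ls = []
  len-pair lS0 lD ls = []
  len-pair lS2 lS0 ls = refl ∷ []
  len-pair lS2 lS2 ls = []
  len-pair lS2 lU ls = refl ∷ []
  len-pair lS2 lD ls = refl ∷ []
  len-pair lU lS0 ls = refl ∷ []
  len-pair lU lS2 ls = []
  len-pair (lU {d}) lU ls = cong (λ n → suc (suc n)) (len-jmap 0 d ls) ∷ []
  len-pair lU lD ls = []
  len-pair lD lS0 ls = refl ∷ []
  len-pair lD lS2 ls = []
  len-pair lD lU ls = refl ∷ []
  len-pair lD lD ls = refl ∷ []

  len-consT : ∀ {d d′} n (l : Lab d d′) (ts : Terms d′) → Lens n ts → Lens (suc n) (consT l ts)
  len-consT n l [] [] = []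
  len-consT n l ((b , T) ∷ ts) (h ∷ hs) = trans (len-tcons l T) (cong suc h) ∷ len-consT n l ts hs

  len-lows : ∀ {d} (ls : Labs d) → Lens (len ls) (lows ls)
  len-lows []           = []
  len-lows (P ∷ [])     = []
  len-lows (P ∷ Q ∷ ls) = ++⁺ (len-pair P Q ls) (len-consT _ P (lows (Q ∷ ls)) (len-lows (Q ∷ ls)))

  -- Inside a row pair `lS2` is the only label with a nonzero entry at 11, and it keeps the state;
  -- the word therefore ends inside a pair.
  iT : ∀ {d} (ls : Labs d) v n → ev ls i v (replicate n st) ≡ + 0
  iT [] v zero    = refl
  iT [] v (suc n) = refl
  iT (l ∷ ls) v zero = refl
  iT (lS0 ∷ ls) v (suc n) = ev-𝟘 ls i (replicate n st)
  iT (lS2 ∷ ls) v (suc n) = iT ls _ n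
  iT (lU ∷ ls) v (suc n)  = ev-𝟘 ls o (replicate n st)
  iT (lD ∷ ls) v (suc n)  = ev-𝟘 ls o (replicate n st)

  -- From positive depth a depth-changing label must follow, and at a site 11 it leads inside a row
  -- pair, from where `iT` applies.
  oT : ∀ {d} (ls : Labs (suc d)) v n → ev ls o v (replicate n st) ≡ + 0
  oT (l ∷ ls) v zero = refl
  oT (lS0 ∷ ls) v (suc n) = ev-𝟘 ls o (replicate n st)
  oT (lS2 ∷ ls) v (suc n) = oT ls _ n
  oT (lU ∷ ls) v (suc n)  = iT ls _ n
  oT (lD ∷ ls) v (suc n)  = iT ls _ n

  nontrivial-st : (ls : Labs 0) → Nontrivial ls → ∀ v n → ev ls o v (replicate n st) ≡ + 0
  nontrivial-st (l ∷ ls) h v zero = refl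
  nontrivial-st (lS0 ∷ ls) h v (suc n) = ev-𝟘 ls o (replicate n st)
  nontrivial-st (lS2 ∷ ls) h v (suc n) = nontrivial-st ls h _ n
  nontrivial-st (lU ∷ ls) h v (suc n)  = iT ls _ n

  -- The word of the single cell in an even box has 10 straddling two sites, which gives the two
  -- sites 01 in front of the sites 11.
  nontrivial-sd : (ls : Labs 0) → Nontrivial ls → ∀ v n → ev ls o v (sd ∷ sd ∷ replicate n st) ≡ + 0
  nontrivial-sd (lS0 ∷ lS0 ∷ ls) h v n = ev-𝟘 ls _ (replicate n st)
  nontrivial-sd (lS0 ∷ lS2 ∷ ls) h v n = nontrivial-st ls h _ n
  nontrivial-sd (lS0 ∷ lU ∷ ls) h v n = iT ls _ n
  nontrivial-sd (lS0 ∷ []) () v n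
  nontrivial-sd (lS2 ∷ ls) h v n = ev-𝟘 ls i (sd ∷ replicate n st)
  nontrivial-sd (lU ∷ lS0 ∷ ls) h v n = iT ls _ n
  nontrivial-sd (lU ∷ lS2 ∷ ls) h v n = ev-𝟘 ls i (replicate n st)
  nontrivial-sd (lU ∷ lU ∷ ls) h v n = oT ls _ n
  nontrivial-sd (lU ∷ lD ∷ ls) h v n = ev-𝟘 ls o (replicate n st)

  nontrivial-s0 : (w : List Site) → ((ls : Labs 0) → Nontrivial ls → ∀ v → ev ls o v w ≡ + 0) →
    ∀ k (ls : Labs 0) → Nontrivial ls → ∀ v → ev ls o v (replicate k s0 ++ w) ≡ + 0
  nontrivial-s0 w H zero ls h v = H ls h v
  nontrivial-s0 w H (suc k) (lS0 ∷ ls) h v = nontrivial-s0 w H k ls h v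
  nontrivial-s0 w H (suc k) (lS2 ∷ ls) h v = ev-𝟘 ls o (replicate k s0 ++ w)
  nontrivial-s0 w H (suc k) (lU ∷ ls) h v = ev-𝟘 ls i (replicate k s0 ++ w)

-- Boundary words, signed addition of cells, and its square.

module BitWords where

  open TermAlgebra using (sgz)
  open Tables

  -- true is a row, false a column; the length of a row is the number of letters false after it.
  Bits : Set
  Bits = List Bool

  zeros ones cells : Bits → ℕ
  zeros []          = 0
  zeros (true ∷ w)  = zeros w
  zeros (false ∷ w) = suc (zeros w)
  ones []          = 0
  ones (true ∷ w)  = suc (ones w)
  ones (false ∷ w) = ones w
  cells []          = 0
  cells (true ∷ w)  = zeros w + cells w
  cells (false ∷ w) = cells w

  -- The suffix `t` contains the rows below the new cell. A largest entry placed there precedes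
  -- exactly `cells t` smaller entries of the reading word.
  cellHop : (Bits → ℤ) → Bits → ℤ
  cellHop f (true ∷ t) = signOf (cells t) *ᶻ f (true ∷ false ∷ t)
  cellHop f _          = + 0

  addCell : (Bits → ℤ) → Bits → ℤ
  addCell f []          = + 0
  addCell f (true ∷ t)  = addCell (λ u → f (true ∷ u)) t
  addCell f (false ∷ t) = cellHop f t +ᶻ addCell (λ u → f (false ∷ u)) t

  -- The two cells of a horizontal domino carry equal signs; in a vertical one the signs differ by
  -- the parity of the old length `zeros t` of the lower row.
  dominoHop : (Bits → ℤ) → Bits → ℤ
  dominoHop f (false ∷ true ∷ t) = f (true ∷ false ∷ false ∷ t)
  dominoHop f (true ∷ true ∷ t)  = signOf (zeros t) *ᶻ f (true ∷ true ∷ false ∷ t)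
  dominoHop f _                  = + 0

  addDomino : (Bits → ℤ) → Bits → ℤ
  addDomino f []          = + 0
  addDomino f (true ∷ t)  = addDomino (λ u → f (true ∷ u)) t
  addDomino f (false ∷ t) = dominoHop f t +ᶻ addDomino (λ u → f (false ∷ u)) t

  addCell-congP : ∀ f g w → (∀ pre t → w ≡ pre ++ false ∷ true ∷ t → f (pre ++ true ∷ false ∷ t) ≡ g (pre ++ true ∷ false ∷ t)) → addCell f w ≡ addCell g w
  addCell-congP f g [] h = refl
  addCell-congP f g (true ∷ w) h = addCell-congP _ _ w (λ pre t e → h (true ∷ pre) t (cong (true ∷_) e))
  addCell-congP f g (false ∷ w) h = cong₂ _+ᶻ_ (hh w h) (addCell-congP _ _ w (λ pre t e → h (false ∷ pre) t (cong (false ∷_) e)))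
    where
    hh : ∀ w → (∀ pre t → false ∷ w ≡ pre ++ false ∷ true ∷ t → f (pre ++ true ∷ false ∷ t) ≡ g (pre ++ true ∷ false ∷ t)) → cellHop f w ≡ cellHop g w
    hh [] h = refl
    hh (false ∷ w) h = refl
    hh (true ∷ w) h = cong (signOf (cells w) *ᶻ_) (h [] w refl)

  addCell-cong : ∀ f g → (∀ w → f w ≡ g w) → ∀ w → addCell f w ≡ addCell g w
  addCell-cong f g h w = addCell-congP f g w (λ _ _ _ → h _)

  addCell-+ : ∀ f g w → addCell (λ u → f u +ᶻ g u) w ≡ addCell f w +ᶻ addCell g w
  addCell-+ f g [] = refl
  addCell-+ f g (true ∷ w) = addCell-+ _ _ w
  addCell-+ f g (false ∷ w) = trans (cong₂ _+ᶻ_ (hh w) (addCell-+ (f ∘ (false ∷_)) (g ∘ (false ∷_)) w)) (r (cellHop f w) (cellHop g w) (addCell (f ∘ (false ∷_)) w) (addCell (g ∘ (false ∷_)) w))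
    where
    r : ∀ a b c d → (a +ᶻ b) +ᶻ (c +ᶻ d) ≡ (a +ᶻ c) +ᶻ (b +ᶻ d)
    r = solve-∀
    hh : ∀ w → cellHop (λ u → f u +ᶻ g u) w ≡ cellHop f w +ᶻ cellHop g w
    hh [] = refl
    hh (false ∷ w) = refl
    hh (true ∷ w) = ℤₚ.*-distribˡ-+ (signOf (cells w)) _ _

  addCell-* : ∀ a f w → addCell (λ u → a *ᶻ f u) w ≡ a *ᶻ addCell f w
  addCell-* a f [] = sym (ℤₚ.*-zeroʳ a)
  addCell-* a f (true ∷ w) = addCell-* a _ w
  addCell-* a f (false ∷ w) = trans (cong₂ _+ᶻ_ (hh w) (addCell-* a (f ∘ (false ∷_)) w)) (sym (ℤₚ.*-distribˡ-+ a (cellHop f w) _))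
    where
    r : ∀ s a b → s *ᶻ (a *ᶻ b) ≡ a *ᶻ (s *ᶻ b)
    r = solve-∀
    hh : ∀ w → cellHop (λ u → a *ᶻ f u) w ≡ a *ᶻ cellHop f w
    hh [] = sym (ℤₚ.*-zeroʳ a)
    hh (false ∷ w) = sym (ℤₚ.*-zeroʳ a)
    hh (true ∷ w) = r (signOf (cells w)) a _

  addCell-0 : ∀ f → (∀ w → f w ≡ + 0) → ∀ w → addCell f w ≡ + 0
  addCell-0 f h w = trans (addCell-cong f (λ u → + 0 *ᶻ f u) (λ u → trans (h u) (sym (ℤₚ.*-zeroˡ (f u)))) w) (trans (addCell-* (+ 0) f w) (ℤₚ.*-zeroˡ (addCell f w)))

  addCell-φ : ∀ (φ h : Bits → ℤ) → (∀ pre t → φ (pre ++ true ∷ false ∷ t) ≡ -ᶻ φ (pre ++ false ∷ true ∷ t)) →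
    ∀ w → addCell (λ u → φ u *ᶻ h u) w ≡ -ᶻ (φ w *ᶻ addCell h w)
  addCell-φ φ h e [] = sym (cong -ᶻ_ (ℤₚ.*-zeroʳ (φ [])))
  addCell-φ φ h e (true ∷ w) = addCell-φ (φ ∘ (true ∷_)) (h ∘ (true ∷_)) (λ pre t → e (true ∷ pre) t) w
  addCell-φ φ h e (false ∷ w) = trans (cong₂ _+ᶻ_ (hh w) (addCell-φ (φ ∘ (false ∷_)) (h ∘ (false ∷_)) (λ pre t → e (false ∷ pre) t) w)) (r (φ (false ∷ w)) (cellHop h w) (addCell (h ∘ (false ∷_)) w))
    where
    r : ∀ a b c → (-ᶻ (a *ᶻ b)) +ᶻ (-ᶻ (a *ᶻ c)) ≡ -ᶻ (a *ᶻ (b +ᶻ c))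
    r = solve-∀
    r′ : ∀ s a b → s *ᶻ ((-ᶻ a) *ᶻ b) ≡ -ᶻ (a *ᶻ (s *ᶻ b))
    r′ = solve-∀
    hh : ∀ w → cellHop (λ u → φ u *ᶻ h u) w ≡ -ᶻ (φ (false ∷ w) *ᶻ cellHop h w)
    hh [] = sym (cong -ᶻ_ (ℤₚ.*-zeroʳ (φ (false ∷ []))))
    hh (false ∷ w) = sym (cong -ᶻ_ (ℤₚ.*-zeroʳ (φ (false ∷ false ∷ w))))
    hh (true ∷ w) = trans (cong (λ y → signOf (cells w) *ᶻ (y *ᶻ h (true ∷ false ∷ w))) (e [] w)) (r′ (signOf (cells w)) (φ (false ∷ true ∷ w)) (h (true ∷ false ∷ w)))

  signOf-suc : ∀ n → signOf (suc n) ≡ -ᶻ signOf n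
  signOf-suc zero          = refl
  signOf-suc (suc zero)    = refl
  signOf-suc (suc (suc n)) = signOf-suc n

  signOf-+ : ∀ m n → signOf (m + n) ≡ signOf m *ᶻ signOf n
  signOf-+ zero n = sym (ℤₚ.*-identityˡ _)
  signOf-+ (suc m) n = trans (signOf-suc (m + n)) (trans (cong -ᶻ_ (signOf-+ m n)) (trans (ℤₚ.neg-distribˡ-* (signOf m) (signOf n)) (cong (_*ᶻ signOf n) (sym (signOf-suc m)))))

  signOf² : ∀ n → signOf n *ᶻ signOf n ≡ + 1
  signOf² zero          = refl
  signOf² (suc zero)    = refl
  signOf² (suc (suc n)) = signOf² n

  zeros-hop : ∀ pre t → zeros (pre ++ true ∷ false ∷ t) ≡ zeros (pre ++ false ∷ true ∷ t)
  zeros-hop [] t = refl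
  zeros-hop (true ∷ pre) t = zeros-hop pre t
  zeros-hop (false ∷ pre) t = cong suc (zeros-hop pre t)

  ones-hop : ∀ pre t → ones (pre ++ true ∷ false ∷ t) ≡ ones (pre ++ false ∷ true ∷ t)
  ones-hop [] t = refl
  ones-hop (true ∷ pre) t = cong suc (ones-hop pre t)
  ones-hop (false ∷ pre) t = ones-hop pre t

  cells-hop : ∀ pre t → cells (pre ++ true ∷ false ∷ t) ≡ suc (cells (pre ++ false ∷ true ∷ t))
  cells-hop [] t = refl
  cells-hop (true ∷ pre) t = trans (cong₂ _+_ (zeros-hop pre t) (cells-hop pre t)) (ℕₚ.+-suc _ _)
  cells-hop (false ∷ pre) t = cells-hop pre t

  addCell-sgn : ∀ h w → addCell (λ u → signOf (cells u) *ᶻ h u) w ≡ -ᶻ (signOf (cells w) *ᶻ addCell h w)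
  addCell-sgn h w = addCell-φ (λ u → signOf (cells u)) h (λ pre t → trans (cong signOf (cells-hop pre t)) (signOf-suc (cells (pre ++ false ∷ true ∷ t)))) w

  -- Two cells that do not form a domino can be added in both orders, with opposite signs.
  addCell² : ∀ f w → addCell (addCell f) w ≡ addDomino f w
  addCell² f [] = refl
  addCell² f (true ∷ w) = addCell² (f ∘ (true ∷_)) w
  addCell² f (false ∷ w) =
    trans (cong (cellHop (addCell f) w +ᶻ_) (addCell-+ (cellHop f) (addCell (f ∘ (false ∷_))) w))
      (trans (sym (ℤₚ.+-assoc (cellHop (addCell f) w) _ _)) (cong₂ _+ᶻ_ (core w) (addCell² (f ∘ (false ∷_)) w)))
    where
    sq : ∀ a b → a *ᶻ (a *ᶻ b) ≡ (a *ᶻ a) *ᶻ b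
    sq = solve-∀
    cA : ∀ w → cellHop (cellHop f) w ≡ dominoHop f (false ∷ w)
    cA [] = refl
    cA (false ∷ w) = refl
    cA (true ∷ w) = trans (sq (signOf (cells w)) (f (true ∷ false ∷ false ∷ w))) (trans (cong (_*ᶻ f (true ∷ false ∷ false ∷ w)) (signOf² (cells w))) (ℤₚ.*-identityˡ (f (true ∷ false ∷ false ∷ w))))
    cB : ∀ w → signOf (cells w) *ᶻ cellHop (f ∘ (true ∷_)) w ≡ dominoHop f (true ∷ w)
    cB [] = ℤₚ.*-zeroʳ (signOf (cells []))
    cB (false ∷ w) = ℤₚ.*-zeroʳ (signOf (cells (false ∷ w)))
    cB (true ∷ w) = trans (cong (_*ᶻ (signOf (cells w) *ᶻ y)) (signOf-+ (zeros w) (cells w))) (trans (r (signOf (zeros w)) (signOf (cells w)) y) (cong (signOf (zeros w) *ᶻ_) (trans (cong (_*ᶻ y) (signOf² (cells w))) (ℤₚ.*-identityˡ y))))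
      where
      y = f (true ∷ true ∷ false ∷ w)
      r : ∀ a b c → (a *ᶻ b) *ᶻ (b *ᶻ c) ≡ a *ᶻ ((b *ᶻ b) *ᶻ c)
      r = solve-∀
    -- The front letter hops first or last. Against a separate later hop the two orders cancel,
    -- since that hop changes the parity of `cells` (`addCell-sgn`); a domino survives.
    core : ∀ w → cellHop (addCell f) w +ᶻ addCell (cellHop f) w ≡ dominoHop f w
    core [] = refl
    core (false ∷ w) = trans (ℤₚ.+-identityˡ _) (trans (cong (cellHop (cellHop f) w +ᶻ_) (addCell-0 _ (λ _ → refl) w)) (trans (ℤₚ.+-identityʳ _) (cA w)))
    core (true ∷ w) = trans (cong (signOf (cells w) *ᶻ (cellHop (f ∘ (true ∷_)) w +ᶻ addCell (λ u → f (true ∷ false ∷ u)) w) +ᶻ_) (addCell-sgn (λ u → f (true ∷ false ∷ u)) w))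
       (trans (r (signOf (cells w)) (cellHop (f ∘ (true ∷_)) w) (addCell (λ u → f (true ∷ false ∷ u)) w)) (cB w))
      where
      r : ∀ a b c → a *ᶻ (b +ᶻ c) +ᶻ (-ᶻ (a *ᶻ c)) ≡ a *ᶻ b
      r = solve-∀

  addCells : ℕ → (Bits → ℤ) → Bits → ℤ
  addCells zero    f = f
  addCells (suc n) f = addCells n (addCell f)

  addCells-suc : ∀ n f w → addCells (suc n) f w ≡ addCell (addCells n f) w
  addCells-suc zero f w = refl
  addCells-suc (suc n) f w = addCells-suc n (addCell f) w

  -- The boundary words of the partitions of n in a box with B rows and W columns.
  record Class (B W n : ℕ) (w : Bits) : Set where
    constructor cls
    field
      on : ones w ≡ B
      ze : zeros w ≡ W
      ce : cells w ≡ n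

  addCell-class : ∀ {B W n} f g → (∀ w → Class B W (suc n) w → f w ≡ g w) → ∀ w → Class B W n w → addCell f w ≡ addCell g w
  addCell-class f g h w (cls a b c) = addCell-congP f g w (λ { pre t refl → h _ (cls (trans (ones-hop pre t) a) (trans (zeros-hop pre t) b) (trans (cells-hop pre t) (cong suc c))) })

  addCells-class : ∀ {B W} n k f g → (∀ w → Class B W (n + k) w → f w ≡ g w) → ∀ w → Class B W k w → addCells n f w ≡ addCells n g w
  addCells-class zero k f g h w c = h w c
  addCells-class (suc n) k f g h w c = addCells-class n k (addCell f) (addCell g) (λ u cu → addCell-class f g h u cu) w c

  addCells-cong : ∀ n f g → (∀ w → f w ≡ g w) → ∀ w → addCells n f w ≡ addCells n g w
  addCells-cong zero f g h w = h w
  addCells-cong (suc n) f g h w = addCells-cong n _ _ (addCell-cong f g h) w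

  addCells-+ : ∀ n f g w → addCells n (λ u → f u +ᶻ g u) w ≡ addCells n f w +ᶻ addCells n g w
  addCells-+ zero f g w = refl
  addCells-+ (suc n) f g w = trans (addCells-cong n _ _ (addCell-+ f g) w) (addCells-+ n (addCell f) (addCell g) w)

  addCells-* : ∀ n a f w → addCells n (λ u → a *ᶻ f u) w ≡ a *ᶻ addCells n f w
  addCells-* zero a f w = refl
  addCells-* (suc n) a f w = trans (addCells-cong n _ _ (addCell-* a f) w) (addCells-* n a (addCell f) w)

  addCells-0 : ∀ n f → (∀ w → f w ≡ + 0) → ∀ w → addCells n f w ≡ + 0
  addCells-0 zero f h w = h w
  addCells-0 (suc n) f h w = addCells-0 n (addCell f) (addCell-0 f h) w

  bitsOf : List Site → Bits
  bitsOf []       = []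
  bitsOf (s0 ∷ w) = false ∷ false ∷ bitsOf w
  bitsOf (su ∷ w) = true ∷ false ∷ bitsOf w
  bitsOf (sd ∷ w) = false ∷ true ∷ bitsOf w
  bitsOf (st ∷ w) = true ∷ true ∷ bitsOf w

  site : Bool → Bool → Site
  site false false = s0
  site true  false = su
  site false true  = sd
  site true  true  = st

  sitesOf : Bits → List Site
  sitesOf (a ∷ b ∷ w) = site a b ∷ sitesOf w
  sitesOf _           = []

  sites-bits : ∀ w → sitesOf (bitsOf w) ≡ w
  sites-bits []       = refl
  sites-bits (s0 ∷ w) = cong (s0 ∷_) (sites-bits w)
  sites-bits (su ∷ w) = cong (su ∷_) (sites-bits w)
  sites-bits (sd ∷ w) = cong (sd ∷_) (sites-bits w)
  sites-bits (st ∷ w) = cong (st ∷_) (sites-bits w)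

  evb : ℕ → Bool
  evb zero    = true
  evb (suc n) = not (evb n)

  sign-evb : ∀ n → signOf n ≡ sgz (evb n)
  sign-evb zero = refl
  sign-evb (suc n) = trans (signOf-suc n) (trans (cong -ᶻ_ (sign-evb n)) (h (evb n)))
    where
    h : ∀ b → -ᶻ sgz b ≡ sgz (not b)
    h true = refl
    h false = refl

  -- The product counts the cells in a row from `a` and a column from `b`: every such pair meets in
  -- a cell.
  cells-++ : ∀ a b → cells (a ++ b) ≡ (cells a + ones a ℕ.* zeros b) + cells b
  cells-++ [] b = refl
  cells-++ (false ∷ a) b = cells-++ a b
  cells-++ (true ∷ a) b = trans (cong₂ _+_ (zeros-++ a b) (cells-++ a b)) (r (zeros a) (zeros b) (cells a) (ones a ℕ.* zeros b) (cells b))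
    where
    zeros-++ : ∀ a b → zeros (a ++ b) ≡ zeros a + zeros b
    zeros-++ [] b = refl
    zeros-++ (true ∷ a) b = zeros-++ a b
    zeros-++ (false ∷ a) b = cong suc (zeros-++ a b)
    r : ∀ za zb c p d → (za + zb) + ((c + p) + d) ≡ ((za + c) + (zb + p)) + d
    r = ℕsolve-∀

  ones-++ : ∀ a b → ones (a ++ b) ≡ ones a + ones b
  ones-++ [] b = refl
  ones-++ (true ∷ a) b = cong suc (ones-++ a b)
  ones-++ (false ∷ a) b = ones-++ a b

  bitsOf-++ : ∀ u v → bitsOf (u ++ v) ≡ bitsOf u ++ bitsOf v
  bitsOf-++ [] v = refl
  bitsOf-++ (s0 ∷ u) v = cong (λ w → false ∷ false ∷ w) (bitsOf-++ u v)
  bitsOf-++ (su ∷ u) v = cong (λ w → true ∷ false ∷ w) (bitsOf-++ u v)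
  bitsOf-++ (sd ∷ u) v = cong (λ w → false ∷ true ∷ w) (bitsOf-++ u v)
  bitsOf-++ (st ∷ u) v = cong (λ w → true ∷ true ∷ w) (bitsOf-++ u v)

  evb-double : ∀ k → evb (k + k) ≡ true
  evb-double zero = refl
  evb-double (suc k) = trans (cong (λ n → not (evb n)) (ℕₚ.+-suc k k)) (trans (not-involutive (evb (k + k))) (evb-double k))

  -- Cutting into sites drops an unpaired last letter, hence the parity assumption.
  bits-sites : ∀ w → evb (zeros w + ones w) ≡ true → w ≡ bitsOf (sitesOf w)
  bits-sites [] e = refl
  bits-sites (true ∷ []) ()
  bits-sites (false ∷ []) ()
  bits-sites (a ∷ b ∷ w) e = trans (cong (λ u → a ∷ b ∷ u) (bits-sites w (trans (sym (h a b)) e))) (g a b (sitesOf w))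
    where
    nn = not-involutive (evb (zeros w + ones w))
    h : ∀ a b → evb (zeros (a ∷ b ∷ w) + ones (a ∷ b ∷ w)) ≡ evb (zeros w + ones w)
    h true true = trans (cong evb (trans (ℕₚ.+-suc (zeros w) _) (cong suc (ℕₚ.+-suc (zeros w) _)))) nn
    h true false = trans (cong (λ n → not (evb n)) (ℕₚ.+-suc (zeros w) _)) nn
    h false true = trans (cong (λ n → not (evb n)) (ℕₚ.+-suc (zeros w) _)) nn
    h false false = nn
    g : ∀ a b u → a ∷ b ∷ bitsOf u ≡ bitsOf (site a b ∷ u)
    g true true u = refl
    g true false u = refl
    g false true u = refl
    g false false u = refl

  length-sites : ∀ w → length w + length w ≡ zeros (bitsOf w) + ones (bitsOf w)
  length-sites [] = refl
  length-sites (s ∷ w) = trans (cong suc (ℕₚ.+-suc (length w) (length w))) (trans (cong (λ n → suc (suc n)) (length-sites w)) (h s))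
    where
    z = zeros (bitsOf w)
    n = ones (bitsOf w)
    h : ∀ s → suc (suc (z + n)) ≡ zeros (bitsOf (s ∷ w)) + ones (bitsOf (s ∷ w))
    h s0 = refl
    h su = cong suc (sym (ℕₚ.+-suc z n))
    h sd = cong suc (sym (ℕₚ.+-suc z n))
    h st = trans (cong suc (sym (ℕₚ.+-suc z n))) (sym (ℕₚ.+-suc z (suc n)))

-- The induction that kills all functionals with zero initial values.

module Vanishing (q x : ℤ) where

  open TermAlgebra using (sgz)
  open Tables
  open Labels q x
  open DominoStep q x
  open BitWords

  dominoSum-cong : ∀ τ f g → (∀ w → f w ≡ g w) → ∀ w → dominoSum τ f w ≡ dominoSum τ g w
  dominoSum-cong τ f g h [] = refl
  dominoSum-cong τ f g h (s ∷ []) = refl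
  dominoSum-cong τ f g h (s ∷ t ∷ w) = cong₂ _+ᶻ_ (us (moves (xr (single t) (xr (single s) τ)) s t)) (dominoSum-cong _ _ _ (λ u → h (s ∷ u)) (t ∷ w))
    where
    us : ∀ ms → moveSum f w ms ≡ moveSum g w ms
    us [] = refl
    us ((b , s , t) ∷ ms) = cong₂ (λ a c → sgz b *ᶻ a +ᶻ c) (h _) (us ms)

  -- A domino hop spans three letters, so it always crosses from one site to the next. The hops
  -- whose first letter lies in `s` are the moves on `s` and `t`.
  addDomino-pair : ∀ s t g w → addDomino g (bitsOf (s ∷ t ∷ w)) ≡
    moveSum (g ∘ bitsOf) w (moves (evb (zeros (bitsOf w))) s t) +ᶻ addDomino (λ u → g (bitsOf (s ∷ []) ++ u)) (bitsOf (t ∷ w))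
  addDomino-pair s t g w = go s t
    where
    η = sgz (evb (zeros (bitsOf w)))
    X : Site → Site → ℤ
    X s t = addDomino (λ u → g (bitsOf (s ∷ []) ++ u)) (bitsOf (t ∷ w))
    r1 : ∀ a X → a +ᶻ (+ 0 +ᶻ X) ≡ (+ 1 *ᶻ a +ᶻ + 0) +ᶻ X
    r1 = solve-∀
    r1′ : ∀ a X → a +ᶻ X ≡ (+ 1 *ᶻ a +ᶻ + 0) +ᶻ X
    r1′ = solve-∀
    r1″ : ∀ a X → + 0 +ᶻ (a +ᶻ X) ≡ (+ 1 *ᶻ a +ᶻ + 0) +ᶻ X
    r1″ = solve-∀
    r2 : ∀ e a X → e *ᶻ a +ᶻ X ≡ (e *ᶻ a +ᶻ + 0) +ᶻ X
    r2 = solve-∀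
    r3 : ∀ e a b X → a +ᶻ (e *ᶻ b +ᶻ X) ≡ (+ 1 *ᶻ a +ᶻ (e *ᶻ b +ᶻ + 0)) +ᶻ X
    r3 = solve-∀
    sg : ∀ n a X → signOf n *ᶻ a +ᶻ X ≡ (sgz (evb n) *ᶻ a +ᶻ + 0) +ᶻ X
    sg n a X = trans (cong (λ e → e *ᶻ a +ᶻ X) (sign-evb n)) (r2 (sgz (evb n)) a X)
    go : ∀ s t → addDomino g (bitsOf (s ∷ t ∷ w)) ≡ moveSum (g ∘ bitsOf) w (moves (evb (zeros (bitsOf w))) s t) +ᶻ X s t
    go s0 s0 = ℤₚ.+-identityˡ _
    go s0 su = r1 (g (bitsOf (su ∷ s0 ∷ w))) (X s0 su)
    go s0 sd = r1″ (g (bitsOf (sd ∷ s0 ∷ w))) (X s0 sd)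
    go s0 st = trans (cong (λ e → a +ᶻ (e *ᶻ b +ᶻ X s0 st)) (sign-evb (zeros (bitsOf w)))) (r3 η a b (X s0 st))
      where
      a = g (bitsOf (su ∷ sd ∷ w))
      b = g (bitsOf (sd ∷ su ∷ w))
    go sd s0 = refl
    go sd su = sg (suc (zeros (bitsOf w))) (g (bitsOf (st ∷ s0 ∷ w))) (X sd su)
    go sd sd = refl
    go sd st = sg (zeros (bitsOf w)) (g (bitsOf (st ∷ sd ∷ w))) (X sd st)
    go su s0 = refl
    go su su = refl
    go su sd = r1′ (g (bitsOf (st ∷ s0 ∷ w))) (X su sd)
    go su st = sg (zeros (bitsOf w)) (g (bitsOf (st ∷ su ∷ w))) (X su st)
    go st t = sym (ℤₚ.+-identityˡ _)

  evb-site : ∀ s w → xr (single s) (evb (zeros (bitsOf (s ∷ w)))) ≡ evb (zeros (bitsOf w))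
  evb-site s0 w = not-involutive _
  evb-site su w = not-involutive _
  evb-site sd w = not-involutive _
  evb-site st w = refl

  addDomino-dominoSum : ∀ g w → addDomino g (bitsOf w) ≡ dominoSum (evb (zeros (bitsOf w))) (g ∘ bitsOf) w
  addDomino-dominoSum g [] = refl
  addDomino-dominoSum g (s0 ∷ []) = refl
  addDomino-dominoSum g (su ∷ []) = refl
  addDomino-dominoSum g (sd ∷ []) = refl
  addDomino-dominoSum g (st ∷ []) = refl
  addDomino-dominoSum g (s ∷ t ∷ w) = trans (addDomino-pair s t g w)
    (cong₂ _+ᶻ_ (cong (λ η → moveSum (g ∘ bitsOf) w (moves η s t)) (sym (trans (cong (xr (single t)) (evb-site s (t ∷ w))) (evb-site t w))))
      (trans (addDomino-dominoSum (λ u → g (bitsOf (s ∷ []) ++ u)) (t ∷ w))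
        (trans (cong (λ τ → dominoSum τ (λ u → g (bitsOf (s ∷ []) ++ bitsOf u)) (t ∷ w)) (sym (evb-site s (t ∷ w))))
          (dominoSum-cong _ _ _ (λ u → cong g (sym (bitsOf-++ (s ∷ []) u))) (t ∷ w)))))

  -- A letter 1 among the first two would be a row with at least n cells.
  first-s0 : ∀ w n → zeros (bitsOf w) ≡ suc n → cells (bitsOf w) < n → ∃[ u ] w ≡ s0 ∷ u
  first-s0 [] n () c
  first-s0 (s0 ∷ w) n e c = w , refl
  first-s0 (su ∷ w) n e c = ⊥-elim (ℕₚ.<⇒≱ c (ℕₚ.≤-trans (ℕₚ.≤-trans (ℕₚ.n≤1+n n) (ℕₚ.≤-reflexive (sym e))) (ℕₚ.m≤m+n _ _)))
  first-s0 (sd ∷ w) n e c = ⊥-elim (ℕₚ.<⇒≱ c (ℕₚ.≤-trans (ℕₚ.≤-reflexive (ℕₚ.suc-injective (sym e))) (ℕₚ.m≤m+n _ _)))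
  first-s0 (st ∷ w) n e c = ⊥-elim (ℕₚ.<⇒≱ c (ℕₚ.≤-trans (ℕₚ.≤-trans (ℕₚ.n≤1+n n) (ℕₚ.≤-reflexive (sym e))) (ℕₚ.m≤m+n _ _)))

  -- A letter 0 among the last two would be a column meeting all rows of the earlier sites, of which
  -- there are at least n.
  last-st : ∀ w n → ones (bitsOf w) ≡ suc n → cells (bitsOf w) < n → ∃[ u ] w ≡ u ++ st ∷ []
  last-st w n e c with initLast w
  last-st .[] n () c | []
  ... | u ∷ʳ′ s = go s e c
    where
    bad : ∀ s → 1 ≤ zeros (bitsOf (s ∷ [])) → ones (bitsOf (s ∷ [])) ≤ 1 → ones (bitsOf (u ++ s ∷ [])) ≡ suc n → cells (bitsOf (u ++ s ∷ [])) < n → ⊥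
    bad s z1 o1 e c = ℕₚ.<⇒≱ c (begin
      n                                                   ≤⟨ ℕₚ.≤-pred (ℕₚ.≤-trans (ℕₚ.≤-reflexive (trans (sym e) (trans (cong ones (bitsOf-++ u (s ∷ []))) (ones-++ (bitsOf u) _)))) (ℕₚ.≤-trans (ℕₚ.+-monoʳ-≤ (ones (bitsOf u)) o1) (ℕₚ.≤-reflexive (ℕₚ.+-comm (ones (bitsOf u)) 1)))) ⟩
      ones (bitsOf u)                                     ≡⟨ sym (ℕₚ.*-identityʳ _) ⟩
      ones (bitsOf u) ℕ.* 1                               ≤⟨ ℕₚ.*-monoʳ-≤ (ones (bitsOf u)) z1 ⟩
      ones (bitsOf u) ℕ.* zeros (bitsOf (s ∷ []))         ≤⟨ ℕₚ.m≤n+m _ (cells (bitsOf u)) ⟩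
      cells (bitsOf u) + ones (bitsOf u) ℕ.* zeros (bitsOf (s ∷ [])) ≤⟨ ℕₚ.m≤m+n _ _ ⟩
      _                                                   ≡⟨ sym (trans (cong cells (bitsOf-++ u (s ∷ []))) (cells-++ (bitsOf u) _)) ⟩
      cells (bitsOf (u ++ s ∷ []))                        ∎)
      where open ℕₚ.≤-Reasoning
    go : ∀ s → ones (bitsOf (u ++ s ∷ [])) ≡ suc n → cells (bitsOf (u ++ s ∷ [])) < n → ∃[ u′ ] u ++ s ∷ [] ≡ u′ ++ st ∷ []
    go st e c = u , refl
    go s0 e c = ⊥-elim (bad s0 (s≤s z≤n) z≤n e c)
    go su e c = ⊥-elim (bad su (s≤s z≤n) (s≤s z≤n) e c)
    go sd e c = ⊥-elim (bad sd (s≤s z≤n) (s≤s z≤n) e c)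

  double-injective : ∀ m n → m + m ≡ n + n → m ≡ n
  double-injective zero zero e = refl
  double-injective (suc m) (suc n) e = cong suc (double-injective m n (ℕₚ.suc-injective (trans (sym (ℕₚ.+-suc m m)) (trans (ℕₚ.suc-injective e) (ℕₚ.+-suc n n)))))

  -- In the square box of side 2K + 2, a shape with fewer than 2K + 1 cells reaches neither the
  -- first nor the last site.
  sites-class : ∀ {K n w} → Class (suc K + suc K) (suc K + suc K) n w → n < K + suc K →
    w ≡ bitsOf (sitesOf w) × length (sitesOf w) ≡ suc K + suc K × ∃[ u ] sitesOf w ≡ s0 ∷ u ++ st ∷ []
  sites-class {K} {n} {w} (cls a b c) lt = e , double-injective _ _ (trans (length-sites (sitesOf w)) (cong₂ _+_ (trans (cong zeros (sym e)) b) (trans (cong ones (sym e)) a))) , ends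
    where
    e : w ≡ bitsOf (sitesOf w)
    e = bits-sites w (trans (cong evb (cong₂ _+_ b a)) (evb-double (suc K + suc K)))
    lt′ : cells (bitsOf (sitesOf w)) < K + suc K
    lt′ = subst (λ y → cells y < K + suc K) e (subst (_< K + suc K) (sym c) lt)
    ends : ∃[ u ] sitesOf w ≡ s0 ∷ u ++ st ∷ []
    ends with sitesOf w | first-s0 (sitesOf w) (K + suc K) (trans (cong zeros (sym e)) b) lt′ | last-st (sitesOf w) (K + suc K) (trans (cong ones (sym e)) a) lt′
    ... | .(s0 ∷ u) | u , refl | [] , ()
    ... | .(s0 ∷ u) | u , refl | (s ∷ u′) , e′ = u′ , cong (s0 ∷_) (∷-injectiveʳ e′)

  evBits : Labs 0 → Bits → ℤ
  evBits ls w = ev ls o (+ 1) (sitesOf w)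

  mstep²-evB : ∀ {K n} (ls : Labs 0) → len ls ≡ suc K + suc K → n < K + suc K → ∀ w → Class (suc K + suc K) (suc K + suc K) n w →
    addCell (addCell (evBits ls)) w ≡ (q +ᶻ x) *ᶻ evBits ls w +ᶻ sumT (lows ls) o (+ 1) (sitesOf w)
  mstep²-evB {K} ls ll lt w cl with sites-class {K} cl lt
  ... | e , l , u , eu = begin
    addCell (addCell (evBits ls)) w                                   ≡⟨ addCell² (evBits ls) w ⟩
    addDomino (evBits ls) w                                             ≡⟨ cong (addDomino (evBits ls)) e ⟩
    addDomino (evBits ls) (bitsOf (sitesOf w))                          ≡⟨ addDomino-dominoSum (evBits ls) (sitesOf w) ⟩
    dominoSum (evb (zeros (bitsOf (sitesOf w)))) (evBits ls ∘ bitsOf) (sitesOf w)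
      ≡⟨ cong (λ τ → dominoSum τ (evBits ls ∘ bitsOf) (sitesOf w)) (trans (cong evb (trans (cong zeros (sym e)) (Class.ze cl))) (evb-double (suc K))) ⟩
    dominoSum true (evBits ls ∘ bitsOf) (sitesOf w)                      ≡⟨ dominoSum-cong true _ _ (λ y → cong (ev ls o (+ 1)) (sites-bits y)) (sitesOf w) ⟩
    dominoSum true (ev ls o (+ 1)) (sitesOf w)                        ≡⟨ cong (dominoSum true (ev ls o (+ 1))) eu ⟩
    dominoSum true (ev ls o (+ 1)) (s0 ∷ u ++ st ∷ [])                ≡⟨ dominoSum-step ls (+ 1) u (trans (cong length (sym eu)) (trans l (sym ll))) ⟩
    _                                                          ≡⟨ cong (λ y → (q +ᶻ x) *ᶻ ev ls o (+ 1) y +ᶻ sumT (lows ls) o (+ 1) y) (sym eu) ⟩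
    _                                                          ∎
    where open ≡-Reasoning

  -- Induction on m for all label lists of the given length at once. A double step yields a multiple
  -- of the functional itself, which vanishes at `w` by assumption, and remainders, which vanish at
  -- `w` because they contain `lU`. The size bound keeps every word met within reach of
  -- `sites-class`.
  vanish : ∀ K k w → Class (suc K + suc K) (suc K + suc K) k w → ((ls : Labs 0) → Nontrivial ls → evBits ls w ≡ + 0) →
    ∀ m (ls : Labs 0) → len ls ≡ suc K + suc K → evBits ls w ≡ + 0 → m + m + k ≤ K + suc K → addCells (m + m) (evBits ls) w ≡ + 0
  vanish K k w cl nt zero ls ll z le = z
  vanish K k w cl nt (suc m) ls ll z le = begin
    addCells (suc (m + suc m)) (evBits ls) w              ≡⟨ cong (λ n → addCells (suc n) (evBits ls) w) (ℕₚ.+-suc m m) ⟩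
    addCells (m + m) (addCell (addCell (evBits ls))) w        ≡⟨ addCells-class (m + m) k _ _ (λ u cu → mstep²-evB {K} ls ll lt u cu) w cl ⟩
    addCells (m + m) (λ u → (q +ᶻ x) *ᶻ evBits ls u +ᶻ sumT (lows ls) o (+ 1) (sitesOf u)) w ≡⟨ addCells-+ (m + m) _ _ w ⟩
    addCells (m + m) (λ u → (q +ᶻ x) *ᶻ evBits ls u) w +ᶻ addCells (m + m) (λ u → sumT (lows ls) o (+ 1) (sitesOf u)) w
      ≡⟨ cong₂ _+ᶻ_ (trans (addCells-* (m + m) (q +ᶻ x) (evBits ls) w) (trans (cong ((q +ᶻ x) *ᶻ_) (vanish K k w cl nt m ls ll z (ℕₚ.<⇒≤ lt))) (ℤₚ.*-zeroʳ (q +ᶻ x))))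
           (terms (lows ls) (lows-nontrivial ls) (len-lows ls)) ⟩
    + 0 ∎
    where
    open ≡-Reasoning
    lt : m + m + k < K + suc K
    lt = ℕₚ.<-≤-trans (ℕₚ.+-monoˡ-< k (ℕₚ.+-mono-<-≤ (ℕₚ.n<1+n m) (ℕₚ.n≤1+n m))) le
    terms : ∀ (ts : Terms 0) → NontrivialTerms ts → Lens (len ls) ts → addCells (m + m) (λ u → sumT ts o (+ 1) (sitesOf u)) w ≡ + 0
    terms [] [] [] = addCells-0 (m + m) _ (λ _ → refl) w
    terms ((b , pl ls′) ∷ ts) (h ∷ hs) (l ∷ le′) = trans (addCells-+ (m + m) _ _ w)
      (cong₂ _+ᶻ_ (trans (addCells-* (m + m) (sgz b) (evBits ls′) w) (trans (cong (sgz b *ᶻ_) (vanish K k w cl nt m ls′ (trans l ll) (nt ls′ h) (ℕₚ.<⇒≤ lt))) (ℤₚ.*-zeroʳ (sgz b)))) (terms ts hs le′))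
    -- At depth 0 no contraction of two doublings can be pending.
    terms ((b , jt zero d () ls′) ∷ ts) _ _
    terms ((b , jt (suc k) d () ls′) ∷ ts) _ _

-- Sign-imbalance by removal of the largest entry.

module Tableaux where

  open BitWords using (signOf-suc; signOf-+)

  insSum : ℕ → (List ℕ → ℤ) → List ℕ → ℤ
  insSum n f []      = f (n ∷ [])
  insSum n f (y ∷ w) = f (n ∷ y ∷ w) +ᶻ insSum n (f ∘ (y ∷_)) w

  permSum : (List ℕ → ℤ) → List ℕ → ℤ
  permSum f []       = f []
  permSum f (x ∷ xs) = permSum (insSum x f) xs

  insSum-cong : ∀ n {f g} → (∀ w → f w ≡ g w) → ∀ w → insSum n f w ≡ insSum n g w
  insSum-cong n h []      = h _
  insSum-cong n h (y ∷ w) = cong₂ _+ᶻ_ (h _) (insSum-cong n (λ u → h (y ∷ u)) w)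

  insSum-+ : ∀ n f g w → insSum n (λ u → f u +ᶻ g u) w ≡ insSum n f w +ᶻ insSum n g w
  insSum-+ n f g []      = refl
  insSum-+ n f g (y ∷ w) = trans (cong ((f (n ∷ y ∷ w) +ᶻ g (n ∷ y ∷ w)) +ᶻ_) (insSum-+ n _ _ w)) (r (f (n ∷ y ∷ w)) (g (n ∷ y ∷ w)) _ _)
    where
    r : ∀ a b c d → (a +ᶻ b) +ᶻ (c +ᶻ d) ≡ (a +ᶻ c) +ᶻ (b +ᶻ d)
    r = solve-∀

  insSum-0 : ∀ n w → insSum n (λ _ → + 0) w ≡ + 0
  insSum-0 n []      = refl
  insSum-0 n (y ∷ w) = trans (ℤₚ.+-identityˡ _) (insSum-0 n w)

  insSum-* : ∀ n a f w → insSum n (λ u → a *ᶻ f u) w ≡ a *ᶻ insSum n f w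
  insSum-* n a f []      = refl
  insSum-* n a f (y ∷ w) = trans (cong (a *ᶻ f (n ∷ y ∷ w) +ᶻ_) (insSum-* n a _ w)) (sym (ℤₚ.*-distribˡ-+ a _ _))

  insSum-comm : ∀ m n f w → insSum m (insSum n f) w ≡ insSum n (insSum m f) w
  insSum-comm m n f []      = ℤₚ.+-comm (f (n ∷ m ∷ [])) (f (m ∷ n ∷ []))
  insSum-comm m n f (y ∷ w) =
    trans (cong ((f (n ∷ m ∷ y ∷ w) +ᶻ (f (m ∷ n ∷ y ∷ w) +ᶻ insSum n (λ u → f (m ∷ y ∷ u)) w)) +ᶻ_) (insSum-+ m (λ u → f (n ∷ y ∷ u)) (insSum n (f ∘ (y ∷_))) w))
    (trans (cong (λ z → (f (n ∷ m ∷ y ∷ w) +ᶻ (f (m ∷ n ∷ y ∷ w) +ᶻ insSum n (λ u → f (m ∷ y ∷ u)) w)) +ᶻ (insSum m (λ u → f (n ∷ y ∷ u)) w +ᶻ z)) (insSum-comm m n (f ∘ (y ∷_)) w))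
    (trans (r (f (n ∷ m ∷ y ∷ w)) (f (m ∷ n ∷ y ∷ w)) _ _ _)
    (sym (cong ((f (m ∷ n ∷ y ∷ w) +ᶻ (f (n ∷ m ∷ y ∷ w) +ᶻ insSum m (λ u → f (n ∷ y ∷ u)) w)) +ᶻ_) (insSum-+ n (λ u → f (m ∷ y ∷ u)) (insSum m (f ∘ (y ∷_))) w)))))
    where
    r : ∀ a b c d e → (a +ᶻ (b +ᶻ c)) +ᶻ (d +ᶻ e) ≡ (b +ᶻ (a +ᶻ d)) +ᶻ (c +ᶻ e)
    r = solve-∀

  permSum-cong : ∀ {f g} → (∀ w → f w ≡ g w) → ∀ xs → permSum f xs ≡ permSum g xs
  permSum-cong h []       = h []
  permSum-cong h (x ∷ xs) = permSum-cong (insSum-cong x h) xs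

  permSum-+ : ∀ f g xs → permSum (λ u → f u +ᶻ g u) xs ≡ permSum f xs +ᶻ permSum g xs
  permSum-+ f g []       = refl
  permSum-+ f g (x ∷ xs) = trans (permSum-cong (insSum-+ x f g) xs) (permSum-+ _ _ xs)

  permSum-* : ∀ a f xs → permSum (λ u → a *ᶻ f u) xs ≡ a *ᶻ permSum f xs
  permSum-* a f []       = refl
  permSum-* a f (x ∷ xs) = trans (permSum-cong (insSum-* x a f) xs) (permSum-* a _ xs)

  permSum-0 : ∀ xs → permSum (λ _ → + 0) xs ≡ + 0
  permSum-0 []       = refl
  permSum-0 (x ∷ xs) = trans (permSum-cong (insSum-0 x) xs) (permSum-0 xs)

  -- Insertions commute, so the last letter, in the application the largest, may be inserted after
  -- all others.
  permSum-∷ʳ : ∀ f xs n → permSum f (xs ∷ʳ n) ≡ permSum (insSum n f) xs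
  permSum-∷ʳ f []       n = refl
  permSum-∷ʳ f (x ∷ xs) n = trans (permSum-∷ʳ (insSum x f) xs n) (permSum-cong (insSum-comm n x f) xs)

  sum-++ᶻ : ∀ as bs → sumℤ (as ++ bs) ≡ sumℤ as +ᶻ sumℤ bs
  sum-++ᶻ []       bs = sym (ℤₚ.+-identityˡ _)
  sum-++ᶻ (a ∷ as) bs = trans (cong (a +ᶻ_) (sum-++ᶻ as bs)) (sym (ℤₚ.+-assoc a _ _))

  sum-insertions : ∀ f n w → sumℤ (map f (insertions n w)) ≡ insSum n f w
  sum-insertions f n []      = ℤₚ.+-identityʳ _
  sum-insertions f n (y ∷ w) = cong (f (n ∷ y ∷ w) +ᶻ_) (trans (cong sumℤ (sym (map-∘ (insertions n w)))) (sum-insertions (f ∘ (y ∷_)) n w))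

  sum-perms : ∀ f xs → sumℤ (map f (perms xs)) ≡ permSum f xs
  sum-perms f []       = ℤₚ.+-identityʳ _
  sum-perms f (x ∷ xs) = trans (cm (perms xs)) (sum-perms (insSum x f) xs)
    where
    cm : ∀ ws → sumℤ (map f (concatMap (insertions x) ws)) ≡ sumℤ (map (insSum x f) ws)
    cm []       = refl
    cm (w ∷ ws) = trans (cong sumℤ (map-++ f (insertions x w) _)) (trans (sum-++ᶻ (map f (insertions x w)) _) (cong₂ _+ᶻ_ (sum-insertions f x w) (cm ws)))

  permSum-P : ∀ {p} (P : ℕ → Set p) {f g} xs → All P xs → (∀ w → All P w → length w ≡ length xs → f w ≡ g w) → permSum f xs ≡ permSum g xs
  permSum-P P []       []       h = h [] [] refl
  permSum-P P {f} {g} (x ∷ xs) (px ∷ pxs) h = permSum-P P xs pxs (λ w pw lw → go f g w pw (λ u pu lu → h u pu (trans lu (cong suc lw))))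
    where
    go : ∀ f g w → All P w → (∀ u → All P u → length u ≡ suc (length w) → f u ≡ g u) → insSum x f w ≡ insSum x g w
    go f g [] [] h = h _ (px ∷ []) refl
    go f g (y ∷ w) (py ∷ pw) h = cong₂ _+ᶻ_ (h _ (px ∷ py ∷ pw) refl) (go _ _ w pw (λ u pu lu → h (y ∷ u) (py ∷ pu) (cong suc lu)))

  -- `isSYT` regrouped by rows: `P` is the condition that the row above imposes on the first row,
  -- which makes the test recursive in the shape.
  tabOK : (List ℕ → Bool) → Shape → List ℕ → Bool
  tabOK P []      w = true
  tabOK P (k ∷ μ) w = (P (take k w) ∧ increasing (take k w)) ∧ tabOK (colsOK (take k w)) μ (drop k w)

  isSYT-tabOK : ∀ μ w → isSYT μ w ≡ tabOK (λ _ → true) μ w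
  isSYT-tabOK []      w = refl
  isSYT-tabOK (k ∷ μ) w = trans (∧-assoc (increasing (take k w)) _ _) (cong (increasing (take k w) ∧_) (go (take k w) μ (drop k w)))
    where
    sw : ∀ a b c d → (a ∧ b) ∧ (c ∧ d) ≡ (c ∧ a) ∧ (b ∧ d)
    sw true  b true  d = refl
    sw true  true  false d = refl
    sw true  false false d = refl
    sw false b true  d = refl
    sw false b false d = refl
    go : ∀ R μ w → allRowsIncr (rowsOf μ w) ∧ allColsIncr (R ∷ rowsOf μ w) ≡ tabOK (colsOK R) μ w
    go R []      w = refl
    go R (k ∷ μ) w = trans (sw (increasing (take k w)) _ (colsOK R (take k w)) _) (cong ((colsOK R (take k w) ∧ increasing (take k w)) ∧_) (go (take k w) μ (drop k w)))

  tabOK-++ : ∀ P r μ t → tabOK P (length r ∷ μ) (r ++ t) ≡ (P r ∧ increasing r) ∧ tabOK (colsOK r) μ t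
  tabOK-++ P r μ t = cong₂ (λ a b → (P a ∧ increasing a) ∧ tabOK (colsOK a) μ b) (tk r) (dp r)
    where
    tk : ∀ r → take (length r) (r ++ t) ≡ r
    tk []      = refl
    tk (x ∷ r) = cong (x ∷_) (tk r)
    dp : ∀ r → drop (length r) (r ++ t) ≡ t
    dp []      = refl
    dp (x ∷ r) = dp r

  when : Bool → ℤ → ℤ
  when b z = if b then z else + 0

  -- Unlike `IsPartition` this admits padding by zero rows. The index bounds the first row and plays
  -- the part of the row above.
  data Desc : ℕ → List ℕ → Set where
    []  : ∀ {W} → Desc W []
    _∷_ : ∀ {W a μ} → a ≤ W → Desc a μ → Desc W (a ∷ μ)

  Desc-0 : ∀ {μ} → Desc 0 μ → sum μ ≡ 0
  Desc-0 []        = refl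
  Desc-0 (z≤n ∷ d) = Desc-0 d

  -- The last cell of a row of length a is a corner when the next row is shorter, and `sum μ`
  -- entries follow it in the reading word.
  coef : ℕ → Shape → ℤ
  coef a μ = when (row μ 0 <ᵇ a) (signOf (sum μ))

  cornerSum : (Shape → ℤ) → Shape → ℤ
  cornerSum f []      = + 0
  cornerSum f (a ∷ μ) = coef a μ *ᶻ f ((a ∸ 1) ∷ μ) +ᶻ cornerSum (f ∘ (a ∷_)) μ

  cornerSum-cong : ∀ {f g} → (∀ μ → f μ ≡ g μ) → ∀ μ → cornerSum f μ ≡ cornerSum g μ
  cornerSum-cong h []      = refl
  cornerSum-cong h (a ∷ μ) = cong₂ _+ᶻ_ (cong (coef a μ *ᶻ_) (h _)) (cornerSum-cong (λ ν → h (a ∷ ν)) μ)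

  cornerSum-0 : ∀ μ → cornerSum (λ _ → + 0) μ ≡ + 0
  cornerSum-0 []      = refl
  cornerSum-0 (a ∷ μ) = trans (cong₂ _+ᶻ_ (ℤₚ.*-zeroʳ (coef a μ)) (cornerSum-0 μ)) refl

  cornerSum-empty : ∀ f μ → sum μ ≡ 0 → cornerSum f μ ≡ + 0
  cornerSum-empty f []         e = refl
  cornerSum-empty f (zero ∷ μ) e = trans (cong₂ _+ᶻ_ (trans (cong (λ b → when b (signOf (sum μ)) *ᶻ f (0 ∷ μ)) (lt0 (row μ 0))) (ℤₚ.*-zeroˡ (f (0 ∷ μ)))) (cornerSum-empty _ μ e)) refl
    where
    lt0 : ∀ n → (n <ᵇ 0) ≡ false
    lt0 zero    = refl
    lt0 (suc n) = refl

  <ᵇ-true : ∀ {m n} → m < n → (m <ᵇ n) ≡ true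
  <ᵇ-true {zero}  (s≤s h) = refl
  <ᵇ-true {suc m} (s≤s h) = <ᵇ-true h

  <ᵇ-false : ∀ {m n} → n ≤ m → (m <ᵇ n) ≡ false
  <ᵇ-false {zero}  z≤n     = refl
  <ᵇ-false {suc m} z≤n     = refl
  <ᵇ-false (s≤s h) = <ᵇ-false h

  module Insert (N : ℕ) where

    Below : List ℕ → Set
    Below = All (_< N)

    inc-false : ∀ r y s → y < N → increasing (r ++ N ∷ y ∷ s) ≡ false
    inc-false []          y s h = cong (_∧ increasing (y ∷ s)) (<ᵇ-false (ℕₚ.<⇒≤ h))
    inc-false (a ∷ [])    y s h = trans (cong ((a <ᵇ N) ∧_) (inc-false [] y s h)) (∧-comm (a <ᵇ N) false)
    inc-false (a ∷ b ∷ r) y s h = trans (cong ((a <ᵇ b) ∧_) (inc-false (b ∷ r) y s h)) (∧-comm (a <ᵇ b) false)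

    inc-snoc : ∀ r → Below r → increasing (r ++ N ∷ []) ≡ increasing r
    inc-snoc []          []           = refl
    inc-snoc (a ∷ [])    (h ∷ [])     = cong (_∧ true) (<ᵇ-true h)
    inc-snoc (a ∷ b ∷ r) (h ∷ hs)     = cong ((a <ᵇ b) ∧_) (inc-snoc (b ∷ r) hs)

    -- An entry below the largest letter would be smaller than it, so the next row must not reach
    -- the column of that letter.
    cols-above : ∀ r s → Below s → length s ≤ suc (length r) → colsOK (r ++ N ∷ []) s ≡ (length s <ᵇ suc (length r)) ∧ colsOK r s
    cols-above []      []          _        _ = refl
    cols-above []      (b ∷ [])    (h ∷ _)  _ = cong (_∧ true) (<ᵇ-false (ℕₚ.<⇒≤ h))
    cols-above []      (b ∷ _ ∷ _) _        (s≤s ())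
    cols-above (a ∷ r) []          _        _ = refl
    cols-above (a ∷ r) (b ∷ s)     (_ ∷ hs) (s≤s l) = trans (cong ((a <ᵇ b) ∧_) (cols-above r s hs l)) (sw (a <ᵇ b) (length s <ᵇ suc (length r)) (colsOK r s))
      where
      sw : ∀ a b c → a ∧ (b ∧ c) ≡ b ∧ (a ∧ c)
      sw true  b c = refl
      sw false true c = refl
      sw false false c = refl

    cols-below : ∀ r s → Below r → length s < length r → colsOK r (s ++ N ∷ []) ≡ colsOK r s
    cols-below (a ∷ r) []      (h ∷ _)  _       = cong (_∧ true) (<ᵇ-true h)
    cols-below (a ∷ r) (b ∷ s) (_ ∷ hs) (s≤s l) = cong ((a <ᵇ b) ∧_) (cols-below r s hs l)

    split-at : ∀ j (w : List ℕ) → j ≤ length w → w ≡ take j w ++ drop j w × length (take j w) ≡ j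
    split-at j w h = sym (take++drop≡id j w) , trans (length-take j w) (ℕₚ.m≤n⇒m⊓n≡m h)

    tabOK-cols : ∀ r μ t → Below t → length t ≡ sum μ → Desc (suc (length r)) μ →
      tabOK (colsOK (r ++ N ∷ [])) μ t ≡ (row μ 0 <ᵇ suc (length r)) ∧ tabOK (colsOK r) μ t
    tabOK-cols r []      t h e d = refl
    tabOK-cols r (m ∷ μ) t h e (l ∷ _) =
      trans (cong (λ b → (b ∧ increasing (take m t)) ∧ tabOK (colsOK (take m t)) μ (drop m t)) (trans (cols-above r (take m t) (take⁺ m h) (subst (_≤ suc (length r)) (sym lm) l)) (cong (λ k → (k <ᵇ suc (length r)) ∧ colsOK r (take m t)) lm)))
        (trans (cong (_∧ _) (∧-assoc (m <ᵇ suc (length r)) _ _)) (∧-assoc (m <ᵇ suc (length r)) _ _))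
      where
      lm : length (take m t) ≡ m
      lm = proj₂ (split-at m t (subst (m ≤_) (sym e) (ℕₚ.m≤m+n m (sum μ))))

    ins-split : ∀ r t f → Below r → (∀ r₁ y r₂ → y < N → r ≡ r₁ ++ y ∷ r₂ → f (r₁ ++ N ∷ y ∷ r₂ ++ t) ≡ + 0) →
      insSum N f (r ++ t) ≡ insSum N (f ∘ (r ++_)) t
    ins-split []      t f _        h = refl
    ins-split (y ∷ r) t f (b ∷ bs) h = trans (cong₂ _+ᶻ_ (h [] y r b refl) (ins-split r t (f ∘ (y ∷_)) bs (λ r₁ z r₂ lz e → h (y ∷ r₁) z r₂ lz (cong (y ∷_) e)))) (ℤₚ.+-identityˡ _)

    -- Only this property of the sign is used in the induction, because it is inherited by
    -- `σ ∘ (r ++_)` when a completed row `r` is split off.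
    SignRule : (List ℕ → ℤ) → Set
    SignRule σ = ∀ u t → Below u → Below t → σ (u ++ N ∷ t) ≡ signOf (length t) *ᶻ σ (u ++ t)

    -- The largest letter can only be inserted at the end of a row, and the column condition holds exactly when the next row is shorter.
    insSum-tabOK : ∀ P σ r μ t → Below r → Below t → length t ≡ sum μ → Desc (suc (length r)) μ → SignRule σ → P (r ++ N ∷ []) ≡ P r →
      insSum N (λ w → when (tabOK P (suc (length r) ∷ μ) w) (σ w)) (r ++ t) ≡ cornerSum (λ ν → when (tabOK P ν (r ++ t)) (σ (r ++ t))) (suc (length r) ∷ μ)
    insSum-tabOK P σ r μ t hr ht e d hσ hP = trans (ins-split r t f hr inner) (trans (first t) (cong₂ _+ᶻ_ corner (later μ t ht e d)))
      where
      f = λ w → when (tabOK P (suc (length r) ∷ μ) w) (σ w)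
      -- The positions beyond the first row: the letter `y` completes that row, and the new letter
      -- falls into a later one.
      rest : Shape → List ℕ → ℤ
      rest μ []      = + 0
      rest μ (y ∷ t) = insSum N (λ u → when (tabOK P (suc (length r) ∷ μ) (r ++ y ∷ u)) (σ (r ++ y ∷ u))) t
      first : ∀ t → insSum N (f ∘ (r ++_)) t ≡ f (r ++ N ∷ t) +ᶻ rest μ t
      first []      = sym (ℤₚ.+-identityʳ _)
      first (y ∷ t) = refl
      snoc-len : ∀ (r : List ℕ) y → length (r ++ y ∷ []) ≡ suc (length r)
      snoc-len r y = trans (length-++ r) (ℕₚ.+-comm (length r) 1)
      tabS : ∀ P r y ν t → tabOK P (suc (length r) ∷ ν) (r ++ y ∷ t) ≡ (P (r ++ y ∷ []) ∧ increasing (r ++ y ∷ [])) ∧ tabOK (colsOK (r ++ y ∷ [])) ν t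
      tabS P r y ν t = trans (cong₂ (λ k w → tabOK P (k ∷ ν) w) (sym (snoc-len r y)) (sym (++-assoc r (y ∷ []) t))) (tabOK-++ P (r ++ y ∷ []) ν t)
      inner : ∀ r₁ y r₂ → y < N → r ≡ r₁ ++ y ∷ r₂ → f (r₁ ++ N ∷ y ∷ r₂ ++ t) ≡ + 0
      inner r₁ y r₂ ly refl = cong (λ b → when b (σ (r₁ ++ N ∷ y ∷ r₂ ++ t)))
        (trans (cong₂ (λ k w → tabOK P (k ∷ μ) w) (trans (cong suc (length-++ r₁)) (trans (sym (ℕₚ.+-suc (length r₁) _)) (sym (length-++ r₁ {N ∷ y ∷ r₂})))) (sym (++-assoc r₁ (N ∷ y ∷ r₂) t)))
          (trans (tabOK-++ P (r₁ ++ N ∷ y ∷ r₂) μ t) (cong (_∧ tabOK (colsOK (r₁ ++ N ∷ y ∷ r₂)) μ t) (trans (cong (P (r₁ ++ N ∷ y ∷ r₂) ∧_) (inc-false r₁ y r₂ ly)) (∧-comm (P (r₁ ++ N ∷ y ∷ r₂)) false)))))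
      gate : ∀ A c B s z → when (A ∧ (c ∧ B)) (s *ᶻ z) ≡ when c s *ᶻ when (A ∧ B) z
      gate true  true  true  s z = refl
      gate true  true  false s z = sym (ℤₚ.*-zeroʳ s)
      gate true  false B     s z = sym (ℤₚ.*-zeroˡ (when B z))
      gate false true  B     s z = sym (ℤₚ.*-zeroʳ s)
      gate false false B     s z = refl
      corner : f (r ++ N ∷ t) ≡ coef (suc (length r)) μ *ᶻ when (tabOK P (length r ∷ μ) (r ++ t)) (σ (r ++ t))
      corner = trans (cong₂ when
          (trans (tabS P r N μ t) (cong₂ _∧_ (cong₂ _∧_ hP (inc-snoc r hr)) (tabOK-cols r μ t ht e d)))
          (trans (hσ r t hr ht) (cong (λ n → signOf n *ᶻ σ (r ++ t)) e)))
        (trans (gate (P r ∧ increasing r) (row μ 0 <ᵇ suc (length r)) (tabOK (colsOK r) μ t) (signOf (sum μ)) (σ (r ++ t)))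
          (cong (λ b → coef (suc (length r)) μ *ᶻ when b (σ (r ++ t))) (sym (tabOK-++ P r μ t))))
      later : ∀ μ t → Below t → length t ≡ sum μ → Desc (suc (length r)) μ →
        rest μ t ≡ cornerSum (λ ν → when (tabOK P (suc (length r) ∷ ν) (r ++ t)) (σ (r ++ t))) μ
      later μ            []      ht        e d       = sym (cornerSum-empty _ μ (sym e))
      later []           (y ∷ t) ht        () d
      later (zero ∷ μ)   (y ∷ t) ht        e (l ∷ d) with trans e (Desc-0 d)
      ... | ()
      later (suc j ∷ μ)  (y ∷ t) (hy ∷ ht) e (l ∷ d) = begin
        insSum N (λ u → when (tabOK P (suc (length r) ∷ suc j ∷ μ) (r ++ y ∷ u)) (σ (r ++ y ∷ u))) t
          ≡⟨ insSum-cong N (λ u → cong₂ when (tabS P r y (suc j ∷ μ) u) (cong σ (sym (++-assoc r (y ∷ []) u)))) t ⟩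
        insSum N (λ u → when (A ∧ tabOK (colsOK r′) (suc j ∷ μ) u) (σ (r′ ++ u))) t
          ≡⟨ go A ⟩
        cornerSum (λ ν → when (A ∧ tabOK (colsOK r′) ν t) (σ (r′ ++ t))) (suc j ∷ μ)
          ≡⟨ cornerSum-cong (λ ν → cong₂ when (sym (tabS P r y ν t)) (cong σ (++-assoc r (y ∷ []) t))) (suc j ∷ μ) ⟩
        cornerSum (λ ν → when (tabOK P (suc (length r) ∷ ν) (r ++ y ∷ t)) (σ (r ++ y ∷ t))) (suc j ∷ μ) ∎
        where
        open ≡-Reasoning
        r′ = r ++ y ∷ []
        A = P r′ ∧ increasing r′
        hr′ : Below r′
        hr′ = ++⁺ hr (hy ∷ [])
        e′ : length t ≡ j + sum μ
        e′ = ℕₚ.suc-injective e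
        sp = split-at j t (subst (j ≤_) (sym e′) (ℕₚ.m≤m+n j (sum μ)))
        -- The first row is now complete as `r′`, so the next row inherits the column condition
        -- `colsOK r′` as its `P` and the prefixed sign as its `σ`.
        IH : ∀ j t r₂ t₂ → t ≡ r₂ ++ t₂ → length r₂ ≡ j → Below r₂ → Below t₂ → length t ≡ j + sum μ → suc j ≤ suc (length r) → Desc (suc j) μ →
          insSum N (λ u → when (tabOK (colsOK r′) (suc j ∷ μ) u) (σ (r′ ++ u))) t ≡ cornerSum (λ ν → when (tabOK (colsOK r′) ν t) (σ (r′ ++ t))) (suc j ∷ μ)
        IH j t r₂ t₂ refl refl h₂ h₃ e₂ l d = insSum-tabOK (colsOK r′) (σ ∘ (r′ ++_)) r₂ μ t₂ h₂ h₃ (ℕₚ.+-cancelˡ-≡ (length r₂) _ _ (trans (sym (length-++ r₂)) e₂)) d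
          (λ u t hu ht → trans (cong σ (sym (++-assoc r′ u (N ∷ t)))) (trans (hσ (r′ ++ u) t (++⁺ hr′ hu) ht) (cong (λ w → signOf (length t) *ᶻ σ w) (++-assoc r′ u t))))
          (cols-below r′ r₂ hr′ (subst (length r₂ <_) (sym (snoc-len r y)) l))
        go : ∀ A → insSum N (λ u → when (A ∧ tabOK (colsOK r′) (suc j ∷ μ) u) (σ (r′ ++ u))) t ≡ cornerSum (λ ν → when (A ∧ tabOK (colsOK r′) ν t) (σ (r′ ++ t))) (suc j ∷ μ)
        go false = trans (insSum-0 N t) (sym (cornerSum-0 (suc j ∷ μ)))
        go true  = IH j t (take j t) (drop j t) (proj₁ sp) (proj₂ sp) (take⁺ j ht) (drop⁺ j ht) e′ l d

    filter-insert : ∀ x u t → x < N → filter (_<? x) (u ++ N ∷ t) ≡ filter (_<? x) (u ++ t)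
    filter-insert x u t h = trans (filter-++ (_<? x) u (N ∷ t)) (trans (cong (filter (_<? x) u ++_) (filter-reject (_<? x) (ℕₚ.<-asym h))) (sym (filter-++ (_<? x) u t)))

    inversions-insert : ∀ u t → Below u → Below t → inversions (u ++ N ∷ t) ≡ length t + inversions (u ++ t)
    inversions-insert [] t hu ht = cong (λ w → length w + inversions t) (filter-all (_<? N) ht)
    inversions-insert (x ∷ u) t (hx ∷ hu) ht = trans (cong₂ (λ a b → length a + b) (filter-insert x u t hx) (inversions-insert u t hu ht)) (r (length (filter (_<? x) (u ++ t))) (length t) (inversions (u ++ t)))
      where
      r : ∀ a b c → a + (b + c) ≡ b + (a + c)
      r = ℕsolve-∀

    sgn-rule : SignRule sgn
    sgn-rule u t hu ht = trans (cong signOf (inversions-insert u t hu ht)) (signOf-+ (length t) (inversions (u ++ t)))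

  letters : ℕ → List ℕ
  letters n = map suc (upTo n)

  letters-suc : ∀ n → letters (suc n) ≡ letters n ∷ʳ suc n
  letters-suc n = trans (cong (map suc) (sym (upTo-∷ʳ n))) (map-++ suc (upTo n) (n ∷ []))

  letters-below : ∀ n → All (_< suc n) (letters n)
  letters-below zero    = []
  letters-below (suc n) = subst (All (_< suc (suc n))) (sym (letters-suc n)) (++⁺ (All.map ℕₚ.m<n⇒m<1+n (letters-below n)) (ℕₚ.n<1+n (suc n) ∷ []))

  signedCount : ℕ → Shape → ℤ
  signedCount n μ = permSum (λ w → when (tabOK (λ _ → true) μ w) (sgn w)) (letters n)

  signImbalance-signedCount : ∀ μ → signImbalance μ ≡ signedCount (sum μ) μ
  signImbalance-signedCount μ = trans (sum-perms _ (letters (sum μ))) (permSum-cong (λ w → cong (λ b → when b (sgn w)) (isSYT-tabOK μ w)) (letters (sum μ)))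

  permSum-cornerSum : ∀ (g : Shape → List ℕ → ℤ) μ xs → permSum (λ w → cornerSum (λ ν → g ν w) μ) xs ≡ cornerSum (λ ν → permSum (g ν) xs) μ
  permSum-cornerSum g []      xs = permSum-0 xs
  permSum-cornerSum g (a ∷ μ) xs = trans (permSum-+ (λ w → coef a μ *ᶻ g ((a ∸ 1) ∷ μ) w) (λ w → cornerSum (λ ν → g (a ∷ ν) w) μ) xs)
    (cong₂ _+ᶻ_ (permSum-* (coef a μ) _ xs) (permSum-cornerSum (g ∘ (a ∷_)) μ xs))

  -- The largest entry of a standard tableau occupies a corner; `insSum-tabOK` is summed over all
  -- words in the smaller letters.
  signedCount-suc : ∀ n {W} μ → Desc W μ → sum μ ≡ suc n → signedCount (suc n) μ ≡ cornerSum (signedCount n) μ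
  signedCount-suc n μ d e = begin
    permSum f (letters (suc n))             ≡⟨ cong (permSum f) (letters-suc n) ⟩
    permSum f (letters n ∷ʳ suc n)          ≡⟨ permSum-∷ʳ f (letters n) (suc n) ⟩
    permSum (insSum (suc n) f) (letters n)  ≡⟨ permSum-P (_< suc n) (letters n) (letters-below n) (λ w hw lw → step μ d e w hw (trans lw (trans (length-map suc (upTo n)) (length-upTo n)))) ⟩
    permSum (λ w → cornerSum (λ ν → g ν w) μ) (letters n) ≡⟨ permSum-cornerSum g μ (letters n) ⟩
    cornerSum (signedCount n) μ                           ∎
    where
    open ≡-Reasoning
    open Insert (suc n)
    g : Shape → List ℕ → ℤ
    g ν w = when (tabOK (λ _ → true) ν w) (sgn w)
    f = g μ
    step : ∀ {W} μ → Desc W μ → sum μ ≡ suc n → ∀ w → Below w → length w ≡ n → insSum (suc n) (g μ) w ≡ cornerSum (λ ν → g ν w) μ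
    step (zero ∷ μ) (_ ∷ d) e w hw lw with trans (sym (Desc-0 d)) e
    ... | ()
    step (suc j ∷ μ) (_ ∷ d) e w hw lw = go j w (take j w) (drop j w) (proj₁ sp) (proj₂ sp) (take⁺ j hw) (drop⁺ j hw) lw′ d
      where
      lw′ : length w ≡ j + sum μ
      lw′ = trans lw (sym (ℕₚ.suc-injective e))
      sp = split-at j w (subst (j ≤_) (sym lw′) (ℕₚ.m≤m+n j (sum μ)))
      go : ∀ j w r t → w ≡ r ++ t → length r ≡ j → Below r → Below t → length w ≡ j + sum μ → Desc (suc j) μ → insSum (suc n) (g (suc j ∷ μ)) w ≡ cornerSum (λ ν → g ν w) (suc j ∷ μ)
      go j w r t refl refl hr ht lw d = insSum-tabOK (λ _ → true) sgn r μ t hr ht (ℕₚ.+-cancelˡ-≡ (length r) _ _ (trans (sym (length-++ r)) lw)) d sgn-rule refl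

  tabOK-zeros : ∀ P k w → P [] ≡ true → tabOK P (replicate k 0) w ≡ true
  tabOK-zeros P zero    w h = refl
  tabOK-zeros P (suc k) w h = trans (cong (λ b → (b ∧ true) ∧ tabOK (colsOK []) (replicate k 0) w) h) (tabOK-zeros (colsOK []) k w refl)

  signedCount-pad : ∀ n μ k → signedCount n (μ ++ replicate k 0) ≡ signedCount n μ
  signedCount-pad n μ k = permSum-cong (λ w → cong (λ b → when b (sgn w)) (go (λ _ → true) μ w refl)) (letters n)
    where
    go : ∀ P μ w → P [] ≡ true → tabOK P (μ ++ replicate k 0) w ≡ tabOK P μ w
    go P []      w h = tabOK-zeros P k w h
    go P (m ∷ μ) w h = cong ((P (take m w) ∧ increasing (take m w)) ∧_) (go (colsOK (take m w)) μ (drop m w) refl)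

-- Removal of cells as the transpose of addition; sign-imbalance from the empty shape.

module CellRemoval where

  open BitWords
  open Tableaux

  rows : Bits → Shape
  rows []          = []
  rows (true ∷ w)  = zeros w ∷ rows w
  rows (false ∷ w) = rows w

  sum-rows : ∀ w → sum (rows w) ≡ cells w
  sum-rows []          = refl
  sum-rows (true ∷ w)  = cong (zeros w ℕ.+_) (sum-rows w)
  sum-rows (false ∷ w) = sum-rows w

  length-rows : ∀ w → length (rows w) ≡ ones w
  length-rows []          = refl
  length-rows (true ∷ w)  = cong suc (length-rows w)
  length-rows (false ∷ w) = length-rows w

  Desc-≤ : ∀ {W V μ} → W ≤ V → Desc W μ → Desc V μ
  Desc-≤ l []      = []
  Desc-≤ l (h ∷ d) = ℕₚ.≤-trans h l ∷ d

  Desc-rows : ∀ w → Desc (zeros w) (rows w)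
  Desc-rows []          = []
  Desc-rows (true ∷ w)  = ℕₚ.≤-refl ∷ Desc-rows w
  Desc-rows (false ∷ w) = Desc-≤ (ℕₚ.n≤1+n _) (Desc-rows w)

  Desc-head : ∀ {W μ} → Desc W μ → row μ 0 ≤ W
  Desc-head []      = z≤n
  Desc-head (h ∷ _) = h

  backHop : (Bits → ℤ) → Bits → ℤ
  backHop φ (false ∷ s) = signOf (cells s) *ᶻ φ (false ∷ true ∷ s)
  backHop φ _           = + 0

  removeCell : (Bits → ℤ) → Bits → ℤ
  removeCell φ []          = + 0
  removeCell φ (true ∷ s)  = backHop φ s +ᶻ removeCell (φ ∘ (true ∷_)) s
  removeCell φ (false ∷ s) = removeCell (φ ∘ (false ∷_)) s

  removeCell-congP : ∀ f g w → (∀ pre t → w ≡ pre ++ true ∷ false ∷ t → f (pre ++ false ∷ true ∷ t) ≡ g (pre ++ false ∷ true ∷ t)) → removeCell f w ≡ removeCell g w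
  removeCell-congP f g []          h = refl
  removeCell-congP f g (false ∷ w) h = removeCell-congP _ _ w (λ pre t e → h (false ∷ pre) t (cong (false ∷_) e))
  removeCell-congP f g (true ∷ w)  h = cong₂ _+ᶻ_ (hh w h) (removeCell-congP _ _ w (λ pre t e → h (true ∷ pre) t (cong (true ∷_) e)))
    where
    hh : ∀ w → (∀ pre t → true ∷ w ≡ pre ++ true ∷ false ∷ t → f (pre ++ false ∷ true ∷ t) ≡ g (pre ++ false ∷ true ∷ t)) → backHop f w ≡ backHop g w
    hh []          h = refl
    hh (true ∷ w)  h = refl
    hh (false ∷ w) h = cong (signOf (cells w) *ᶻ_) (h [] w refl)

  removeCell-0 : ∀ w → removeCell (λ _ → + 0) w ≡ + 0
  removeCell-0 []                = refl
  removeCell-0 (false ∷ w)       = removeCell-0 w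
  removeCell-0 (true ∷ [])       = refl
  removeCell-0 (true ∷ true ∷ w) = trans (ℤₚ.+-identityˡ _) (removeCell-0 (true ∷ w))
  removeCell-0 (true ∷ false ∷ w) = trans (cong₂ _+ᶻ_ (ℤₚ.*-zeroʳ (signOf (cells w))) (removeCell-0 w)) refl

  δ : Bits → Bits → ℤ
  δ []          []          = + 1
  δ (true ∷ w)  (true ∷ u)  = δ w u
  δ (false ∷ w) (false ∷ u) = δ w u
  δ _           _           = + 0

  δ-refl : ∀ w → δ w w ≡ + 1
  δ-refl []          = refl
  δ-refl (true ∷ w)  = δ-refl w
  δ-refl (false ∷ w) = δ-refl w

  -- A hop from `u` to `w` and the reverse hop from `w` to `u` share the suffix, hence the sign: the
  -- two operators are transposes.
  addCell-δ : ∀ w u → addCell (δ w) u ≡ removeCell (λ v → δ v u) w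
  addCell-δ [] u = trans (addCell-congP (δ []) (λ _ → + 0) u (λ pre t _ → h pre)) (addCell-0 _ (λ _ → refl) u)
    where
    h : ∀ pre {b t} → δ [] (pre ++ b ∷ t) ≡ + 0
    h []      = refl
    h (_ ∷ _) = refl
  addCell-δ (b ∷ w) [] = sym (trans (removeCell-congP (λ v → δ v []) (λ _ → + 0) (b ∷ w) (λ pre t _ → h pre)) (removeCell-0 (b ∷ w)))
    where
    h : ∀ pre {t} → δ (pre ++ false ∷ t) [] ≡ + 0
    h []          = refl
    h (true ∷ _)  = refl
    h (false ∷ _) = refl
  addCell-δ (true ∷ w) (true ∷ u) = trans (addCell-δ w u) (sym (trans (cong (_+ᶻ removeCell (λ v → δ v u) w) (h w)) (ℤₚ.+-identityˡ _)))
    where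
    h : ∀ w → backHop (λ v → δ v (true ∷ u)) w ≡ + 0
    h []          = refl
    h (true ∷ w)  = refl
    h (false ∷ w) = ℤₚ.*-zeroʳ (signOf (cells w))
  addCell-δ (false ∷ w) (true ∷ u) = trans (addCell-0 _ (λ _ → refl) u) (sym (removeCell-0 w))
  addCell-δ (false ∷ w) (false ∷ u) = trans (cong (_+ᶻ addCell (δ w) u) (h u)) (trans (ℤₚ.+-identityˡ _) (addCell-δ w u))
    where
    h : ∀ u → cellHop (δ (false ∷ w)) u ≡ + 0
    h []          = refl
    h (false ∷ u) = refl
    h (true ∷ u)  = ℤₚ.*-zeroʳ (signOf (cells u))
  addCell-δ (true ∷ w) (false ∷ u) = cong₂ _+ᶻ_ (h u w) (trans (addCell-0 _ (λ _ → refl) u) (sym (removeCell-0 w)))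
    where
    -- The signs on the two sides are taken from different suffixes; they need to agree only where
    -- `δ` is nonzero, that is, where the suffixes coincide.
    sg : ∀ w u → ∀ a b → (w ≡ u → a ≡ b) → a *ᶻ δ w u ≡ b *ᶻ δ w u
    sg [] [] a b e = cong (_*ᶻ + 1) (e refl)
    sg (true ∷ w) (true ∷ u) a b e = sg w u a b (λ p → e (cong (true ∷_) p))
    sg (false ∷ w) (false ∷ u) a b e = sg w u a b (λ p → e (cong (false ∷_) p))
    sg [] (_ ∷ _) a b e = trans (ℤₚ.*-zeroʳ a) (sym (ℤₚ.*-zeroʳ b))
    sg (true ∷ _) [] a b e = trans (ℤₚ.*-zeroʳ a) (sym (ℤₚ.*-zeroʳ b))
    sg (false ∷ _) [] a b e = trans (ℤₚ.*-zeroʳ a) (sym (ℤₚ.*-zeroʳ b))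
    sg (true ∷ _) (false ∷ _) a b e = trans (ℤₚ.*-zeroʳ a) (sym (ℤₚ.*-zeroʳ b))
    sg (false ∷ _) (true ∷ _) a b e = trans (ℤₚ.*-zeroʳ a) (sym (ℤₚ.*-zeroʳ b))
    h : ∀ u w → cellHop (δ (true ∷ w)) u ≡ backHop (λ v → δ v (false ∷ u)) w
    h [] []          = refl
    h [] (true ∷ w)  = refl
    h [] (false ∷ w) = sym (ℤₚ.*-zeroʳ (signOf (cells w)))
    h (false ∷ u) []          = refl
    h (false ∷ u) (true ∷ w)  = refl
    h (false ∷ u) (false ∷ w) = sym (ℤₚ.*-zeroʳ (signOf (cells w)))
    h (true ∷ u) []          = ℤₚ.*-zeroʳ (signOf (cells u))
    h (true ∷ u) (true ∷ w)  = ℤₚ.*-zeroʳ (signOf (cells u))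
    h (true ∷ u) (false ∷ w) = sg w u (signOf (cells u)) (signOf (cells w)) (λ e → cong (λ y → signOf (cells y)) (sym e))

  addCells-removeCell : ∀ n (g : Bits → Bits → ℤ) w w₀ → addCells n (λ u → removeCell (λ v → g v u) w) w₀ ≡ removeCell (λ v → addCells n (g v) w₀) w
  addCells-removeCell n g []          w₀ = addCells-0 n _ (λ _ → refl) w₀
  addCells-removeCell n g (false ∷ w) w₀ = addCells-removeCell n (g ∘ (false ∷_)) w w₀
  addCells-removeCell n g (true ∷ w)  w₀ = trans (addCells-+ n (λ u → backHop (λ v → g v u) w) _ w₀) (cong₂ _+ᶻ_ (h w) (addCells-removeCell n (g ∘ (true ∷_)) w w₀))
    where
    h : ∀ w → addCells n (λ u → backHop (λ v → g v u) w) w₀ ≡ backHop (λ v → addCells n (g v) w₀) w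
    h []          = addCells-0 n _ (λ _ → refl) w₀
    h (true ∷ w)  = addCells-0 n _ (λ _ → refl) w₀
    h (false ∷ w) = addCells-* n (signOf (cells w)) _ w₀

  -- A row loses its last cell exactly where its letter 1 is followed by 0, that is, where the next
  -- row is shorter.
  removeCell-rows : ∀ G w → removeCell (G ∘ rows) w ≡ cornerSum G (rows w)
  removeCell-rows G []          = refl
  removeCell-rows G (false ∷ w) = removeCell-rows G w
  removeCell-rows G (true ∷ w)  = cong₂ _+ᶻ_ (h w) (trans (removeCell-congP _ _ w (λ { pre t refl → cong (λ z → G (z ∷ rows (pre ++ false ∷ true ∷ t))) (sym (zeros-hop pre t)) })) (removeCell-rows (G ∘ (zeros w ∷_)) w))
    where
    h : ∀ w → backHop (G ∘ rows) w ≡ coef (zeros w) (rows w) *ᶻ G ((zeros w ∸ 1) ∷ rows w)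
    h []          = sym (ℤₚ.*-zeroˡ (G (0 ∷ [])))
    h (true ∷ w)  = sym (trans (cong (λ b → when b (signOf (sum (zeros w ∷ rows w))) *ᶻ G ((zeros w ∸ 1) ∷ zeros w ∷ rows w)) (<ᵇ-false {zeros w} ℕₚ.≤-refl)) (ℤₚ.*-zeroˡ (G ((zeros w ∸ 1) ∷ zeros w ∷ rows w))))
    h (false ∷ w) = sym (cong₂ (λ b s → when b (signOf s) *ᶻ G (zeros w ∷ rows w)) (<ᵇ-true (s≤s (Desc-head (Desc-rows w)))) (sum-rows w))

  emptyWord : ℕ → ℕ → Bits
  emptyWord B W = replicate W false ++ replicate B true

  rows-empty : ∀ B W → rows (emptyWord B W) ≡ replicate B 0
  rows-empty B (suc W) = rows-empty B W
  rows-empty zero zero = refl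
  rows-empty (suc B) zero = cong₂ _∷_ (z B) (rows-empty B zero)
    where
    z : ∀ B → zeros (replicate B true) ≡ 0
    z zero = refl
    z (suc B) = z B

  cells-0 : ∀ w → cells w ≡ 0 → w ≡ emptyWord (ones w) (zeros w)
  cells-0 []          e = refl
  cells-0 (false ∷ w) e = cong (false ∷_) (cells-0 w e)
  cells-0 (true ∷ w)  e = trans (cong (true ∷_) (trans (cells-0 w (ℕₚ.m+n≡0⇒n≡0 (zeros w) e)) (cong (emptyWord (ones w)) z0))) (cong (emptyWord (suc (ones w))) (sym z0))
    where
    z0 : zeros w ≡ 0
    z0 = ℕₚ.m+n≡0⇒m≡0 (zeros w) e

  -- Transposition turns additions to the empty word into removals from `w`, which obey the
  -- recursion `signedCount-suc`.
  addCells-δ : ∀ B W n w → Class B W n w → addCells n (δ w) (emptyWord B W) ≡ signedCount n (rows w)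
  addCells-δ B W zero w (cls a b c) with cells-0 w c
  ... | e rewrite a | b = trans (cong (λ u → δ u (emptyWord B W)) e) (trans (δ-refl (emptyWord B W)) (sym (trans (cong (signedCount 0) (trans (cong rows e) (rows-empty B W))) (cong (λ b → when b (+ 1)) (tabOK-zeros (λ _ → true) B [] refl)))))
  addCells-δ B W (suc n) w (cls a b c) = begin
    addCells n (addCell (δ w)) w₀                 ≡⟨ addCells-cong n _ _ (addCell-δ w) w₀ ⟩
    addCells n (λ u → removeCell (λ v → δ v u) w) w₀  ≡⟨ addCells-removeCell n δ w w₀ ⟩
    removeCell (λ v → addCells n (δ v) w₀) w          ≡⟨ removeCell-congP _ _ w (λ { pre t refl → addCells-δ B W n (pre ++ false ∷ true ∷ t) (cls (trans (sym (ones-hop pre t)) a) (trans (sym (zeros-hop pre t)) b) (ℕₚ.suc-injective (trans (sym (cells-hop pre t)) c))) }) ⟩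
    removeCell (signedCount n ∘ rows) w                      ≡⟨ removeCell-rows (signedCount n) w ⟩
    cornerSum (signedCount n) (rows w)                      ≡⟨ sym (signedCount-suc n (rows w) (Desc-rows w) (trans (sum-rows w) c)) ⟩
    signedCount (suc n) (rows w)                       ∎
    where
    open ≡-Reasoning
    w₀ = emptyWord B W

-- Coefficients of integer polynomials from their values.

module Extraction where

  open BitWords
  open Tableaux using (when)

  lin : ∀ {A : Set} → (A → ℤ) → List (ℤ × A) → ℤ
  lin f []            = + 0
  lin f ((c , a) ∷ l) = c *ᶻ f a +ᶻ lin f l

  lin-cong : ∀ {A : Set} {f g : A → ℤ} → (∀ a → f a ≡ g a) → ∀ l → lin f l ≡ lin g l
  lin-cong h []            = refl
  lin-cong h ((c , a) ∷ l) = cong₂ (λ y z → c *ᶻ y +ᶻ z) (h a) (lin-cong h l)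

  lin-+ : ∀ {A : Set} (f g : A → ℤ) l → lin (λ a → f a +ᶻ g a) l ≡ lin f l +ᶻ lin g l
  lin-+ f g []            = refl
  lin-+ f g ((c , a) ∷ l) = trans (cong (c *ᶻ (f a +ᶻ g a) +ᶻ_) (lin-+ f g l)) (r c (f a) (g a) (lin f l) (lin g l))
    where
    r : ∀ c a b x y → c *ᶻ (a +ᶻ b) +ᶻ (x +ᶻ y) ≡ (c *ᶻ a +ᶻ x) +ᶻ (c *ᶻ b +ᶻ y)
    r = solve-∀

  lin-* : ∀ {A : Set} k (f : A → ℤ) l → lin (λ a → k *ᶻ f a) l ≡ k *ᶻ lin f l
  lin-* k f []            = sym (ℤₚ.*-zeroʳ k)
  lin-* k f ((c , a) ∷ l) = trans (cong (c *ᶻ (k *ᶻ f a) +ᶻ_) (lin-* k f l)) (r c k (f a) (lin f l))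
    where
    r : ∀ c k a x → c *ᶻ (k *ᶻ a) +ᶻ k *ᶻ x ≡ k *ᶻ (c *ᶻ a +ᶻ x)
    r = solve-∀

  lin-++ : ∀ {A : Set} (f : A → ℤ) l m → lin f (l ++ m) ≡ lin f l +ᶻ lin f m
  lin-++ f []            m = sym (ℤₚ.+-identityˡ _)
  lin-++ f ((c , a) ∷ l) m = trans (cong (c *ᶻ f a +ᶻ_) (lin-++ f l m)) (sym (ℤₚ.+-assoc (c *ᶻ f a) _ _))

  -- The points and coefficients do not depend on `f`. The parameters q and x, which enter through
  -- `f` alone, can therefore be varied against one fixed linear form.
  addCell-lin : ∀ w → ∃[ l ] (∀ f → addCell f w ≡ lin f l)
  addCell-lin []          = [] , λ f → refl
  addCell-lin (b ∷ w) = go b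
    where
    l = proj₁ (addCell-lin w)
    cons : Bool → ℤ × Bits → ℤ × Bits
    cons b (c , u) = c , b ∷ u
    lin-cons : ∀ b f l → lin f (map (cons b) l) ≡ lin (f ∘ (b ∷_)) l
    lin-cons b f []            = refl
    lin-cons b f ((c , u) ∷ l) = cong (c *ᶻ f (b ∷ u) +ᶻ_) (lin-cons b f l)
    m : ∀ b f → addCell (f ∘ (b ∷_)) w ≡ lin f (map (cons b) l)
    m b f = trans (proj₂ (addCell-lin w) _) (sym (lin-cons b f l))
    hops : ∀ w → ∃[ l ] (∀ f → cellHop f w ≡ lin f l)
    hops []          = [] , λ f → refl
    hops (false ∷ w) = [] , λ f → refl
    hops (true ∷ w)  = (signOf (cells w) , true ∷ false ∷ w) ∷ [] , λ f → sym (ℤₚ.+-identityʳ _)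
    go : ∀ b → ∃[ l ] (∀ f → addCell f (b ∷ w) ≡ lin f l)
    go true  = map (cons true) l , m true
    go false = proj₁ (hops w) ++ map (cons false) l , λ f → trans (cong₂ _+ᶻ_ (proj₂ (hops w) f) (m false f)) (sym (lin-++ f (proj₁ (hops w)) _))

  lin-bind : ∀ (l : List (ℤ × Bits)) → ∃[ m ] (∀ f → lin (addCell f) l ≡ lin f m)
  lin-bind []            = [] , λ f → refl
  lin-bind ((c , w) ∷ l) = map sc (proj₁ (addCell-lin w)) ++ proj₁ (lin-bind l) ,
    λ f → trans (cong₂ _+ᶻ_ (trans (cong (c *ᶻ_) (proj₂ (addCell-lin w) f)) (h f (proj₁ (addCell-lin w)))) (proj₂ (lin-bind l) f)) (sym (lin-++ f (map sc (proj₁ (addCell-lin w))) _))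
    where
    sc : ℤ × Bits → ℤ × Bits
    sc (d , u) = c *ᶻ d , u
    r : ∀ c d a x → c *ᶻ (d *ᶻ a +ᶻ x) ≡ (c *ᶻ d) *ᶻ a +ᶻ c *ᶻ x
    r = solve-∀
    h : ∀ f m → c *ᶻ lin f m ≡ lin f (map sc m)
    h f []            = ℤₚ.*-zeroʳ c
    h f ((d , u) ∷ m) = trans (r c d (f u) (lin f m)) (cong ((c *ᶻ d) *ᶻ f u +ᶻ_) (h f m))

  addCells-lin : ∀ n w → ∃[ l ] (∀ f → addCells n f w ≡ lin f l)
  addCells-lin zero    w = (+ 1 , w) ∷ [] , λ f → sym (trans (ℤₚ.+-identityʳ _) (ℤₚ.*-identityˡ (f w)))
  addCells-lin (suc n) w with addCells-lin n w
  ... | l , e = proj₁ (lin-bind l) , λ f → trans (e (addCell f)) (proj₂ (lin-bind l) f)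

  eqz : ℕ → ℕ → ℤ
  eqz m n = when (m ≡ᵇ n) (+ 1)

  -- The choice m = |z| makes |z| + 1 a divisor of |z|.
  divisible-by-all : ∀ z (k : ℕ → ℤ) → (∀ m → z ≡ + suc m *ᶻ k m) → z ≡ + 0
  divisible-by-all z k h = ℤₚ.∣i∣≡0⇒i≡0 (zr (ℤ.∣ z ∣) (ℕ∣.divides (ℤ.∣ k ℤ.∣ z ∣ ∣) (trans (cong ℤ.∣_∣ (h ℤ.∣ z ∣)) (trans (ℤₚ.abs-* (+ suc ℤ.∣ z ∣) (k ℤ.∣ z ∣)) (ℕₚ.*-comm (suc ℤ.∣ z ∣) ℤ.∣ k ℤ.∣ z ∣ ∣)))))
    where
    zr : ∀ n → suc n ℕ∣.∣ n → n ≡ 0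
    zr zero d = refl
    zr (suc n) d with ℕ∣.∣⇒≤ d
    ... | ℕ.s≤s l = ⊥-elim (ℕₚ.1+n≰n l)

  -- The constant term of a polynomial vanishing at all positive integers is divisible by each of
  -- them, hence 0. Dividing by the argument lowers all exponents by one, and k rounds bring the
  -- coefficient of exponent k to the front.
  extract : ∀ {A : Set} (l : List (ℤ × A)) k (g : A → ℤ) (h : A → ℕ) → (∀ m → lin (λ a → g a *ᶻ (+ suc m) ^ h a) l ≡ + 0) →
    lin (λ a → g a *ᶻ eqz (h a) k) l ≡ + 0
  extract {A} l k g h H = go k
    where
    open ≡-Reasoning
    -- Drops the terms of exponent 0, on which `pred` does not lower the exponent.
    pos : ℕ → ℤ
    pos zero    = + 0
    pos (suc _) = + 1
    g′ : A → ℤ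
    g′ a = g a *ᶻ pos (h a)
    R : ℕ → ℤ
    R m = lin (λ a → g′ a *ᶻ (+ suc m) ^ ℕ.pred (h a)) l
    s1 : ∀ g y → g *ᶻ + 1 ≡ g *ᶻ + 1 +ᶻ y *ᶻ (g *ᶻ + 0 *ᶻ + 1)
    s1 = solve-∀
    s2 : ∀ g y z → g *ᶻ (y *ᶻ z) ≡ g *ᶻ + 0 +ᶻ y *ᶻ (g *ᶻ + 1 *ᶻ z)
    s2 = solve-∀
    sp : ∀ m g n → g *ᶻ (+ suc m) ^ n ≡ g *ᶻ eqz n 0 +ᶻ + suc m *ᶻ (g *ᶻ pos n *ᶻ (+ suc m) ^ ℕ.pred n)
    sp m g zero    = s1 g (+ suc m)
    sp m g (suc n) = s2 g (+ suc m) ((+ suc m) ^ n)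
    dec : ∀ m → + 0 ≡ lin (λ a → g a *ᶻ eqz (h a) 0) l +ᶻ + suc m *ᶻ R m
    dec m = trans (sym (H m)) (trans (lin-cong (λ a → sp m (g a) (h a)) l) (trans (lin-+ _ _ l) (cong (lin (λ a → g a *ᶻ eqz (h a) 0) l +ᶻ_) (lin-* (+ suc m) _ l))))
    neg : ∀ z y r → + 0 ≡ z +ᶻ y *ᶻ r → z ≡ y *ᶻ (-ᶻ r)
    neg z y r e = trans (t z y r) (trans (cong (_+ᶻ y *ᶻ (-ᶻ r)) (sym e)) (ℤₚ.+-identityˡ _))
      where
      t : ∀ z y r → z ≡ (z +ᶻ y *ᶻ r) +ᶻ y *ᶻ (-ᶻ r)
      t = solve-∀
    z0 : lin (λ a → g a *ᶻ eqz (h a) 0) l ≡ + 0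
    z0 = divisible-by-all _ (λ m → -ᶻ R m) (λ m → neg _ (+ suc m) (R m) (dec m))
    R0 : ∀ m → R m ≡ + 0
    R0 m with ℤₚ.i*j≡0⇒i≡0∨j≡0 (+ suc m) (trans (sym (trans (cong (_+ᶻ + suc m *ᶻ R m) z0) (ℤₚ.+-identityˡ _))) (sym (dec m)))
    ... | inj₂ e = e
    s : ∀ g n k → g *ᶻ eqz n (suc k) ≡ g *ᶻ pos n *ᶻ eqz (ℕ.pred n) k
    s g zero    k = trans (ℤₚ.*-zeroʳ g) (sym (trans (cong (_*ᶻ eqz 0 k) (ℤₚ.*-zeroʳ g)) (ℤₚ.*-zeroˡ (eqz 0 k))))
    s g (suc n) k = cong (_*ᶻ eqz n k) (sym (ℤₚ.*-identityʳ g))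
    go : ∀ k → lin (λ a → g a *ᶻ eqz (h a) k) l ≡ + 0
    go zero    = z0
    go (suc k) = trans (lin-cong (λ a → s (g a) (h a) k) l) (extract l k g′ (ℕ.pred ∘ h) R0)

  extract₂ : ∀ {A : Set} (l : List (ℤ × A)) (g : A → ℤ) (h v : A → ℕ) → (∀ m n → lin (λ a → g a *ᶻ ((+ suc m) ^ h a *ᶻ (+ suc n) ^ v a)) l ≡ + 0) →
    ∀ j k → lin (λ a → g a *ᶻ (eqz (h a) j *ᶻ eqz (v a) k)) l ≡ + 0
  extract₂ l g h v H j k = trans (lin-cong (λ a → sym (ℤₚ.*-assoc (g a) _ _)) l)
    (extract l k (λ a → g a *ᶻ eqz (h a) j) v (λ n → trans (lin-cong (λ a → r (g a) (eqz (h a) j) ((+ suc n) ^ v a)) l)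
      (extract l j (λ a → g a *ᶻ (+ suc n) ^ v a) h (λ m → trans (lin-cong (λ a → r′ (g a) ((+ suc n) ^ v a) ((+ suc m) ^ h a)) l) (H m n)))))
    where
    r : ∀ a b c → (a *ᶻ b) *ᶻ c ≡ (a *ᶻ c) *ᶻ b
    r = solve-∀
    r′ : ∀ a b c → (a *ᶻ b) *ᶻ c ≡ a *ᶻ (c *ᶻ b)
    r′ = solve-∀

-- Halves, parities, and the statistics of row pairs.

module Halving where

  open Extraction using (eqz)

  dbl : ℕ → ℕ
  dbl zero    = zero
  dbl (suc n) = suc (suc (dbl n))

  par : ℕ → ℕ
  par 0             = 0
  par 1             = 1
  par (suc (suc n)) = par n

  half-dbl : ∀ n → ⌊ dbl n /2⌋ ≡ n
  half-dbl zero    = refl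
  half-dbl (suc n) = cong suc (half-dbl n)

  half-sdbl : ∀ n → ⌊ suc (dbl n) /2⌋ ≡ n
  half-sdbl zero    = refl
  half-sdbl (suc n) = cong suc (half-sdbl n)

  par-dbl : ∀ n → par (dbl n) ≡ 0
  par-dbl zero    = refl
  par-dbl (suc n) = par-dbl n

  par-sdbl : ∀ n → par (suc (dbl n)) ≡ 1
  par-sdbl zero    = refl
  par-sdbl (suc n) = par-sdbl n

  half-≤ : ∀ b n → b ≤ suc (dbl n) → ⌊ b /2⌋ ≤ n
  half-≤ 0             n       h             = z≤n
  half-≤ 1             n       h             = z≤n
  half-≤ (suc (suc b)) (suc n) (s≤s (s≤s h)) = s≤s (half-≤ b n h)
  half-≤ (suc (suc b)) zero    (s≤s ())

  suc²-inj : ∀ {m n} → suc (suc m) ≡ suc (suc n) → m ≡ n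
  suc²-inj refl = refl

  ≡ᵇ-≡ : ∀ m n → (m ≡ᵇ n) ≡ true → m ≡ n
  ≡ᵇ-≡ zero    zero    e = refl
  ≡ᵇ-≡ (suc m) (suc n) e = cong suc (≡ᵇ-≡ m n e)

  ≡ᵇ-refl : ∀ n → (n ≡ᵇ n) ≡ true
  ≡ᵇ-refl zero    = refl
  ≡ᵇ-refl (suc n) = ≡ᵇ-refl n

  ≡ᵇ-> : ∀ {m n} → n ≤ m → (suc m ≡ᵇ n) ≡ false
  ≡ᵇ-> z≤n     = refl
  ≡ᵇ-> (s≤s h) = ≡ᵇ-> h

  ≤-ne : ∀ {k n} → k ≤ suc n → (k ≡ᵇ suc n) ≡ false → k ≤ n
  ≤-ne {zero}          h       e = z≤n
  ≤-ne {suc zero} {zero} h ()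
  ≤-ne {suc (suc k)} {zero} (s≤s ()) e
  ≤-ne {suc k} {suc n} (s≤s h) e = s≤s (≤-ne h e)

  matchZ : List ℕ → List ℕ → ℤ
  matchZ []       []           = + 1
  matchZ (k ∷ ks) (a ∷ b ∷ rs) = eqz k ⌊ b /2⌋ *ᶻ matchZ ks rs
  matchZ _        _            = + 0

  -- Rows are listed in pairs, so these are meant for lists of even length.
  hsRows vsRows : List ℕ → ℕ
  hsRows (a ∷ b ∷ rs) = (⌊ a /2⌋ ∸ ⌊ b /2⌋) + hsRows rs
  hsRows _            = 0
  vsRows (a ∷ b ∷ rs) = par b + vsRows rs
  vsRows _            = 0

-- Products of `lS0` and `lS2` as weights of shapes with a given body.

module Weights (q x : ℤ) where

  open Tables
  open Labels q x
  open BitWords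
  open Tableaux using (Desc; []; _∷_; when)
  open CellRemoval
  open Extraction using (eqz)
  open Halving

  -- The boundary word of the halved body, with row lengths `ks` in a box of K columns: `lS0` stands
  -- for a column of fourlings, `lS2` for a row.
  bodyLabels : ℕ → List ℕ → Labs 0
  bodyLabels zero    []       = []
  bodyLabels (suc K) []       = lS0 ∷ bodyLabels K []
  bodyLabels zero    (k ∷ ks) = lS2 ∷ bodyLabels zero ks
  bodyLabels (suc K) (k ∷ ks) = if k ≡ᵇ suc K then lS2 ∷ bodyLabels (suc K) ks else lS0 ∷ bodyLabels K (k ∷ ks)

  len-bodyLabels : ∀ K ks → len (bodyLabels K ks) ≡ K + length ks
  len-bodyLabels zero    []       = refl
  len-bodyLabels (suc K) []       = cong suc (len-bodyLabels K [])
  len-bodyLabels zero    (k ∷ ks) = cong suc (len-bodyLabels zero ks)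
  len-bodyLabels (suc K) (k ∷ ks) = go (k ≡ᵇ suc K) (len-bodyLabels (suc K) ks) (len-bodyLabels K (k ∷ ks))
    where
    go : ∀ b → len (bodyLabels (suc K) ks) ≡ suc K + length ks → len (bodyLabels K (k ∷ ks)) ≡ K + suc (length ks) →
      len (if b then lS2 ∷ bodyLabels (suc K) ks else lS0 ∷ bodyLabels K (k ∷ ks)) ≡ suc K + suc (length ks)
    go true  e₁ e₂ = trans (cong suc e₁) (cong suc (sym (ℕₚ.+-suc K (length ks))))
    go false e₁ e₂ = cong suc e₂

  -- The weight to be read outside a row pair; `ψ g` is the weight inside one, where g starts as the
  -- half length of its first row.
  φ : List ℕ → List ℕ → ℤ
  ψ : ℕ → ℕ → List ℕ → List ℕ → ℤ
  φ []       []       = + 1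
  φ (k ∷ ks) (a ∷ rs) = ψ ⌊ a /2⌋ k ks rs
  φ _        _        = + 0
  ψ g k ks []       = + 0
  ψ g k ks (b ∷ rs) = eqz k ⌊ b /2⌋ *ᶻ ((x ^ (g ∸ ⌊ b /2⌋) *ᶻ q ^ par b) *ᶻ φ ks rs)

  -- Two more columns between the ends of the two rows of a pair contain one of odd index, and its
  -- length is odd: one more factor x.
  ψ-up : ∀ g k ks rs → Desc (suc (dbl g)) rs → ψ (suc g) k ks rs ≡ x *ᶻ ψ g k ks rs
  ψ-up g k ks []       d       = sym (ℤₚ.*-zeroʳ x)
  ψ-up g k ks (b ∷ rs) (h ∷ _) = trans (cong (λ n → eqz k ⌊ b /2⌋ *ᶻ ((x ^ n *ᶻ q ^ par b) *ᶻ φ ks rs)) (ℕₚ.+-∸-assoc 1 (half-≤ b g h)))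
    (r (eqz k ⌊ b /2⌋) x (x ^ (g ∸ ⌊ b /2⌋)) (q ^ par b) (φ ks rs))
    where
    r : ∀ e x y q f → e *ᶻ ((x *ᶻ y *ᶻ q) *ᶻ f) ≡ x *ᶻ (e *ᶻ ((y *ᶻ q) *ᶻ f))
    r = solve-∀

  eqz-ne : ∀ m n → (m ≡ᵇ n) ≡ false → eqz m n ≡ + 0
  eqz-ne m n e = cong (λ b → when b (+ 1)) e

  ψ-ne : ∀ g k ks b rs n → ⌊ b /2⌋ ≡ n → (k ≡ᵇ n) ≡ false → ψ g k ks (b ∷ rs) ≡ + 0
  ψ-ne g k ks b rs .(⌊ b /2⌋) refl e = trans (cong (_*ᶻ y) (eqz-ne k ⌊ b /2⌋ e)) (ℤₚ.*-zeroˡ y)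
    where
    y = (x ^ (g ∸ ⌊ b /2⌋) *ᶻ q ^ par b) *ᶻ φ ks rs

  ψ-0 : ∀ g′ g ks rs → Desc (suc (dbl g)) rs → ψ g′ (suc g) ks rs ≡ + 0
  ψ-0 g′ g ks []       d       = refl
  ψ-0 g′ g ks (b ∷ rs) (h ∷ _) = ψ-ne g′ (suc g) ks b rs _ refl (≡ᵇ-> (half-≤ b g h))

  ψ-eq : ∀ g k ks b rs → ⌊ b /2⌋ ≡ k → g ≡ k → ψ g k ks (b ∷ rs) ≡ q ^ par b *ᶻ φ ks rs
  ψ-eq g .(⌊ b /2⌋) ks b rs refl refl = trans (cong₂ (λ e n → e *ᶻ ((x ^ n *ᶻ q ^ par b) *ᶻ φ ks rs)) (cong (λ b → when b (+ 1)) (≡ᵇ-refl ⌊ b /2⌋)) (ℕₚ.n∸n≡0 ⌊ b /2⌋)) (r (q ^ par b) (φ ks rs))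
    where
    r : ∀ q f → + 1 *ᶻ ((+ 1 *ᶻ q) *ᶻ f) ≡ q *ᶻ f
    r = solve-∀

  φ-0 : ∀ g ks rs → Desc (suc (dbl g)) rs → φ (suc g ∷ ks) rs ≡ + 0
  φ-0 g ks []       d       = refl
  φ-0 g ks (a ∷ rs) (h ∷ d) = ψ-0 ⌊ a /2⌋ g ks rs (Desc-≤ h d)

  Rows : List Site → Shape
  Rows w = rows (bitsOf w)

  Rows-Desc : ∀ w {n} → zeros (bitsOf w) ≡ n → Desc n (Rows w)
  Rows-Desc w refl = Desc-rows (bitsOf w)

  *-zero : ∀ v → + 0 ≡ v *ᶻ + 0
  *-zero v = sym (ℤₚ.*-zeroʳ v)

  -- Simultaneous induction along the word. The letters o and i give the state, encoded also by the
  -- parities of the remaining zeros and ones; a final 2 means that the next label is already known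
  -- to be `lS2`. Wherever a matrix entry is 0, the current row pair does not match the body.
  ev-o  : ∀ w K ks v → zeros (bitsOf w) ≡ dbl K → ones (bitsOf w) ≡ dbl (length ks) → Desc K ks → ev (bodyLabels K ks) o v w ≡ v *ᶻ φ ks (Rows w)
  ev-o2 : ∀ w K ks v → zeros (bitsOf w) ≡ dbl K → ones (bitsOf w) ≡ suc (suc (dbl (length ks))) → Desc K ks → ev (lS2 ∷ bodyLabels K ks) o v w ≡ v *ᶻ φ (K ∷ ks) (Rows w)
  ev-i  : ∀ w γ k ks v → zeros (bitsOf w) ≡ suc (dbl γ) → ones (bitsOf w) ≡ suc (dbl (length ks)) → k ≤ γ → Desc k ks → ev (bodyLabels γ (k ∷ ks)) i v w ≡ v *ᶻ ψ γ k ks (Rows w)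
  ev-i2 : ∀ w γ ks v → zeros (bitsOf w) ≡ suc (dbl γ) → ones (bitsOf w) ≡ suc (dbl (length ks)) → Desc γ ks → ev (lS2 ∷ bodyLabels γ ks) i v w ≡ v *ᶻ ψ γ γ ks (Rows w)

  ev-o []       zero    []       v z n d = sym (ℤₚ.*-identityʳ v)
  ev-o (s0 ∷ w) (suc K) []       v z n d = ev-o w K [] v (suc²-inj z) n []
  ev-o (su ∷ w) K       []       v z () d
  ev-o (sd ∷ w) K       []       v z () d
  ev-o (st ∷ w) K       []       v z () d
  ev-o w        zero    (.0 ∷ ks) v z n (z≤n ∷ d) = ev-o2 w zero ks v z n d
  ev-o w        (suc K) (k ∷ ks) v z n (h ∷ d) with k ≡ᵇ suc K in eq
  ev-o w        (suc K) (k ∷ ks) v z n (h ∷ d) | true with ≡ᵇ-≡ k (suc K) eq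
  ... | refl = ev-o2 w (suc K) ks v z n d
  ev-o (s0 ∷ w) (suc K) (k ∷ ks) v z n (h ∷ d) | false = ev-o w K (k ∷ ks) v (suc²-inj z) n (≤-ne h eq ∷ d)
  ev-o (sd ∷ w) (suc K) (k ∷ ks) v z n (h ∷ d) | false = trans (ev-i w K k ks v z′ (ℕₚ.suc-injective n) (≤-ne h eq) d) (cong (λ g → v *ᶻ ψ g k ks (Rows w)) (sym (trans (cong ⌊_/2⌋ z′) (half-sdbl K))))
    where
    z′ = ℕₚ.suc-injective z
  ev-o (su ∷ w) (suc K) (k ∷ ks) v z n (h ∷ d) | false = trans (ev-i w K k ks (x *ᶻ v) z′ (ℕₚ.suc-injective n) (≤-ne h eq) d)
    (trans (r x v (ψ K k ks (Rows w))) (cong (v *ᶻ_) (trans (sym (ψ-up K k ks (Rows w) (Rows-Desc w z′))) (cong (λ g → ψ g k ks (Rows w)) (sym (trans (cong ⌊_/2⌋ (cong suc z′)) (half-dbl (suc K))))))))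
    where
    z′ = ℕₚ.suc-injective z
    r : ∀ x v y → (x *ᶻ v) *ᶻ y ≡ v *ᶻ (x *ᶻ y)
    r = solve-∀
  -- Both rows of the pair have half length `suc K`, while the body demands the smaller `k`.
  ev-o (st ∷ w) (suc K) (k ∷ ks) v z n (h ∷ d) | false = trans (ev-𝟘 (bodyLabels K (k ∷ ks)) o w) (trans (*-zero v) (cong (v *ᶻ_) (sym (ψ-ne _ k ks (zeros (bitsOf w)) (Rows w) (suc K) (trans (cong ⌊_/2⌋ z) (half-dbl (suc K))) eq))))
  ev-o []       (suc K) (k ∷ ks) v () n (h ∷ d) | false

  ev-o2 (s0 ∷ w) (suc K) ks v z n d = trans (ev-𝟘 (bodyLabels (suc K) ks) o w) (trans (*-zero v) (cong (v *ᶻ_) (sym (φ-0 K ks (Rows w) (Desc-≤ (ℕₚ.n≤1+n _) (Rows-Desc w (suc²-inj z)))))))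
  ev-o2 (sd ∷ w) (suc K) ks v z n d = trans (ev-𝟘 (bodyLabels (suc K) ks) i w) (trans (*-zero v) (cong (v *ᶻ_) (sym (ψ-0 _ K ks (Rows w) (Rows-Desc w (ℕₚ.suc-injective z))))))
  ev-o2 (su ∷ w) (suc K) ks v z n d = trans (ev-𝟘 (bodyLabels (suc K) ks) i w) (trans (*-zero v) (cong (v *ᶻ_) (sym (ψ-0 _ K ks (Rows w) (Rows-Desc w (ℕₚ.suc-injective z))))))
  ev-o2 (st ∷ w) K ks v z n d = trans (ev-o w K ks v z (suc²-inj n) d) (cong (v *ᶻ_) (sym (trans (ψ-eq _ K ks (zeros (bitsOf w)) (Rows w) hz hz) (trans (cong (λ p → q ^ p *ᶻ φ ks (Rows w)) (trans (cong par z) (par-dbl K))) (ℤₚ.*-identityˡ _)))))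
    where
    hz = trans (cong ⌊_/2⌋ z) (half-dbl K)

  ev-i w zero .0 ks v z n z≤n d = ev-i2 w zero ks v z n d
  ev-i w (suc γ) k ks v z n h d with k ≡ᵇ suc γ in eq
  ev-i w (suc γ) k ks v z n h d | true with ≡ᵇ-≡ k (suc γ) eq
  ... | refl = ev-i2 w (suc γ) ks v z n d
  ev-i (s0 ∷ w) (suc γ) k ks v z n h d | false = trans (ev-i w γ k ks (x *ᶻ v) z′ n (≤-ne h eq) d) (trans (r x v (ψ γ k ks (Rows w))) (cong (v *ᶻ_) (sym (ψ-up γ k ks (Rows w) (Rows-Desc w z′)))))
    where
    z′ = suc²-inj z
    r : ∀ x v y → (x *ᶻ v) *ᶻ y ≡ v *ᶻ (x *ᶻ y)
    r = solve-∀
  ev-i (su ∷ w) (suc γ) k ks v z n h d | false = trans (ev-𝟘 (bodyLabels γ (k ∷ ks)) o w) (trans (*-zero v) (cong (v *ᶻ_) (sym (ψ-ne (suc γ) k ks (suc (zeros (bitsOf w))) (Rows w) (suc γ) (trans (cong ⌊_/2⌋ z) (half-sdbl (suc γ))) eq))))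
  ev-i (sd ∷ w) (suc γ) k ks v z n h d | false = trans (ev-𝟘 (bodyLabels γ (k ∷ ks)) o w) (trans (*-zero v) (cong (v *ᶻ_) (sym (ψ-ne (suc γ) k ks (zeros (bitsOf w)) (Rows w) (suc γ) (trans (cong ⌊_/2⌋ (ℕₚ.suc-injective z)) (half-dbl (suc γ))) eq))))
  ev-i (st ∷ w) (suc γ) k ks v z n h d | false = trans (ev-𝟘 (bodyLabels γ (k ∷ ks)) i w) (trans (*-zero v) (cong (v *ᶻ_) (sym (ψ-ne (suc γ) k ks (zeros (bitsOf w)) (zeros (bitsOf w) ∷ Rows w) (suc γ) (trans (cong ⌊_/2⌋ z) (half-sdbl (suc γ))) eq))))
  ev-i [] (suc γ) k ks v () n h d | false

  ev-i2 (s0 ∷ w) (suc γ) ks v z n d = trans (ev-𝟘 (bodyLabels (suc γ) ks) i w) (trans (*-zero v) (cong (v *ᶻ_) (sym (ψ-0 (suc γ) γ ks (Rows w) (Rows-Desc w (suc²-inj z))))))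
  ev-i2 (s0 ∷ w) zero ks v () n d
  ev-i2 (su ∷ w) γ ks v z n d = trans (ev-o w γ ks (q *ᶻ v) (ℕₚ.suc-injective z) (ℕₚ.suc-injective n) d)
    (trans (r q v (φ ks (Rows w))) (cong (v *ᶻ_) (sym (trans (ψ-eq γ γ ks (suc (zeros (bitsOf w))) (Rows w) (trans (cong ⌊_/2⌋ z) (half-sdbl γ)) refl) (cong (λ p → q ^ p *ᶻ φ ks (Rows w)) (trans (cong par z) (par-sdbl γ)))))))
    where
    r : ∀ q v y → (q *ᶻ v) *ᶻ y ≡ v *ᶻ ((q *ᶻ + 1) *ᶻ y)
    r = solve-∀
  ev-i2 (sd ∷ w) γ ks v z n d = trans (ev-o w γ ks v z′ (ℕₚ.suc-injective n) d)
    (cong (v *ᶻ_) (sym (trans (ψ-eq γ γ ks (zeros (bitsOf w)) (Rows w) (trans (cong ⌊_/2⌋ z′) (half-dbl γ)) refl) (trans (cong (λ p → q ^ p *ᶻ φ ks (Rows w)) (trans (cong par z′) (par-dbl γ))) (ℤₚ.*-identityˡ _)))))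
    where
    z′ = ℕₚ.suc-injective z
  ev-i2 (st ∷ w) γ [] v z () d
  -- The first letter 1 closes a pair with a row of odd length, hence the factor q; the second opens
  -- the next pair, so the state stays inside.
  ev-i2 (st ∷ w) γ (k ∷ ks) v z n (h ∷ d) = trans (ev-i w γ k ks (q *ᶻ v) z (suc²-inj n) h d)
    (trans (r q v (ψ γ k ks (Rows w))) (cong (v *ᶻ_) (sym (trans (ψ-eq γ γ (k ∷ ks) (zeros (bitsOf w)) (zeros (bitsOf w) ∷ Rows w) hz refl)
      (cong₂ (λ p g → q ^ p *ᶻ ψ g k ks (Rows w)) (trans (cong par z) (par-sdbl γ)) hz)))))
    where
    hz = trans (cong ⌊_/2⌋ z) (half-sdbl γ)
    r : ∀ q v y → (q *ᶻ v) *ᶻ y ≡ v *ᶻ ((q *ᶻ + 1) *ᶻ y)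
    r = solve-∀

  φ-weight : ∀ ks rs → φ ks rs ≡ matchZ ks rs *ᶻ (x ^ hsRows rs *ᶻ q ^ vsRows rs)
  φ-weight []       []           = refl
  φ-weight []       (_ ∷ _)      = refl
  φ-weight (k ∷ ks) []           = refl
  φ-weight (k ∷ ks) (a ∷ [])     = refl
  φ-weight (k ∷ ks) (a ∷ b ∷ rs) = trans (cong (λ y → eqz k ⌊ b /2⌋ *ᶻ ((x ^ m *ᶻ q ^ par b) *ᶻ y)) (φ-weight ks rs))
    (trans (r (eqz k ⌊ b /2⌋) (x ^ m) (q ^ par b) (matchZ ks rs) (x ^ hsRows rs) (q ^ vsRows rs))
      (cong₂ (λ y z → (eqz k ⌊ b /2⌋ *ᶻ matchZ ks rs) *ᶻ (y *ᶻ z)) (sym (ℤₚ.^-distribˡ-+-* x m (hsRows rs))) (sym (ℤₚ.^-distribˡ-+-* q (par b) (vsRows rs)))))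
    where
    m = ⌊ a /2⌋ ∸ ⌊ b /2⌋
    r : ∀ e x q m y z → e *ᶻ ((x *ᶻ q) *ᶻ (m *ᶻ (y *ᶻ z))) ≡ (e *ᶻ m) *ᶻ ((x *ᶻ y) *ᶻ (q *ᶻ z))
    r = solve-∀

-- Initial values, and vanishing of each coefficient.

module Coefficients where

  open Tables
  open BitWords
  open Tableaux using (Desc; []; _∷_; when)
  open CellRemoval
  open Extraction
  open Halving

  double-dbl : ∀ k → k + k ≡ dbl k
  double-dbl zero    = refl
  double-dbl (suc k) = cong suc (trans (ℕₚ.+-suc k k) (cong suc (double-dbl k)))

  parity : ∀ n → ∃[ m ] (n ≡ m + m ⊎ n ≡ suc (m + m))
  parity zero    = 0 , inj₁ refl
  parity (suc n) with parity n
  ... | m , inj₁ e = m , inj₂ (cong suc e)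
  ... | m , inj₂ e = suc m , inj₁ (trans (cong suc e) (cong suc (sym (ℕₚ.+-suc m m))))

  -- The one-cell shape in a box with B + 1 rows and W + 1 columns.
  boxWord : ℕ → ℕ → Bits
  boxWord B W = replicate W false ++ true ∷ false ∷ replicate B true

  rep-cons : ∀ n (v : Bits) → false ∷ replicate n false ++ v ≡ replicate n false ++ false ∷ v
  rep-cons zero    v = refl
  rep-cons (suc n) v = cong (false ∷_) (rep-cons n v)

  emptyWord-hop : ∀ B W → emptyWord (suc B) (suc W) ≡ replicate W false ++ false ∷ true ∷ replicate B true
  emptyWord-hop B W = rep-cons W (true ∷ replicate B true)

  sites-0 : ∀ k v → sitesOf (replicate (dbl k) false ++ v) ≡ replicate k s0 ++ sitesOf v
  sites-0 zero    v = refl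
  sites-0 (suc k) v = cong (s0 ∷_) (sites-0 k v)

  sites-t : ∀ k → sitesOf (replicate (dbl k) true) ≡ replicate k st
  sites-t zero    = refl
  sites-t (suc k) = cong (st ∷_) (sites-t k)

  sites-empty : ∀ B W → sitesOf (emptyWord (dbl B) (dbl W)) ≡ replicate W s0 ++ replicate B st
  sites-empty B W = trans (sites-0 W _) (cong (replicate W s0 ++_) (sites-t B))

  sites-box : ∀ K → sitesOf (boxWord (suc (dbl K)) (suc (dbl K))) ≡ replicate K s0 ++ sd ∷ sd ∷ replicate K st
  sites-box K = trans (cong sitesOf (rep-cons (dbl K) _)) (trans (sites-0 K _) (cong (λ w → replicate K s0 ++ sd ∷ sd ∷ w) (sites-t K)))

  cls-empty : ∀ B W → Class B W 0 (emptyWord B W)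
  cls-empty B (suc W) with cls-empty B W
  ... | cls a b c = cls a (cong suc b) c
  cls-empty zero zero = cls refl refl refl
  cls-empty (suc B) zero with cls-empty B zero
  ... | cls a b c = cls (cong suc a) b (cong₂ _+_ b c)

  cls-box : ∀ B W → Class (suc B) (suc W) 1 (boxWord B W)
  cls-box B W with subst (Class (suc B) (suc W) 0) (emptyWord-hop B W) (cls-empty (suc B) (suc W))
  ... | cls a b c = cls (trans (ones-hop (replicate W false) t) a) (trans (zeros-hop (replicate W false) t) b) (trans (cells-hop (replicate W false) t) (cong suc c))
    where
    t = replicate B true

  addCell-true : ∀ g B → addCell g (replicate B true) ≡ + 0
  addCell-true g zero    = refl
  addCell-true g (suc B) = addCell-true _ B

  addCell-empty : ∀ g B W → addCell g (emptyWord (suc B) (suc W)) ≡ g (boxWord B W)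
  addCell-empty g B W = trans (cong (addCell g) (emptyWord-hop B W)) (go g W)
    where
    go : ∀ g W → addCell g (replicate W false ++ false ∷ true ∷ replicate B true) ≡ g (replicate W false ++ true ∷ false ∷ replicate B true)
    go g zero    = trans (cong₂ _+ᶻ_ (trans (cong (λ n → signOf n *ᶻ g (boxWord B 0)) (Class.ce (cls-empty B 0))) (ℤₚ.*-identityˡ (g (boxWord B 0)))) (addCell-true _ B)) (ℤₚ.+-identityʳ _)
    go g (suc W) = trans (cong (_+ᶻ addCell (g ∘ (false ∷_)) (replicate W false ++ false ∷ true ∷ replicate B true)) (h W)) (trans (ℤₚ.+-identityˡ _) (go (g ∘ (false ∷_)) W))
      where
      h : ∀ W → cellHop g (replicate W false ++ false ∷ true ∷ replicate B true) ≡ + 0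
      h zero    = refl
      h (suc W) = refl

  module Eval (q x : ℤ) (K : ℕ) (ks : List ℕ) (lk : length ks ≡ suc K) (dk : Desc (suc K) ks) where
    open Labels q x
    open DominoStep q x
    open Vanishing q x
    open Weights q x
    private N = suc K + suc K

    evBits-weight : ∀ {n} w → Class N N n w → evBits (bodyLabels (suc K) ks) w ≡ matchZ ks (rows w) *ᶻ (x ^ hsRows (rows w) *ᶻ q ^ vsRows (rows w))
    evBits-weight w (cls a b c) = trans (ev-o (sitesOf w) (suc K) ks (+ 1) (trans (cong zeros (sym e)) (trans b (double-dbl (suc K)))) (trans (cong ones (sym e)) (trans a (trans (double-dbl (suc K)) (cong dbl (sym lk))))) dk)
      (trans (ℤₚ.*-identityˡ _) (trans (cong (λ u → φ ks (rows u)) (sym e)) (φ-weight ks (rows w))))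
      where
      e : w ≡ bitsOf (sitesOf w)
      e = bits-sites w (trans (cong evb (cong₂ _+_ b a)) (evb-double N))

    evBits-0 : ∀ {n} w → Class N N n w → matchZ ks (rows w) ≡ + 0 → evBits (bodyLabels (suc K) ks) w ≡ + 0
    evBits-0 w c e = trans (evBits-weight w c) (trans (cong (_*ᶻ y) e) (ℤₚ.*-zeroˡ y))
      where
      y = x ^ hsRows (rows w) *ᶻ q ^ vsRows (rows w)

    ll : len (bodyLabels (suc K) ks) ≡ N
    ll = trans (len-bodyLabels (suc K) ks) (cong (λ m → suc K + m) lk)

    nontrivial-empty : (ls : Labs 0) → Nontrivial ls → evBits ls (emptyWord N N) ≡ + 0
    nontrivial-empty ls h = trans (cong (λ n → ev ls o (+ 1) (sitesOf (emptyWord n n))) (double-dbl (suc K)))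
      (trans (cong (ev ls o (+ 1)) (sites-empty (suc K) (suc K))) (nontrivial-s0 (replicate (suc K) st) (λ ls h v → nontrivial-st ls h v (suc K)) (suc K) ls h (+ 1)))

    nontrivial-box : (ls : Labs 0) → Nontrivial ls → evBits ls (boxWord (K + suc K) (K + suc K)) ≡ + 0
    nontrivial-box ls h = trans (cong (λ n → ev ls o (+ 1) (sitesOf (boxWord n n))) (ℕₚ.suc-injective (double-dbl (suc K))))
      (trans (cong (ev ls o (+ 1)) (sites-box K)) (nontrivial-s0 (sd ∷ sd ∷ replicate K st) (λ ls h v → nontrivial-sd ls h v K) K ls h (+ 1)))

    -- Double steps reach only even n from the empty word. For odd n one addition is split off; its
    -- only possible result is the one-cell word.
    vanish-all : ∀ n → n ≤ K + suc K → matchZ ks (rows (emptyWord N N)) ≡ + 0 → matchZ ks (rows (boxWord (K + suc K) (K + suc K))) ≡ + 0 →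
      addCells n (evBits (bodyLabels (suc K) ks)) (emptyWord N N) ≡ + 0
    vanish-all n le e₀ e₁ with parity n
    ... | m , inj₁ refl = vanish K 0 (emptyWord N N) (cls-empty N N) nontrivial-empty m (bodyLabels (suc K) ks) ll (evBits-0 _ (cls-empty N N) e₀) (subst (_≤ K + suc K) (sym (ℕₚ.+-identityʳ (m + m))) le)
    ... | m , inj₂ refl = trans (addCells-suc (m + m) (evBits (bodyLabels (suc K) ks)) (emptyWord N N)) (trans (addCell-empty (addCells (m + m) (evBits (bodyLabels (suc K) ks))) (K + suc K) (K + suc K))
      (vanish K 1 (boxWord (K + suc K) (K + suc K)) bx nontrivial-box m (bodyLabels (suc K) ks) ll (evBits-0 _ bx e₁) (subst (_≤ K + suc K) (ℕₚ.+-comm 1 (m + m)) le)))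
      where
      bx = cls-box (K + suc K) (K + suc K)

  -- The coefficient of x^h q^v in the weight of the body with halved row lengths ks.
  χ : List ℕ → ℕ → ℕ → Bits → ℤ
  χ ks h v w = matchZ ks (rows w) *ᶻ (eqz (hsRows (rows w)) h *ᶻ eqz (vsRows (rows w)) v)

  -- The first half length `suc k` is positive, so neither the empty shape nor the single cell has
  -- this body, and both initial values are 0.
  χ-vanish : ∀ K k ks n h v → length ks ≡ K → Desc (suc K) (suc k ∷ ks) → n ≤ K + suc K →
    addCells n (χ (suc k ∷ ks) h v) (emptyWord (suc K + suc K) (suc K + suc K)) ≡ + 0
  χ-vanish K k ks n h v lk dk le = trans (proj₂ rep (χ (suc k ∷ ks) h v))
    (extract₂ (proj₁ rep) (λ w → matchZ (suc k ∷ ks) (rows w)) (hsRows ∘ rows) (vsRows ∘ rows) H h v)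
    where
    N = suc K + suc K
    rep = addCells-lin n (emptyWord N N)
    z : ∀ a rs → matchZ (suc k ∷ ks) (a ∷ 0 ∷ rs) ≡ + 0
    z a rs = ℤₚ.*-zeroˡ (matchZ ks rs)
    e₀ : matchZ (suc k ∷ ks) (rows (emptyWord N N)) ≡ + 0
    e₀ = trans (cong (matchZ (suc k ∷ ks)) (trans (rows-empty N N) (cong (λ m → replicate m 0) (double-dbl (suc K))))) (z 0 (replicate (dbl K) 0))
    e₁ : matchZ (suc k ∷ ks) (rows (boxWord (K + suc K) (K + suc K))) ≡ + 0
    e₁ = trans (cong (λ m → matchZ (suc k ∷ ks) (rows (boxWord m m))) (ℕₚ.+-suc K K))
      (trans (cong (matchZ (suc k ∷ ks)) (go (suc (K + K)))) (trans (cong (λ y → matchZ (suc k ∷ ks) (zeros (false ∷ replicate (suc (K + K)) true) ∷ y)) (rows-empty (suc (K + K)) 0)) (z (zeros (false ∷ replicate (suc (K + K)) true)) (replicate (K + K) 0))))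
      where
      go : ∀ W → rows (boxWord (suc (K + K)) W) ≡ rows (boxWord (suc (K + K)) 0)
      go zero    = refl
      go (suc W) = go W
    H : ∀ m j → lin (λ w → matchZ (suc k ∷ ks) (rows w) *ᶻ ((+ suc m) ^ hsRows (rows w) *ᶻ (+ suc j) ^ vsRows (rows w))) (proj₁ rep) ≡ + 0
    H m j = trans (sym (proj₂ rep _)) (trans (sym (addCells-class n 0 _ _ (λ w c → Ev.evBits-weight w c) (emptyWord N N) (cls-empty N N))) (Ev.vanish-all n le e₀ e₁))
      where
      -- All positive integers serve as values of q and x.
      module Ev = Eval (+ suc j) (+ suc m) K (suc k ∷ ks) (cong suc lk) dk

-- Fourling bodies, domino packings, and conjugation in terms of row lengths.

module Packings where

  open Tableaux using (Desc; []; _∷_)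
  open CellRemoval using (Desc-≤; Desc-head)
  open Halving
  open Coefficients using (double-dbl)

  partition-Desc : ∀ {μ} → IsPartition μ → Desc (row μ 0) μ
  partition-Desc (_ , l) = go l
    where
    go : ∀ {μ} → Linked _≥_ μ → Desc (row μ 0) μ
    go []      = []
    go [-]     = ℕₚ.≤-refl ∷ []
    go (h ∷ l) = ℕₚ.≤-refl ∷ Desc-≤ h (go l)

  row-suc-≤ : ∀ {W μ} → Desc W μ → ∀ r → row μ (suc r) ≤ row μ r
  row-suc-≤ []      r       = z≤n
  row-suc-≤ (_ ∷ d) zero    = Desc-head d
  row-suc-≤ (_ ∷ d) (suc r) = row-suc-≤ d r

  Desc-row : ∀ {W μ} → Desc W μ → ∀ r → row μ r ≤ W
  Desc-row d zero    = Desc-head d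
  Desc-row d (suc r) = ℕₚ.≤-trans (row-suc-≤ d r) (Desc-row d r)

  even-odd : ∀ r → ∃[ i ] (r ≡ dbl i ⊎ r ≡ suc (dbl i))
  even-odd zero    = 0 , inj₁ refl
  even-odd (suc r) with even-odd r
  ... | i , inj₁ e = i , inj₂ (cong suc e)
  ... | i , inj₂ e = suc i , inj₁ (cong suc e)

  dbl-mono : ∀ {m n} → m ≤ n → dbl m ≤ dbl n
  dbl-mono z≤n     = z≤n
  dbl-mono (s≤s h) = s≤s (s≤s (dbl-mono h))

  dbl-half-≤ : ∀ n → dbl ⌊ n /2⌋ ≤ n
  dbl-half-≤ 0             = z≤n
  dbl-half-≤ 1             = z≤n
  dbl-half-≤ (suc (suc n)) = s≤s (s≤s (dbl-half-≤ n))

  dbl-half-par : ∀ n → dbl ⌊ n /2⌋ + par n ≡ n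
  dbl-half-par 0             = refl
  dbl-half-par 1             = refl
  dbl-half-par (suc (suc n)) = cong (suc ∘ suc) (dbl-half-par n)

  par-01 : ∀ n → par n ≡ 0 ⊎ par n ≡ 1
  par-01 0             = inj₁ refl
  par-01 1             = inj₂ refl
  par-01 (suc (suc n)) = par-01 n

  Even-dbl : ∀ {n} → Even n → n ≡ dbl ⌊ n /2⌋
  Even-dbl ev0      = refl
  Even-dbl (ev+2 e) = cong (suc ∘ suc) (Even-dbl e)

  dbl-Even : ∀ k → Even (dbl k)
  dbl-Even zero    = ev0
  dbl-Even (suc k) = ev+2 (dbl-Even k)

  <-incl : ∀ {m n} → (∀ c → c < m → c < n) → m ≤ n
  <-incl {zero}  h = z≤n
  <-incl {suc m} h = h m ℕₚ.≤-refl

  fourling-rows : ∀ {D} → IsFourlingShape D → ∀ i → row D (suc (dbl i)) ≡ row D (dbl i) × row D (dbl i) ≡ dbl ⌊ row D (dbl i) /2⌋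
  fourling-rows {D} (_ , f) i with f i
  ... | e , ev = subst (λ r → row D (suc r) ≡ row D r) (double-dbl i) (sym e) , subst (λ r → row D r ≡ dbl ⌊ row D r /2⌋) (double-dbl i) (Even-dbl ev)

  body : Shape → ℕ → ℕ
  body μ i = dbl ⌊ row μ (suc (dbl i)) /2⌋

  BodyRows : Shape → Shape → Set
  BodyRows D μ = ∀ i → row D (dbl i) ≡ body μ i × row D (suc (dbl i)) ≡ body μ i

  BodyRows-bound : ∀ D μ {W} → Desc W μ → BodyRows D μ → ∀ r → row D r ≤ row μ r
  BodyRows-bound D μ d b r with even-odd r
  ... | i , inj₁ refl = ℕₚ.≤-trans (ℕₚ.≤-reflexive (proj₁ (b i))) (ℕₚ.≤-trans (dbl-half-≤ _) (row-suc-≤ d (dbl i)))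
  ... | i , inj₂ refl = ℕₚ.≤-trans (ℕₚ.≤-reflexive (proj₂ (b i))) (dbl-half-≤ _)

  -- Rows 2i and 2i + 1 of a fourling shape are equal and even, so both are bounded by the even part
  -- of the shorter of the two rows of `μ`.
  fourling-bound : ∀ E D μ → IsFourlingShape E → E ⊆ₛ μ → BodyRows D μ → ∀ r → row E r ≤ row D r
  fourling-bound E D μ fE inc b r = go (even-odd r)
    where
    step : ∀ i → row E (dbl i) ≤ body μ i
    step i = subst (_≤ body μ i) (sym (proj₂ fr)) (dbl-mono (ℕₚ.⌊n/2⌋-mono (subst (_≤ row μ (suc (dbl i))) (proj₁ fr) (<-incl (inc (suc (dbl i)))))))
      where fr = fourling-rows fE i
    go : ∃[ i ] (r ≡ dbl i ⊎ r ≡ suc (dbl i)) → row E r ≤ row D r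
    go (i , inj₁ refl) = subst (row E (dbl i) ≤_) (sym (proj₁ (b i))) (step i)
    go (i , inj₂ refl) = subst₂ _≤_ (sym (proj₁ (fourling-rows fE i))) (sym (proj₂ (b i))) (step i)

  rows⇒body : ∀ {D μ} → IsPartition μ → IsFourlingShape D → BodyRows D μ → IsFourlingBody D μ
  rows⇒body {D} {μ} pμ fD b = fD , (λ r c h → ℕₚ.<-≤-trans h (BodyRows-bound D μ (partition-Desc pμ) b r)) , λ E fE inc r c h → ℕₚ.<-≤-trans h (fourling-bound E D μ fE inc b r)

  -- The body is cut off at the first empty pair, since zero rows are not allowed; by `half-0` all
  -- later pairs are empty too.
  fourlings : Shape → Shape
  addPair : ℕ → Shape → Shape
  fourlings (a ∷ b ∷ μ) = addPair ⌊ b /2⌋ (fourlings μ)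
  fourlings _           = []
  addPair zero    E = []
  addPair (suc k) E = dbl (suc k) ∷ dbl (suc k) ∷ E

  half-0 : ∀ {b c} → ⌊ b /2⌋ ≡ 0 → c ≤ b → ⌊ c /2⌋ ≡ 0
  half-0 e h = ℕₚ.n≤0⇒n≡0 (subst (_ ≤_) e (ℕₚ.⌊n/2⌋-mono h))

  fourlings-rows : ∀ {W} μ → Desc W μ → BodyRows (fourlings μ) μ
  fourlings-rows []          d i       = refl , refl
  fourlings-rows (a ∷ [])    d zero    = refl , refl
  fourlings-rows (a ∷ [])    d (suc i) = refl , refl
  fourlings-rows (a ∷ b ∷ μ) (_ ∷ (_ ∷ d)) i with ⌊ b /2⌋ in eq
  fourlings-rows (a ∷ b ∷ μ) (_ ∷ (_ ∷ d)) zero    | zero rewrite eq = refl , refl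
  fourlings-rows (a ∷ b ∷ μ) (_ ∷ (_ ∷ d)) (suc i) | zero rewrite half-0 {b} eq (Desc-row d (suc (dbl i))) = refl , refl
  fourlings-rows (a ∷ b ∷ μ) (_ ∷ (_ ∷ d)) zero    | suc k rewrite eq = refl , refl
  fourlings-rows (a ∷ b ∷ μ) (_ ∷ (_ ∷ d)) (suc i) | suc k = fourlings-rows μ d i

  fourlings-Linked : ∀ {W} μ → Desc W μ → All (0 <_) (fourlings μ) × Desc (dbl ⌊ W /2⌋) (fourlings μ)
  fourlings-Linked []          d = [] , []
  fourlings-Linked (a ∷ [])    d = [] , []
  fourlings-Linked (a ∷ b ∷ μ) (ha ∷ (hb ∷ d)) with ⌊ b /2⌋ | ℕₚ.⌊n/2⌋-mono (ℕₚ.≤-trans hb ha) | fourlings-Linked μ d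
  ... | zero  | _ | _     = [] , []
  ... | suc k | l | p , r = (s≤s z≤n ∷ s≤s z≤n ∷ p) , (dbl-mono l ∷ (ℕₚ.≤-refl ∷ r))

  Desc-Linked : ∀ {W μ} → Desc W μ → Linked _≥_ μ
  Desc-Linked []            = []
  Desc-Linked (_ ∷ [])      = [-]
  Desc-Linked (_ ∷ (h ∷ d)) = h ∷ Desc-Linked (h ∷ d)

  fourlings-shape : ∀ {W} μ → Desc W μ → IsFourlingShape (fourlings μ)
  fourlings-shape μ d = (proj₁ (fourlings-Linked μ d) , Desc-Linked (proj₂ (fourlings-Linked μ d))) , λ i → subst (λ r → row (fourlings μ) r ≡ row (fourlings μ) (suc r) × Even (row (fourlings μ) r)) (sym (double-dbl i))
    (trans (proj₁ (fourlings-rows μ d i)) (sym (proj₂ (fourlings-rows μ d i))) , subst Even (sym (proj₁ (fourlings-rows μ d i))) (dbl-Even _))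

  -- Mutual inclusion with `fourlings μ`: it lies in `D` by maximality and contains `D` by
  -- `fourling-bound`.
  body⇒rows : ∀ {D μ} → IsPartition μ → IsFourlingBody D μ → BodyRows D μ
  body⇒rows {D} {μ} pμ (fD , inc , mx) i = trans (eq (dbl i)) (proj₁ (b i)) , trans (eq (suc (dbl i))) (proj₂ (b i))
    where
    d = partition-Desc pμ
    b = fourlings-rows μ d
    eq : ∀ r → row D r ≡ row (fourlings μ) r
    eq r = ℕₚ.≤-antisym (fourling-bound D (fourlings μ) μ fD inc b r) (<-incl (mx (fourlings μ) (fourlings-shape μ d) (λ r c h → ℕₚ.<-≤-trans h (BodyRows-bound (fourlings μ) μ d b r)) r))

  -- Re-indexes the row pairs after the first pair has been removed; an index 0 is discarded.
  preds : List ℕ → List ℕ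
  preds []           = []
  preds (zero ∷ is)  = preds is
  preds (suc i ∷ is) = i ∷ preds is

  All-preds : ∀ {P : ℕ → Set} {is} → All P is → All (P ∘ suc) (preds is)
  All-preds {is = []}         []       = []
  All-preds {is = zero ∷ is}  (_ ∷ hs) = All-preds hs
  All-preds {is = suc i ∷ is} (h ∷ hs) = h ∷ All-preds hs

  Unique-preds : ∀ {is} → AllPairs _≢_ is → AllPairs _≢_ (preds is)
  Unique-preds {[]}         []       = []
  Unique-preds {zero ∷ is}  (_ ∷ u)  = Unique-preds u
  Unique-preds {suc i ∷ is} (h ∷ u)  = All.map (λ ne e → ne (cong suc e)) (All-preds h) ∷ Unique-preds u

  length-preds : ∀ {is} → All (0 ≢_) is → length is ≡ length (preds is)
  length-preds {[]}         []      = refl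
  length-preds {zero ∷ is}  (h ∷ _) = ⊥-elim (h refl)
  length-preds {suc i ∷ is} (_ ∷ h) = cong suc (length-preds h)

  length-preds-≤ : ∀ {is} → AllPairs _≢_ is → length is ≤ suc (length (preds is))
  length-preds-≤ {[]}         []      = z≤n
  length-preds-≤ {zero ∷ is}  (h ∷ _) = s≤s (ℕₚ.≤-reflexive (length-preds h))
  length-preds-≤ {suc i ∷ is} (_ ∷ u) = s≤s (length-preds-≤ u)

  OddAt : Shape → ℕ → Set
  OddAt μ i = par (row μ (suc (dbl i))) ≡ 1

  odd-rows-≤ : ∀ μ is → AllPairs _≢_ is → All (OddAt μ) is → length is ≤ vsRows μ
  odd-rows-≤ []          []       u h       = z≤n
  odd-rows-≤ []          (i ∷ is) u (() ∷ _)
  odd-rows-≤ (a ∷ [])    []       u h       = z≤n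
  odd-rows-≤ (a ∷ [])    (i ∷ is) u (() ∷ _)
  odd-rows-≤ (a ∷ b ∷ μ) is       u h with par-01 b
  ... | inj₂ e rewrite e = ℕₚ.≤-trans (length-preds-≤ u) (s≤s (odd-rows-≤ μ (preds is) (Unique-preds u) (All-preds h)))
  ... | inj₁ e rewrite e = ℕₚ.≤-trans (ℕₚ.≤-reflexive (length-preds (All.map (λ {j} hj z → nz j hj z) h))) (odd-rows-≤ μ (preds is) (Unique-preds u) (All-preds h))
    where
    nz : ∀ j → OddAt (a ∷ b ∷ μ) j → 0 ≢ j
    nz .0 hj refl with trans (sym e) hj
    ... | ()

  last-square : ∀ m c → c < m → dbl ⌊ m /2⌋ ≤ c → par m ≡ 1 × c ≡ dbl ⌊ m /2⌋
  last-square m c l h with par-01 m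
  ... | inj₁ e = ⊥-elim (ℕₚ.<⇒≱ l (ℕₚ.≤-trans (ℕₚ.≤-reflexive (sym (trans (sym (ℕₚ.+-identityʳ _)) (trans (cong (λ k → dbl ⌊ m /2⌋ + k) (sym e)) (dbl-half-par m))))) h))
  ... | inj₂ e = e , ℕₚ.≤-antisym (ℕₚ.≤-pred (ℕₚ.≤-trans l (ℕₚ.≤-reflexive (trans (sym (dbl-half-par m)) (trans (cong (λ k → dbl ⌊ m /2⌋ + k) e) (ℕₚ.+-comm _ 1)))))) h

  -- Of the two rows met by a vertical domino in the strip, one is row 2⌊r/2⌋ + 1, and it has at most one square outside the body.
  domino-square : ∀ D μ → BodyRows D μ → ∀ r c → InStrip D μ (r , c) → InStrip D μ (suc r , c) → OddAt μ ⌊ r /2⌋ × c ≡ body μ ⌊ r /2⌋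
  domino-square D μ b r c (a₁ , d₁) (a₂ , d₂) with even-odd r
  ... | i , inj₁ refl rewrite half-dbl i = last-square (row μ (suc (dbl i))) c a₂ (subst (_≤ c) (proj₂ (b i)) d₂)
  ... | i , inj₂ refl rewrite half-sdbl i = last-square (row μ (suc (dbl i))) c a₁ (subst (_≤ c) (proj₂ (b i)) d₁)

  -- Sending a domino to its row pair ⌊r/2⌋ is injective on a packing: two dominoes with the same
  -- pair lie in the same column by `domino-square`, and top rows at most one apart would make them
  -- overlap.
  VS-bound : ∀ D μ → BodyRows D μ → ∀ ps → IsVPacking D μ ps → length ps ≤ vsRows μ
  VS-bound D μ b ps (h , disj) = subst (_≤ vsRows μ) (length-map (λ p → ⌊ proj₁ p /2⌋) ps)
    (odd-rows-≤ μ (map (λ p → ⌊ proj₁ p /2⌋) ps) (AllPairsₚ.map⁺ (uniq ps h disj)) (Allₚ.map⁺ (All.map (λ { {r , c} (s , t) → proj₁ (domino-square D μ b r c s t) }) h)))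
    where
    S : ℕ × ℕ → Set
    S p = InStrip D μ p × InStrip D μ (suc (proj₁ p) , proj₂ p)
    near : ∀ r r′ → ⌊ r /2⌋ ≡ ⌊ r′ /2⌋ → suc r < r′ → ⊥
    near r r′ e l = ℕₚ.1+n≰n (ℕₚ.≤-trans (ℕₚ.⌊n/2⌋-mono l) (ℕₚ.≤-reflexive (sym e)))
    ne : ∀ p p′ → S p → S p′ → DisjointV p p′ → ⌊ proj₁ p /2⌋ ≢ ⌊ proj₁ p′ /2⌋
    ne (r , c) (r′ , c′) (s , t) (s′ , t′) (inj₁ n) e = n (trans (proj₂ (domino-square D μ b r c s t)) (trans (cong (body μ) e) (sym (proj₂ (domino-square D μ b r′ c′ s′ t′)))))
    ne (r , c) (r′ , c′) _ _ (inj₂ (inj₁ l)) e = near r r′ e l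
    ne (r , c) (r′ , c′) _ _ (inj₂ (inj₂ l)) e = near r′ r (sym e) l
    uniq : ∀ ps → All S ps → AllPairs DisjointV ps → AllPairs (λ p p′ → ⌊ proj₁ p /2⌋ ≢ ⌊ proj₁ p′ /2⌋) ps
    uniq []       []       []       = []
    uniq (p ∷ ps) (s ∷ ss) (d ∷ ds) = All.map (λ { {p′} (s′ , d′) → ne p p′ s s′ d′ }) (All.zip (ss , d)) ∷ uniq ps ss ds

  -- The optimal packing: one domino over the last square of each row of odd index and odd length.
  packFrom : ℕ → Shape → List (ℕ × ℕ)
  packFrom r (a ∷ b ∷ μ) = addIf (par b)
    where
    addIf : ℕ → List (ℕ × ℕ)
    addIf zero    = packFrom (suc (suc r)) μ
    addIf (suc _) = (r , dbl ⌊ b /2⌋) ∷ packFrom (suc (suc r)) μ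
  packFrom r _           = []

  length-packFrom : ∀ r μ → length (packFrom r μ) ≡ vsRows μ
  length-packFrom r []          = refl
  length-packFrom r (a ∷ [])    = refl
  length-packFrom r (a ∷ b ∷ μ) with par b | par-01 b
  ... | .0 | inj₁ refl = length-packFrom (suc (suc r)) μ
  ... | .1 | inj₂ refl = cong suc (length-packFrom (suc (suc r)) μ)

  packFrom-≥ : ∀ r μ → All (λ p → r ≤ proj₁ p) (packFrom r μ)
  packFrom-≥ r []          = []
  packFrom-≥ r (a ∷ [])    = []
  packFrom-≥ r (a ∷ b ∷ μ) with par b
  ... | zero  = All.map (ℕₚ.≤-trans (ℕₚ.m≤n+m r 2)) (packFrom-≥ (suc (suc r)) μ)
  ... | suc _ = ℕₚ.≤-refl ∷ All.map (ℕₚ.≤-trans (ℕₚ.m≤n+m r 2)) (packFrom-≥ (suc (suc r)) μ)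

  packFrom-disjoint : ∀ r μ → AllPairs DisjointV (packFrom r μ)
  packFrom-disjoint r []          = []
  packFrom-disjoint r (a ∷ [])    = []
  packFrom-disjoint r (a ∷ b ∷ μ) with par b
  ... | zero  = packFrom-disjoint (suc (suc r)) μ
  ... | suc _ = All.map (λ h → inj₂ (inj₁ h)) (packFrom-≥ (suc (suc r)) μ) ∷ packFrom-disjoint (suc (suc r)) μ

  packFrom-strip : ∀ D μ {W} → Desc W μ → BodyRows D μ → ∀ j ν → (∀ r → row μ (dbl j + r) ≡ row ν r) →
    All (λ p → InStrip D μ p × InStrip D μ (suc (proj₁ p) , proj₂ p)) (packFrom (dbl j) ν)
  packFrom-strip D μ d b j []          e = []
  packFrom-strip D μ d b j (a ∷ [])    e = []
  packFrom-strip D μ d b j (a ∷ c ∷ ν) e with par c in pc | packFrom-strip D μ d b (suc j) ν (λ r → trans (cong (row μ) (sym (trans (ℕₚ.+-suc (dbl j) (suc r)) (cong suc (ℕₚ.+-suc (dbl j) r))))) (e (suc (suc r))))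
  ... | zero  | rest = rest
  ... | suc p | rest = ((ℕₚ.<-≤-trans lt (row-suc-≤ d (dbl j)) , ℕₚ.≤-reflexive (trans (proj₁ (b j)) bd)) , (lt , ℕₚ.≤-reflexive (trans (proj₂ (b j)) bd))) ∷ rest
    where
    ec : row μ (suc (dbl j)) ≡ c
    ec = trans (cong (row μ) (ℕₚ.+-comm 1 (dbl j))) (e 1)
    bd : body μ j ≡ dbl ⌊ c /2⌋
    bd = cong (λ m → dbl ⌊ m /2⌋) ec
    lt : dbl ⌊ c /2⌋ < row μ (suc (dbl j))
    lt = subst (dbl ⌊ c /2⌋ <_) (sym ec) (ℕₚ.<-≤-trans (ℕₚ.m<m+n (dbl ⌊ c /2⌋) {suc p} (s≤s z≤n)) (ℕₚ.≤-reflexive (trans (cong (λ k → dbl ⌊ c /2⌋ + k) (sym pc)) (dbl-half-par c))))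

  packing : ∀ D μ {W} → Desc W μ → BodyRows D μ → IsVPacking D μ (packFrom 0 μ)
  packing D μ d b = packFrom-strip D μ d b 0 μ (λ _ → refl) , packFrom-disjoint 0 μ

  VS⇒vsRows : ∀ {μ v} → IsPartition μ → VS μ v → v ≡ vsRows μ
  VS⇒vsRows {μ} {v} pμ (D , fb , (ps , pk , refl) , mx) = ℕₚ.≤-antisym (VS-bound D μ b ps pk) (subst (_≤ v) (length-packFrom 0 μ) (mx (packFrom 0 μ) (packing D μ (partition-Desc pμ) b)))
    where
    b = body⇒rows pμ fb

  vsRows⇒VS : ∀ {μ} → IsPartition μ → VS μ (vsRows μ)
  vsRows⇒VS {μ} pμ = fourlings μ , rows⇒body pμ (fourlings-shape μ d) b , (packFrom 0 μ , packing (fourlings μ) μ d b , length-packFrom 0 μ) , λ ps pk → VS-bound (fourlings μ) μ b ps pk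
    where
    d = partition-Desc pμ
    b = fourlings-rows μ d

  -- A numerical indicator of `c < a`, so that column lengths become sums over rows.
  lt : ℕ → ℕ → ℕ
  lt c       zero    = 0
  lt zero    (suc a) = 1
  lt (suc c) (suc a) = lt c a

  colLen : Shape → ℕ → ℕ
  colLen μ c = length (filter (c <?_) μ)

  lt-< : ∀ {c a} → c < a → lt c a ≡ 1
  lt-< {zero}  (s≤s h) = refl
  lt-< {suc c} (s≤s h) = lt-< h

  lt-≥ : ∀ {c a} → a ≤ c → lt c a ≡ 0
  lt-≥ z≤n     = refl
  lt-≥ (s≤s h) = lt-≥ h

  colLen-∷ : ∀ a μ c → colLen (a ∷ μ) c ≡ lt c a + colLen μ c
  colLen-∷ a μ c with c <? a
  ... | yes h = trans (cong length (filter-accept (c <?_) h)) (cong (_+ colLen μ c) (sym (lt-< h)))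
  ... | no h  = trans (cong length (filter-reject (c <?_) h)) (cong (_+ colLen μ c) (sym (lt-≥ (ℕₚ.≮⇒≥ h))))

  colLen-Desc : ∀ {W μ c} → Desc W μ → W ≤ c → colLen μ c ≡ 0
  colLen-Desc []                      h = refl
  colLen-Desc {μ = a ∷ μ} {c} (ha ∷ d) h = trans (colLen-∷ a μ c) (cong₂ _+_ (lt-≥ (ℕₚ.≤-trans ha h)) (colLen-Desc d (ℕₚ.≤-trans ha h)))

  colLen-pad : ∀ μ k c → colLen (μ ++ replicate k 0) c ≡ colLen μ c
  colLen-pad []      zero    c = refl
  colLen-pad []      (suc k) c = trans (colLen-∷ 0 (replicate k 0) c) (colLen-pad [] k c)
  colLen-pad (a ∷ μ) k       c = trans (colLen-∷ a (μ ++ replicate k 0) c) (trans (cong (λ k → lt c a + k) (colLen-pad μ k c)) (sym (colLen-∷ a μ c)))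

  -- Two rows a ≥ b on top add two cells to the columns c < b and none to c ≥ a. A column with b ≤ c
  -- < a gains one cell and has none below, so its parity becomes odd.
  par-colLen : ∀ {W} a b μ c → Desc W (a ∷ b ∷ μ) → lt c b + par (colLen (a ∷ b ∷ μ) c) ≡ lt c a + par (colLen μ c)
  par-colLen a b μ c (_ ∷ (ba ∷ d)) = trans (cong (λ n → lt c b + par n) (trans (colLen-∷ a (b ∷ μ) c) (cong (λ k → lt c a + k) (colLen-∷ b μ c)))) (go (c <? b) (c <? a))
    where
    go : Dec (c < b) → Dec (c < a) → lt c b + par (lt c a + (lt c b + colLen μ c)) ≡ lt c a + par (colLen μ c)
    go (yes h) _ rewrite lt-< h | lt-< (ℕₚ.<-≤-trans h ba) = refl
    go (no h) (yes h′) rewrite lt-≥ (ℕₚ.≮⇒≥ h) | lt-< h′ | colLen-Desc {c = c} d (ℕₚ.≮⇒≥ h) = refl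
    go (no h) (no h′) rewrite lt-≥ (ℕₚ.≮⇒≥ h) | lt-≥ (ℕₚ.≮⇒≥ h′) = refl

  sumOdd : (ℕ → ℕ) → ℕ → ℕ
  sumOdd g (suc (suc m)) = g 1 + sumOdd (λ c → g (suc (suc c))) m
  sumOdd g _             = 0

  sumOdd-cong : ∀ {f g} → (∀ c → f c ≡ g c) → ∀ m → sumOdd f m ≡ sumOdd g m
  sumOdd-cong h 0             = refl
  sumOdd-cong h 1             = refl
  sumOdd-cong h (suc (suc m)) = cong₂ _+_ (h 1) (sumOdd-cong (λ c → h (suc (suc c))) m)

  sumOdd-+ : ∀ f g m → sumOdd (λ c → f c + g c) m ≡ sumOdd f m + sumOdd g m
  sumOdd-+ f g 0             = refl
  sumOdd-+ f g 1             = refl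
  sumOdd-+ f g (suc (suc m)) = trans (cong (λ k → f 1 + g 1 + k) (sumOdd-+ _ _ m)) (r (f 1) (g 1) _ _)
    where
    r : ∀ a b c d → (a + b) + (c + d) ≡ (a + c) + (b + d)
    r = ℕsolve-∀

  sumOdd-0 : ∀ g → (∀ c → g c ≡ 0) → ∀ m → sumOdd g m ≡ 0
  sumOdd-0 g h 0             = refl
  sumOdd-0 g h 1             = refl
  sumOdd-0 g h (suc (suc m)) = cong₂ _+_ (h 1) (sumOdd-0 _ (λ c → h (suc (suc c))) m)

  sumOdd-lt : ∀ a m → a ≤ m → sumOdd (λ c → lt c a) m ≡ ⌊ a /2⌋
  sumOdd-lt 0             m             h             = sumOdd-0 _ (λ _ → refl) m
  sumOdd-lt 1             m             h             = go m
    where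
    go : ∀ m → sumOdd (λ c → lt c 1) m ≡ 0
    go 0             = refl
    go 1             = refl
    go (suc (suc m)) = sumOdd-0 _ (λ _ → refl) m
  sumOdd-lt (suc (suc a)) (suc (suc m)) (s≤s (s≤s h)) = cong suc (sumOdd-lt a m h)

  -- The row pair a ≥ b contributes the odd indices between b and a. The count ⌊b/2⌋ is added on
  -- both sides to keep truncated subtraction out of the induction.
  sumOdd-colLen : ∀ {W} μ k m → length μ ≡ dbl k → Desc W μ → W ≤ m → sumOdd (par ∘ colLen μ) m ≡ hsRows μ
  sumOdd-colLen []          k       m e d h = sumOdd-0 _ (λ _ → refl) m
  sumOdd-colLen (a ∷ [])    (suc k) m () d h
  sumOdd-colLen (a ∷ b ∷ μ) (suc k) m e (ha ∷ (hb ∷ d)) h = ℕₚ.+-cancelˡ-≡ ⌊ b /2⌋ _ _ (trans (cong (_+ S (a ∷ b ∷ μ)) (sym (sumOdd-lt b m (ℕₚ.≤-trans hb (ℕₚ.≤-trans ha h)))))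
    (trans (sym (sumOdd-+ (λ c → lt c b) _ m)) (trans (sumOdd-cong (λ c → par-colLen a b μ c (ha ∷ (hb ∷ d))) m) (trans (sumOdd-+ (λ c → lt c a) _ m)
      (trans (cong₂ _+_ (sumOdd-lt a m (ℕₚ.≤-trans ha h)) (sumOdd-colLen μ k m (suc²-inj e) d (ℕₚ.≤-trans hb (ℕₚ.≤-trans ha h))))
        (trans (cong (_+ hsRows μ) (sym (ℕₚ.m+[n∸m]≡n (ℕₚ.⌊n/2⌋-mono hb)))) (ℕₚ.+-assoc ⌊ b /2⌋ _ _)))))))
    where
    S : Shape → ℕ
    S μ = sumOdd (par ∘ colLen μ) m

  map-upTo-colLen : ∀ μ → conj μ ≡ applyUpTo (colLen μ) (row μ 0)
  map-upTo-colLen μ = map-upTo (colLen μ) (row μ 0)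

  vsRows-applyUpTo : ∀ f m → vsRows (applyUpTo f m) ≡ sumOdd (par ∘ f) m
  vsRows-applyUpTo f 0             = refl
  vsRows-applyUpTo f 1             = refl
  vsRows-applyUpTo f (suc (suc m)) = cong (λ k → par (f 1) + k) (vsRows-applyUpTo (λ c → f (suc (suc c))) m)

  vsRows-conj : ∀ μ k j → length (μ ++ replicate j 0) ≡ dbl k → Desc (row μ 0) (μ ++ replicate j 0) → vsRows (conj μ) ≡ hsRows (μ ++ replicate j 0)
  vsRows-conj μ k j e d = trans (cong vsRows (map-upTo-colLen μ)) (trans (vsRows-applyUpTo (colLen μ) (row μ 0)) (trans (sumOdd-cong (λ c → cong par (sym (colLen-pad μ j c))) (row μ 0)) (sumOdd-colLen (μ ++ replicate j 0) k (row μ 0) e d ℕₚ.≤-refl)))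

  lt-mono : ∀ c a → lt (suc c) a ≤ lt c a
  lt-mono c       zero          = z≤n
  lt-mono zero    (suc zero)    = z≤n
  lt-mono zero    (suc (suc a)) = ℕₚ.≤-refl
  lt-mono (suc c) (suc a)       = lt-mono c a

  colLen-mono : ∀ μ c → colLen μ (suc c) ≤ colLen μ c
  colLen-mono []      c = z≤n
  colLen-mono (a ∷ μ) c = subst₂ _≤_ (sym (colLen-∷ a μ (suc c))) (sym (colLen-∷ a μ c)) (ℕₚ.+-mono-≤ (lt-mono c a) (colLen-mono μ c))

  colLen-pos : ∀ μ {c} → c < row μ 0 → 0 < colLen μ c
  colLen-pos (a ∷ μ) {c} h = subst (0 <_) (sym (trans (colLen-∷ a μ c) (cong (_+ colLen μ c) (lt-< h)))) (s≤s z≤n)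

  conj-partition : ∀ μ → IsPartition (conj μ)
  conj-partition μ = subst IsPartition (sym (map-upTo-colLen μ)) (Allₚ.applyUpTo⁺₁ (colLen μ) (row μ 0) (colLen-pos μ) , Linkedₚ.applyUpTo⁺₂ (colLen μ) (row μ 0) (colLen-mono μ))

-- Shapes as words in a common box, and the final summation.

open BitWords
open Tableaux using (Desc; []; _∷_; signedCount; signedCount-pad; signImbalance-signedCount; when)
open CellRemoval
open Extraction using (eqz)
open Halving
open Coefficients
open Packings

-- The inverse of `rows` on words with W zeros; W is the number of columns still to be passed.
bitsW : ℕ → Shape → Bits
bitsW W []      = replicate W false
bitsW W (a ∷ μ) = replicate (W ∸ a) false ++ true ∷ bitsW a μ

zeros-rep : ∀ k w → zeros (replicate k false ++ w) ≡ k + zeros w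
zeros-rep zero    w = refl
zeros-rep (suc k) w = cong suc (zeros-rep k w)

rows-rep : ∀ k w → rows (replicate k false ++ w) ≡ rows w
rows-rep zero    w = refl
rows-rep (suc k) w = rows-rep k w

zeros-bitsW : ∀ W μ → Desc W μ → zeros (bitsW W μ) ≡ W
zeros-bitsW zero    []      d       = refl
zeros-bitsW (suc W) []      d       = cong suc (zeros-bitsW W [] [])
zeros-bitsW W       (a ∷ μ) (h ∷ d) = trans (zeros-rep (W ∸ a) _) (trans (cong (λ m → (W ∸ a) + m) (zeros-bitsW a μ d)) (ℕₚ.m∸n+n≡m h))

rows-bitsW : ∀ W μ → Desc W μ → rows (bitsW W μ) ≡ μ
rows-bitsW zero    []      d       = refl
rows-bitsW (suc W) []      d       = rows-bitsW W [] []
rows-bitsW W       (a ∷ μ) (h ∷ d) = trans (rows-rep (W ∸ a) _) (cong₂ _∷_ (zeros-bitsW a μ d) (rows-bitsW a μ d))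

bitsW-rows : ∀ w → w ≡ bitsW (zeros w) (rows w)
bitsW-rows []          = refl
bitsW-rows (true ∷ w)  = trans (cong (true ∷_) (bitsW-rows w)) (cong (λ k → replicate k false ++ true ∷ bitsW (zeros w) (rows w)) (sym (ℕₚ.n∸n≡0 (zeros w))))
bitsW-rows (false ∷ w) = trans (cong (false ∷_) (bitsW-rows w)) (go (rows w) (Desc-rows w))
  where
  go : ∀ {W} μ → Desc W μ → false ∷ bitsW W μ ≡ bitsW (suc W) μ
  go []      d = refl
  go (a ∷ μ) (h ∷ _) = cong (λ k → replicate k false ++ true ∷ bitsW a μ) (sym (ℕₚ.+-∸-assoc 1 h))

padTo : ℕ → Shape → Shape
padTo N μ = μ ++ replicate (N ∸ length μ) 0

row-pad : ∀ μ k r → row (μ ++ replicate k 0) r ≡ row μ r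
row-pad []      zero    r       = refl
row-pad []      (suc k) zero    = refl
row-pad []      (suc k) (suc r) = row-pad [] k r
row-pad (a ∷ μ) k       zero    = refl
row-pad (a ∷ μ) k       (suc r) = row-pad μ k r

Desc-pad : ∀ {W} μ k → Desc W μ → Desc W (μ ++ replicate k 0)
Desc-pad []      zero    d       = []
Desc-pad []      (suc k) d       = z≤n ∷ Desc-pad [] k []
Desc-pad (a ∷ μ) k       (h ∷ d) = h ∷ Desc-pad μ k d

sum-pad : ∀ μ k → sum (μ ++ replicate k 0) ≡ sum μ
sum-pad []      zero    = refl
sum-pad []      (suc k) = sum-pad [] k
sum-pad (a ∷ μ) k       = cong (λ m → a + m) (sum-pad μ k)

vsRows-pad : ∀ μ k → vsRows (μ ++ replicate k 0) ≡ vsRows μ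
vsRows-pad []          0             = refl
vsRows-pad []          1             = refl
vsRows-pad []          (suc (suc k)) = vsRows-pad [] k
vsRows-pad (a ∷ [])    zero          = refl
vsRows-pad (a ∷ [])    (suc k)       = vsRows-pad [] k
vsRows-pad (a ∷ b ∷ μ) k             = cong (λ m → par b + m) (vsRows-pad μ k)

length-padTo : ∀ N μ → length μ ≤ N → length (padTo N μ) ≡ N
length-padTo N μ h = trans (length-++ μ) (trans (cong (λ m → length μ + m) (length-replicate (N ∸ length μ))) (ℕₚ.m+[n∸m]≡n h))

length-≤-sum : ∀ {μ} → All (0 <_) μ → length μ ≤ sum μ
length-≤-sum []       = z≤n
length-≤-sum (h ∷ hs) = ℕₚ.+-mono-≤ h (length-≤-sum hs)

-- Recovers a partition from its padded list of rows.
trim : Shape → Shape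
trim []          = []
trim (zero ∷ μ)  = []
trim (suc a ∷ μ) = suc a ∷ trim μ

trim-pad : ∀ {μ} k → All (0 <_) μ → trim (μ ++ replicate k 0) ≡ μ
trim-pad {[]}        zero    []       = refl
trim-pad {[]}        (suc k) []       = refl
trim-pad {suc a ∷ μ} k       (_ ∷ hs) = cong (suc a ∷_) (trim-pad k hs)

trim-pos : ∀ μ → All (0 <_) (trim μ)
trim-pos []          = []
trim-pos (zero ∷ μ)  = []
trim-pos (suc a ∷ μ) = s≤s z≤n ∷ trim-pos μ

trim-Desc : ∀ {W} μ → Desc W μ → Desc W (trim μ)
trim-Desc []          d       = []
trim-Desc (zero ∷ μ)  d       = []
trim-Desc (suc a ∷ μ) (h ∷ d) = h ∷ trim-Desc μ d

trim-partition : ∀ {W} μ → Desc W μ → IsPartition (trim μ)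
trim-partition μ d = trim-pos μ , Desc-Linked (trim-Desc μ d)

padTo-trim : ∀ {W} μ → Desc W μ → padTo (length μ) (trim μ) ≡ μ
padTo-trim []          d       = refl
padTo-trim (zero ∷ μ)  (_ ∷ d) = cong (0 ∷_) (zs μ d)
  where
  zs : ∀ μ → Desc 0 μ → replicate (length μ) 0 ≡ μ
  zs []       d        = refl
  zs (.0 ∷ μ) (z≤n ∷ d) = cong (0 ∷_) (zs μ d)
padTo-trim (suc a ∷ μ) (h ∷ d) = cong (suc a ∷_) (padTo-trim μ d)

δ-ne : ∀ w u → w ≢ u → δ w u ≡ + 0
δ-ne []          []          n = ⊥-elim (n refl)
δ-ne []          (_ ∷ _)     n = refl
δ-ne (true ∷ w)  []          n = refl
δ-ne (false ∷ w) []          n = refl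
δ-ne (true ∷ w)  (true ∷ u)  n = δ-ne w u (n ∘ cong (true ∷_))
δ-ne (false ∷ w) (false ∷ u) n = δ-ne w u (n ∘ cong (false ∷_))
δ-ne (true ∷ w)  (false ∷ u) n = refl
δ-ne (false ∷ w) (true ∷ u)  n = refl

sumOver : ∀ {A : Set} → (A → ℤ) → List A → ℤ
sumOver f L = sumℤ (map f L)

addCells-sum : ∀ {A : Set} n (g : A → Bits → ℤ) L w → addCells n (λ u → sumOver (λ a → g a u) L) w ≡ sumOver (λ a → addCells n (g a) w) L
addCells-sum n g []      w = addCells-0 n _ (λ _ → refl) w
addCells-sum n g (a ∷ L) w = trans (addCells-+ n (g a) _ w) (cong (addCells n (g a) w +ᶻ_) (addCells-sum n g L w))

sumOver-cong : ∀ {A : Set} (f g : A → ℤ) L → (∀ {a} → a ∈ L → f a ≡ g a) → sumOver f L ≡ sumOver g L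
sumOver-cong f g []      h = refl
sumOver-cong f g (a ∷ L) h = cong₂ _+ᶻ_ (h (here refl)) (sumOver-cong f g L (h ∘ there))

sumOver-0 : ∀ {A : Set} (f : A → ℤ) L → (∀ {a} → a ∈ L → f a ≡ + 0) → sumOver f L ≡ + 0
sumOver-0 f []      h = refl
sumOver-0 f (a ∷ L) h = cong₂ _+ᶻ_ (h (here refl)) (sumOver-0 f L (h ∘ there))

sumOver-1 : ∀ {A : Set} (f : A → ℤ) L a → Unique L → a ∈ L → f a ≡ + 1 → (∀ {b} → b ∈ L → b ≢ a → f b ≡ + 0) → sumOver f L ≡ + 1
sumOver-1 f (a ∷ L) .a (u ∷ us) (here refl) e h = cong₂ _+ᶻ_ e (sumOver-0 f L (λ {b} m → h (there m) (λ p → All.lookup u m (sym p))))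
sumOver-1 f (b ∷ L) a (u ∷ us) (there m) e h = cong₂ _+ᶻ_ (h (here refl) (All.lookup u m)) (sumOver-1 f L a us m e (h ∘ there))

halves : Shape → List ℕ
halves []          = []
halves (a ∷ [])    = ⌊ a /2⌋ ∷ []
halves (a ∷ _ ∷ μ) = ⌊ a /2⌋ ∷ halves μ

row-halves : ∀ μ i → row (halves μ) i ≡ ⌊ row μ (dbl i) /2⌋
row-halves []          i       = refl
row-halves (a ∷ [])    zero    = refl
row-halves (a ∷ [])    (suc i) = refl
row-halves (a ∷ _ ∷ μ) zero    = refl
row-halves (a ∷ _ ∷ μ) (suc i) = row-halves μ i

length-halves : ∀ μ m → length μ ≡ dbl m → length (halves μ) ≡ m
length-halves []          zero    e = refl
length-halves (_ ∷ _ ∷ μ) (suc m) e = cong suc (length-halves μ m (suc²-inj e))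
length-halves (_ ∷ [])    (suc m) ()

Desc-halves : ∀ {W} μ → Desc W μ → Desc ⌊ W /2⌋ (halves μ)
Desc-halves []          d             = []
Desc-halves (a ∷ [])    (h ∷ d)       = ℕₚ.⌊n/2⌋-mono h ∷ []
Desc-halves (a ∷ b ∷ μ) (h ∷ (l ∷ d)) = ℕₚ.⌊n/2⌋-mono h ∷ Desc-halves μ (Desc-≤ l d)

eqz-dec : ∀ m n → (eqz m n ≡ + 1 × m ≡ n) ⊎ (eqz m n ≡ + 0 × m ≢ n)
eqz-dec m n with m ≡ᵇ n in e
... | true  = inj₁ (refl , ≡ᵇ-≡ m n e)
... | false = inj₂ (refl , λ { refl → t≢f (trans (sym (≡ᵇ-refl m)) e) })
  where
  t≢f : true ≡ false → ⊥
  t≢f ()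

Match : List ℕ → Shape → Set
Match ks ν = ∀ i → row ks i ≡ ⌊ row ν (suc (dbl i)) /2⌋

match-dec : ∀ ks ν → length ν ≡ dbl (length ks) → (matchZ ks ν ≡ + 1 × Match ks ν) ⊎ (matchZ ks ν ≡ + 0 × ¬ Match ks ν)
match-dec []       []          e = inj₁ (refl , λ _ → refl)
match-dec (k ∷ ks) (a ∷ [])    ()
match-dec (k ∷ ks) (a ∷ b ∷ ν) e with eqz-dec k ⌊ b /2⌋
... | inj₂ (z , n) = inj₂ (trans (cong (_*ᶻ matchZ ks ν) z) (ℤₚ.*-zeroˡ (matchZ ks ν)) , λ m → n (m 0))
... | inj₁ (z , p) with match-dec ks ν (suc²-inj e)
...   | inj₁ (y , m) = inj₁ (cong₂ _*ᶻ_ z y , λ { zero → p ; (suc i) → m i })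
...   | inj₂ (y , n) = inj₂ (trans (cong (eqz k ⌊ b /2⌋ *ᶻ_) y) (ℤₚ.*-zeroʳ (eqz k ⌊ b /2⌋)) , λ m → n (m ∘ suc))

χ-dec : ∀ ks h v u → length (rows u) ≡ dbl (length ks) →
  (χ ks h v u ≡ + 1 × (Match ks (rows u) × hsRows (rows u) ≡ h × vsRows (rows u) ≡ v)) ⊎ (χ ks h v u ≡ + 0 × ¬ (Match ks (rows u) × hsRows (rows u) ≡ h × vsRows (rows u) ≡ v))
χ-dec ks h v u e with match-dec ks (rows u) e | eqz-dec (hsRows (rows u)) h | eqz-dec (vsRows (rows u)) v
... | inj₁ (a , m) | inj₁ (b , p) | inj₁ (c , r) = inj₁ (cong₂ _*ᶻ_ a (cong₂ _*ᶻ_ b c) , m , p , r)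
... | inj₂ (a , n) | _ | _ = inj₂ (trans (cong (_*ᶻ y) a) (ℤₚ.*-zeroˡ y) , λ { (m , _) → n m })
  where y = eqz (hsRows (rows u)) h *ᶻ eqz (vsRows (rows u)) v
... | inj₁ _ | inj₂ (b , n) | _ = inj₂ (trans (cong (matchZ ks (rows u) *ᶻ_) (trans (cong (_*ᶻ eqz (vsRows (rows u)) v) b) (ℤₚ.*-zeroˡ (eqz (vsRows (rows u)) v)))) (ℤₚ.*-zeroʳ (matchZ ks (rows u))) , λ { (_ , p , _) → n p })
... | inj₁ _ | inj₁ _ | inj₂ (c , n) = inj₂ (trans (cong (matchZ ks (rows u) *ᶻ_) (trans (cong (eqz (hsRows (rows u)) h *ᶻ_) c) (ℤₚ.*-zeroʳ (eqz (hsRows (rows u)) h)))) (ℤₚ.*-zeroʳ (matchZ ks (rows u))) , λ { (_ , _ , r) → n r })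

χ-vanish-nonempty : ∀ K ks n h v → length ks ≡ suc K → row ks 0 ≢ 0 → Desc (suc K) ks → n ≤ K + suc K →
  addCells n (χ ks h v) (emptyWord (suc K + suc K) (suc K + suc K)) ≡ + 0
χ-vanish-nonempty K (zero ∷ ks)  n h v e nz d le = ⊥-elim (nz refl)
χ-vanish-nonempty K (suc k ∷ ks) n h v e nz d le = χ-vanish K k ks n h v (ℕₚ.suc-injective e) d le

module _ (D : Shape) (fD : IsFourlingShape D) (nD : D ≢ []) (h v s : ℕ) where

  private
    n N : ℕ
    n = size D + s
    -- An even side lets the words be cut into sites; twice n + 1 holds every shape with n cells and
    -- leaves the end sites untouched throughout the induction.
    N = suc n + suc n
    ks : List ℕ
    ks = halves (padTo N D)
    word : Shape → Bits
    word μ = bitsW N (padTo N μ)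
    Cond : Shape → Set
    Cond μ = IsPartition μ × IsFourlingBody D μ × size μ ≡ size D + s × HS μ h × VS μ v
    Good : Shape → Set
    Good ν = Match ks ν × hsRows ν ≡ h × vsRows ν ≡ v

  n≤N : n ≤ N
  n≤N = ℕₚ.≤-trans (ℕₚ.n≤1+n n) (ℕₚ.m≤m+n (suc n) (suc n))

  row0-≤-sum : ∀ μ → row μ 0 ≤ sum μ
  row0-≤-sum []      = z≤n
  row0-≤-sum (a ∷ μ) = ℕₚ.m≤m+n a (sum μ)

  padTo-Desc : ∀ {μ} → IsPartition μ → size μ ≤ N → Desc N (padTo N μ)
  padTo-Desc {μ} p h = Desc-pad μ _ (Desc-≤ (ℕₚ.≤-trans (row0-≤-sum μ) h) (partition-Desc p))

  padTo-len : ∀ {μ} → IsPartition μ → size μ ≤ N → length (padTo N μ) ≡ N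
  padTo-len {μ} (p , _) h = length-padTo N μ (ℕₚ.≤-trans (length-≤-sum p) h)

  D≤N : size D ≤ N
  D≤N = ℕₚ.≤-trans (ℕₚ.m≤m+n (size D) s) n≤N

  length-ks : length ks ≡ suc n
  length-ks = length-halves (padTo N D) (suc n) (trans (padTo-len (proj₁ fD) D≤N) (double-dbl (suc n)))

  Desc-ks : Desc (suc n) ks
  Desc-ks = subst (λ m → Desc m ks) (trans (cong ⌊_/2⌋ (double-dbl (suc n))) (half-dbl (suc n))) (Desc-halves (padTo N D) (padTo-Desc (proj₁ fD) D≤N))

  row-ks : ∀ i → row ks i ≡ ⌊ row D (dbl i) /2⌋
  row-ks i = trans (row-halves (padTo N D) i) (cong ⌊_/2⌋ (row-pad D _ (dbl i)))

  ks-nz : row ks 0 ≢ 0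
  ks-nz e = go D fD nD (trans (sym (row-ks 0)) e)
    where
    go : ∀ D → IsFourlingShape D → D ≢ [] → ⌊ row D 0 /2⌋ ≡ 0 → ⊥
    go []      f nD e = nD refl
    go (a ∷ D) f nD e with proj₁ (proj₁ f) | trans (proj₂ (fourling-rows f 0)) (cong dbl e)
    go (.0 ∷ D) f nD e | () ∷ _ | refl

  word-rows : ∀ {μ} → IsPartition μ → size μ ≡ n → rows (word μ) ≡ padTo N μ
  word-rows p e = rows-bitsW N _ (padTo-Desc p (subst (_≤ N) (sym e) n≤N))

  word-cls : ∀ {μ} → IsPartition μ → size μ ≡ n → Class N N n (word μ)
  word-cls {μ} p e = cls (trans (sym (length-rows (word μ))) (trans (cong length (word-rows p e)) (padTo-len p le)))
    (zeros-bitsW N _ (padTo-Desc p le)) (trans (sym (sum-rows (word μ))) (trans (cong sum (word-rows p e)) (trans (sum-pad μ _) e)))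
    where
    le = subst (_≤ N) (sym e) n≤N

  vsRows-conj′ : ∀ {μ} → IsPartition μ → size μ ≡ n → vsRows (conj μ) ≡ hsRows (padTo N μ)
  vsRows-conj′ {μ} p e = vsRows-conj μ (suc n) (N ∸ length μ) (trans (padTo-len p (subst (_≤ N) (sym e) n≤N)) (double-dbl (suc n))) (Desc-pad μ _ (partition-Desc p))

  Cond-Good : ∀ {μ} → Cond μ → Good (padTo N μ)
  Cond-Good {μ} (p , fb , e , hs , vs) =
    (λ i → trans (row-ks i) (trans (cong ⌊_/2⌋ (proj₁ (b i))) (trans (half-dbl _) (cong ⌊_/2⌋ (sym (row-pad μ _ (suc (dbl i))))))))
    , sym (trans (VS⇒vsRows (conj-partition μ) hs) (vsRows-conj′ p e)) , sym (trans (VS⇒vsRows p vs) (sym (vsRows-pad μ _)))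
    where
    b = body⇒rows p fb

  Good-Cond : ∀ {μ} → IsPartition μ → size μ ≡ n → Good (padTo N μ) → Cond μ
  Good-Cond {μ} p e (m , hs , vs) = p , rows⇒body p fD (λ i → eq i , trans (proj₁ (fourling-rows fD i)) (eq i)) , e
    , subst (HS μ) (trans (vsRows-conj′ p e) hs) (vsRows⇒VS (conj-partition μ)) , subst (VS μ) (trans (sym (vsRows-pad μ _)) vs) (vsRows⇒VS p)
    where
    eq : ∀ i → row D (dbl i) ≡ body μ i
    eq i = trans (proj₂ (fourling-rows fD i)) (cong dbl (trans (sym (row-ks i)) (trans (m i) (cong ⌊_/2⌋ (row-pad μ _ (suc (dbl i)))))))

  module _ (L : List Shape) (uL : Unique L) (hL : ∀ μ → (μ ∈ L) ⇔ Cond μ) where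

    cond : ∀ {μ} → μ ∈ L → Cond μ
    cond {μ} = Equivalence.to (hL μ)

    -- The word `u` belongs to exactly one partition, `trim (rows u)`. As `L` lists the admissible
    -- shapes without repetition, the sum is 1 or 0 according to whether that partition is
    -- admissible, which `χ` reads off the rows.
    sum-δ : ∀ u → Class N N n u → sumOver (λ μ → δ (word μ) u) L ≡ χ ks h v u
    sum-δ u (cls a b c) = go (χ-dec ks h v u (trans len (trans (double-dbl (suc n)) (cong dbl (sym length-ks)))))
      where
      ν = rows u
      μ = trim ν
      dν : Desc N ν
      dν = subst (λ m → Desc m ν) b (Desc-rows u)
      len : length ν ≡ N
      len = trans (length-rows u) a
      pμ : IsPartition μ
      pμ = trim-partition ν dν
      pad : padTo N μ ≡ ν
      pad = subst (λ m → padTo m μ ≡ ν) len (padTo-trim ν dν)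
      sz : size μ ≡ n
      sz = trans (sym (sum-pad μ _)) (trans (cong sum pad) (trans (sum-rows u) c))
      wu : word μ ≡ u
      wu = trans (cong (bitsW N) pad) (trans (cong (λ m → bitsW m ν) (sym b)) (sym (bitsW-rows u)))
      rows-of : ∀ {κ} → κ ∈ L → word κ ≡ u → padTo N κ ≡ ν
      rows-of {κ} m e = trans (sym (word-rows (proj₁ (cond m)) (proj₁ (proj₂ (proj₂ (cond m)))))) (cong rows e)
      go : (χ ks h v u ≡ + 1 × Good ν) ⊎ (χ ks h v u ≡ + 0 × ¬ Good ν) → sumOver (λ μ → δ (word μ) u) L ≡ χ ks h v u
      go (inj₁ (e , g)) = trans (sumOver-1 _ L μ uL (Equivalence.from (hL μ) (Good-Cond pμ sz (subst Good (sym pad) g))) (trans (cong (λ w → δ w u) wu) (δ-refl u))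
        (λ {κ} m ne → δ-ne (word κ) u (λ e → ne (trans (sym (trim-pad _ (proj₁ (proj₁ (cond m))))) (cong trim (rows-of m e)))))) (sym e)
      go (inj₂ (e , ng)) = trans (sumOver-0 _ L (λ {κ} m → δ-ne (word κ) u (λ e → ng (subst Good (rows-of m e) (Cond-Good (cond m)))))) (sym e)

    result : sumℤ (map signImbalance L) ≡ + 0
    result = begin
      sumOver signImbalance L                                ≡⟨ sumOver-cong _ _ L (λ {μ} m → si m) ⟩
      sumOver (λ μ → addCells n (δ (word μ)) (emptyWord N N)) L ≡⟨ sym (addCells-sum n (λ μ → δ (word μ)) L (emptyWord N N)) ⟩
      addCells n (λ u → sumOver (λ μ → δ (word μ) u) L) (emptyWord N N)
        ≡⟨ addCells-class n 0 _ _ (λ u cu → sum-δ u (subst (λ m → Class N N m u) (ℕₚ.+-identityʳ n) cu)) (emptyWord N N) (cls-empty N N) ⟩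
      -- The box parameter K is n itself, and the bound n ≤ K + suc K is immediate.
      addCells n (χ ks h v) (emptyWord N N)                    ≡⟨ χ-vanish-nonempty n ks n h v length-ks ks-nz Desc-ks (ℕₚ.m≤m+n n (suc n)) ⟩
      + 0 ∎
      where
      open ≡-Reasoning
      si : ∀ {μ} → μ ∈ L → signImbalance μ ≡ addCells n (δ (word μ)) (emptyWord N N)
      si {μ} m with cond m
      ... | p , _ , e , _ = trans (signImbalance-signedCount μ) (trans (cong (λ k → signedCount k μ) e) (trans (sym (signedCount-pad n μ (N ∸ length μ))) (trans (cong (signedCount n) (sym (word-rows p e))) (sym (addCells-δ N N n (word μ) (word-cls p e))))))

theorem3p3 : (D : Shape) → IsFourlingShape D → D ≢ [] → (h v s : ℕ)
    → (L : List Shape) → Unique L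
    → (∀ μ → (μ ∈ L) ⇔ (IsPartition μ × IsFourlingBody D μ × size μ ≡ size D + s × HS μ h × VS μ v))
    → sumℤ (map signImbalance L) ≡ + 0
theorem3p3 = result
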